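{- Let $\iota\subseteq S_{2n}$ be the set of twisted identities, ordered by the Bruhat order, and let $S_\iota$ be the set of all special partial matchings of all lower intervals $\iota_{\le w}$, $w\in\iota\setminus\{e\}$. For each $x\in\{q,-1\}$, the family of Kazhdan--Lusztig $R^x$-polynomials of the pircon system $(\iota,S_\iota)$ satisfies the up-down symmetry. (Equivalently, the Kazhdan--Lusztig--Vogan $R$-polynomials and $Q$-polynomials for the action of $\mathrm{Sp}(2n,\mathbb C)$ on the flag variety of $\mathrm{SL}(2n,\mathbb C)$ satisfy the up-down symmetry.)
   Context: $S_{2n}$ is the symmetric group with Coxeter generators $s_i=(i,i+1)$, $1\le i\le 2n-1$, and Bruhat order. Let $\theta$ be the involutive automorphism of $S_{2n}$ with $\theta(s_i)=s_{2n-i}$. The set of twisted identities is $\iota=\{\theta(w^{ -1})w : w\in S_{2n}\}$, with the order induced from Bruhat order and identity $e$ as minimum. For elements of a poset, $x\lhd y$ means $y$ covers $x$; $P_{\le x}=\{y: y\le x\}$. A quasi special partial matching of a poset $P$ is an involution $M:P\to P$ with, for every $x$, $M(x)\lhd x$, $M(x)=x$ or $M(x)\rhd x$, and such that $x\lhd y$, $M(x)\ne y$ imply $M(x)<M(y)$. If $P$ is finite with maximum $\hat1_P$, a special partial matching of $P$ is a quasi special partial matching with $M(\hat1_P)\lhd\hat1_P$. A pircon is a poset such that every $P_{\le x}$, $x$ non-minimal, is finite and admits a special partial matching; pircons are connected, graded, with minimum $\hat0_P$. For quasi special partial matchings $M,N$ of $P_{\le w}$, every orbit $\mathcal O$ of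 $\langle M,N\rangle$ is an interval and is either dihedral (isomorphic to a Bruhat interval of a rank-2 Coxeter group, no point fixed by $M$ or $N$) or chain-like (a chain whose minimum and maximum are each fixed by $M$ or $N$); $m(\mathcal O)$ is the rank of $\mathcal O$, plus $1$ if chain-like. $M,N$ are strictly coherent if $m(\mathcal O)\mid m(\langle M,N\rangle(w))$ for all orbits; special partial matchings of $w$ are coherent if joined by a sequence of special partial matchings of $w$ with consecutive ones strictly coherent. A dircon is a pircon in which any two special partial matchings of $P_{\le w}$ are coherent, for every $w$. It is known that $\iota$ is a dircon, so $(\iota,S_\iota)$ is a pircon system (i.e. every $w\neq\hat0$ has a special partial matching $M$ of $P_{\le w}$, necessarily with $M(w)\lhd w$, and any two such are coherent). $R^x$-polynomials of a pircon system $(P,S)$ ($x\in\{q,-1\}$): choosing for each $w\ne\hat0_P$ some $M_w\in S$ defined on $P_{\le w}$ with $M_w(w)\lhd w$, $\{R^x_{u,w}\}\subseteq\mathbb Z[q]$ is the unique family with $R^x_{u,w}=0$ if $u\not\le w$, $R^x_{w,w}=1$, and for $u\le w$: $R^x_{u,w}=R^x_{M_w(u),M_w(w)}$ if $M_w(u)\lhd u$; $=(q-1)R^x_{u,M_w(w)}+qR^x_{M_w(u),M_w(w)}$ if $M_w(u)\rhd u$; $=(q-1-x)R^x_{u,M_w(w)}$ if $M_w(u)=u$; it is known to be independent of the choices. For $\iota$ it is known that the $R^q$- and $R^{ -1}$-polynomials are respectively the Kazhdan--Lusztig--Vogan $R$- and $Q$-polynomials for the action of $\mathrm{Sp}(2n,\mathbb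 C)$ on the flag variety of $\mathrm{SL}(2n,\mathbb C)$. Up-down symmetry: for all $M\in S$ and $u,w$ in the domain of $M$ with $M(u)\rhd u$: $R^x_{u,w}=R^x_{M(u),M(w)}$ if $M(w)\rhd w$; $R^x_{u,w}=(q-1)R^x_{M(u),w}+qR^x_{M(u),M(w)}$ if $M(w)\lhd w$; $R^x_{u,w}=(q-1-x)R^x_{M(u),w}$ if $M(w)=w$. -}

module Defs where

open import Data.Nat using (ℕ; zero; suc; _+_; _*_)
import Data.Nat as ℕ
open import Data.Integer as ℤ using (ℤ)
open import Data.Fin using (Fin; opposite; _≟_; _<?_)
import Data.Fin as F
open import Data.Vec using (Vec; lookup; tabulate)
open import Data.List using (List; []; _∷_; map; concatMap; allFin)
open import Data.Nat.ListAction using (sum)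
open import Data.Bool using (Bool; true; false; if_then_else_; _∧_)
open import Data.Product using (Σ; ∃; _×_; _,_; proj₁; proj₂)
open import Data.Sum using (_⊎_)
open import Relation.Nullary using (¬_)
open import Relation.Nullary.Decidable using (⌊_⌋)
open import Relation.Binary.PropositionalEquality using (_≡_; _≢_)
open import Relation.Binary.Construct.Closure.ReflexiveTransitive using (Star)

-- Permutations of {0,…,m-1} as vectors of images (one-line notation)

Word : ℕ → Set
Word m = Vec (Fin m) m

idW : (m : ℕ) → Word m
idW m = tabulate (λ k → k)

_∘W_ : ∀ {m} → Word m → Word m → Word m
p ∘W r = tabulate (λ k → lookup p (lookup r k))

swapF : ∀ {m} → Fin m → Fin m → Fin m → Fin m
swapF i j k = if ⌊ k ≟ i ⌋ then j else (if ⌊ k ≟ j ⌋ then i else k)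

_·⟨_,_⟩ : ∀ {m} → Word m → Fin m → Fin m → Word m
w ·⟨ i , j ⟩ = tabulate (λ k → lookup w (swapF i j k))

allPairs : (m : ℕ) → List (Fin m × Fin m)
allPairs m = concatMap (λ i → map (λ j → (i , j)) (allFin m)) (allFin m)

len : ∀ {m} → Word m → ℕ
len {m} w = sum (map (λ p → if ⌊ proj₁ p <? proj₂ p ⌋ ∧ ⌊ lookup w (proj₂ p) <? lookup w (proj₁ p) ⌋
                            then 1 else 0) (allPairs m))

BruhatStep : ∀ {m} → Word m → Word m → Set
BruhatStep {m} u w = Σ (Fin m) λ i → Σ (Fin m) λ j →
  (i F.< j) × (u ≡ w ·⟨ i , j ⟩) × (len u ℕ.< len w)

_≤B_ : ∀ {m} → Word m → Word m → Set
_≤B_ = Star BruhatStep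

-- S_{2n}, the involution θ (θ(s_i) = s_{2n-i}, i.e. conjugation by w₀),
-- and twisted identities

W : ℕ → Set
W n = Word (2 * n)

e : (n : ℕ) → W n
e n = idW (2 * n)

θ : ∀ {m} → Word m → Word m
θ v = tabulate (λ i → opposite (lookup v (opposite i)))

-- v is a twisted identity: v = θ(w⁻¹) w for some permutation w
-- (u is w⁻¹: a left inverse of w, hence w is a bijection and u = w⁻¹)
Twisted : (n : ℕ) → W n → Set
Twisted n v = Σ (W n) λ w → Σ (W n) λ u →
  (∀ i → lookup u (lookup w i) ≡ i) × (v ≡ θ u ∘W w)

_<ι_ : ∀ {m} → Word m → Word m → Set
u <ι w = (u ≤B w) × (u ≢ w)

Cov : (n : ℕ) → W n → W n → Set
Cov n x y = (x <ι y) × (∀ z → Twisted n z → x ≤B z → z ≤B y → (z ≡ x) ⊎ (z ≡ y))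

InDom : (n : ℕ) → W n → W n → Set
InDom n w x = Twisted n x × (x ≤B w)

-- quasi special partial matching of ι_{≤ w} (M given as a map on words,
-- only its values on ι_{≤ w} matter)
record QSPM (n : ℕ) (w : W n) (M : W n → W n) : Set where
  field
    closed  : ∀ x → InDom n w x → InDom n w (M x)
    invol   : ∀ x → InDom n w x → M (M x) ≡ x
    local   : ∀ x → InDom n w x → Cov n (M x) x ⊎ (M x ≡ x) ⊎ Cov n x (M x)
    compat  : ∀ x y → InDom n w x → InDom n w y → Cov n x y → M x ≢ y → M x <ι M y

record SPM (n : ℕ) (w : W n) (M : W n → W n) : Set where
  field
    qspm : QSPM n w M
    top  : Cov n (M w) w

Poly : Set
Poly = List ℤ

coeff : Poly → ℕ → ℤ
coeff []      _       = ℤ.0ℤ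
coeff (a ∷ p) zero    = a
coeff (a ∷ p) (suc k) = coeff p k

_≈P_ : Poly → Poly → Set
p ≈P r = ∀ k → coeff p k ≡ coeff r k

_⊕_ : Poly → Poly → Poly
[]      ⊕ r       = r
(a ∷ p) ⊕ []      = a ∷ p
(a ∷ p) ⊕ (b ∷ r) = (a ℤ.+ b) ∷ (p ⊕ r)

scale : ℤ → Poly → Poly
scale a = Data.List.map (a ℤ.*_)

negP : Poly → Poly
negP = scale (ℤ.- ℤ.1ℤ)

_⊗_ : Poly → Poly → Poly
[]      ⊗ r = []
(a ∷ p) ⊗ r = scale a r ⊕ (ℤ.0ℤ ∷ (p ⊗ r))

0P 1P qP : Poly
0P = []
1P = ℤ.1ℤ ∷ []
qP = ℤ.0ℤ ∷ ℤ.1ℤ ∷ []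

qm1 : Poly
qm1 = qP ⊕ negP 1P

data XPar : Set where
  x=q x=-1 : XPar

xPoly : XPar → Poly
xPoly x=q  = qP
xPoly x=-1 = negP 1P

qm1mx : XPar → Poly
qm1mx x = qm1 ⊕ negP (xPoly x)

IsRFamily : (n : ℕ) → XPar → (Mch : W n → W n → W n) → (R : W n → W n → Poly) → Set
IsRFamily n x Mch R =
    (∀ u w → Twisted n u → Twisted n w → ¬ (u ≤B w) → R u w ≈P 0P)
  × (∀ w → Twisted n w → R w w ≈P 1P)
  × (∀ u w → Twisted n u → Twisted n w → w ≢ e n → u ≤B w →
       let M = Mch w in
         (Cov n (M u) u → R u w ≈P R (M u) (M w))
       × (Cov n u (M u) → R u w ≈P ((qm1 ⊗ R u (M w)) ⊕ (qP ⊗ R (M u) (M w))))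
       × (M u ≡ u → R u w ≈P (qm1mx x ⊗ R u (M w))))

UpDown : (n : ℕ) → XPar → (R : W n → W n → Poly) → Set
UpDown n x R =
  ∀ v M → Twisted n v → v ≢ e n → SPM n v M →
  ∀ u w → InDom n v u → InDom n v w → Cov n u (M u) →
      (Cov n w (M w) → R u w ≈P R (M u) (M w))
    × (Cov n (M w) w → R u w ≈P ((qm1 ⊗ R (M u) w) ⊕ (qP ⊗ R (M u) (M w))))
    × (M w ≡ w → R u w ≈P (qm1mx x ⊗ R (M u) w))

-- The map x ↦ w₀ x identifies ι with the fixed-point-free involutions of a set of 2n points, the
-- generators acting by conjugation. An element of rank at least 3 has at least two coatoms and is
-- determined by them, so two matchings that commute at e commute everywhere and two matchings that
-- agree on the elements of rank at most 1 are equal. Comparing values on atoms, every special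
-- partial matching M of w is then a conjugation or commutes with the conjugation s by some descent
-- of w such that M(w) ≠ s(w).
--
-- Write A_M for the Hecke operator on functions of u given by the right-hand sides of the recursion.
-- By induction on the rank of w, R_w = A_M R_{M(w)} if M(w) ◁ w, and A_M R_w = (q - 1 - x) R_w if
-- M(w) = w, for every quasi special partial matching M of w: the equation is carried from one
-- matching to another through elements below w, by commutation or, for two conjugations, by the
-- braid relation of the operators. Reading these equations at M(u) gives the up-down symmetry.
module Submission where

open import Defs
open import Data.Nat using (ℕ; zero; suc; _+_; _*_; _∸_; _≤_; _<_; z≤n; s≤s; z<s; s≤s⁻¹; ⌊_/2⌋; _≟_; _<?_)
open import Data.Nat.Properties hiding (_≟_; _<?_)
open import Data.Nat.ListAction using () renaming (sum to sumᴸ)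
open import Data.Nat.ListAction.Properties using (sum-++)
open import Data.Nat.Tactic.RingSolver using (solve-∀)
open import Data.Integer as ℤ using (ℤ; 0ℤ; -[1+_]) renaming (+_ to pos; _+_ to _+ᶻ_; -_ to -ᶻ_; _-_ to _-ᶻ_; pred to predᶻ)
import Data.Integer.Properties as ℤₚ
open import Data.Integer.Tactic.RingSolver using () renaming (solve-∀ to solveᶻ)
open import Data.Fin as F using (Fin; toℕ; fromℕ<; opposite)
open import Data.Fin.Properties using (toℕ-injective; toℕ<n; toℕ-fromℕ<; fromℕ<-toℕ; opposite-prop; opposite-involutive; pigeonhole; any?)
open import Data.Fin.Permutation using (Permutation; permutation)
open import Algebra.Properties.CommutativeMonoid.Sum +-0-commutativeMonoid using (sum; sum-permute; sum-cong-≗)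
open import Data.Bool using (true; false; if_then_else_; _∧_)
open import Data.List as List using (List; []; _∷_; map; concatMap; allFin)
open import Data.List.Properties using (map-++; map-tabulate; map-∘)
open import Data.Vec using (lookup; tabulate)
open import Data.Vec.Properties using (lookup∘tabulate; tabulate∘lookup; tabulate-cong; ≡-dec)
open import Data.Product using (Σ; ∃; ∃₂; _×_; _,_; proj₁; proj₂)
open import Data.Sum using (_⊎_; inj₁; inj₂; [_,_]′)
open import Data.Empty using (⊥; ⊥-elim)
open import Data.Unit using (⊤; tt)
open import Relation.Nullary using (¬_; Dec; yes; no; recompute)
open import Relation.Nullary.Decidable using (⌊_⌋; map′; _×-dec_; ¬?)
open import Relation.Binary.PropositionalEquality
open import Relation.Binary.Definitions using (tri<; tri≈; tri>)
open import Relation.Binary.Construct.Closure.ReflexiveTransitive using (ε; _◅_; _◅◅_)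

-- The obstacle is that atoms do not pin down a generator: conjugation by `k` and by its mirror
-- index `k′`, where `k + k′ + 2 ≡ m`, send `ê` to the same atom. A matching with `M ê ≡ atom l`
-- acts on every other atom below `w` like `act l` or like `act l′`, and these two can differ only
-- on the atoms of the neighbours of `l`. If the choices at the two neighbours disagree, `M` need
-- not be a conjugation. A comparison in ranks up to four then excludes one particular element of
-- rank three from lying below `w`. This bounds the first values of `F w` from below, and the first
-- position where `F w` differs from `F ê` yields the descent whose conjugation commutes with `M`.
--
-- Matchings with `M w ≡ w` are carried through the same induction because a matching of a larger
-- interval may restrict to one of them, and the third clause of the symmetry concerns exactly this
-- case.

-- Adjacent transpositions of the natural numbers.

sw : ℕ → ℕ → ℕ
sw zero    zero          = 1
sw zero    (suc zero)    = 0
sw zero    (suc (suc j)) = suc (suc j)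
sw (suc k) zero          = zero
sw (suc k) (suc j)       = suc (sw k j)

sw-l : ∀ k → sw k k ≡ suc k
sw-l zero    = refl
sw-l (suc k) = cong suc (sw-l k)

sw-r : ∀ k → sw k (suc k) ≡ k
sw-r zero    = refl
sw-r (suc k) = cong suc (sw-r k)

sw-o : ∀ k j → j ≢ k → j ≢ suc k → sw k j ≡ j
sw-o zero    zero          p q = ⊥-elim (p refl)
sw-o zero    (suc zero)    p q = ⊥-elim (q refl)
sw-o zero    (suc (suc j)) p q = refl
sw-o (suc k) zero          p q = refl
sw-o (suc k) (suc j)       p q = cong suc (sw-o k j (λ r → p (cong suc r)) (λ r → q (cong suc r)))

sw-invol : ∀ k j → sw k (sw k j) ≡ j
sw-invol zero    zero          = refl
sw-invol zero    (suc zero)    = refl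
sw-invol zero    (suc (suc j)) = refl
sw-invol (suc k) zero          = refl
sw-invol (suc k) (suc j)       = cong suc (sw-invol k j)

sw-inj : ∀ k {a b} → sw k a ≡ sw k b → a ≡ b
sw-inj k {a} {b} p = trans (sym (sw-invol k a)) (trans (cong (sw k) p) (sw-invol k b))

sw-braid : ∀ k j → sw k (sw (suc k) (sw k j)) ≡ sw (suc k) (sw k (sw (suc k) j))
sw-braid zero    zero                = refl
sw-braid zero    (suc zero)          = refl
sw-braid zero    (suc (suc zero))    = refl
sw-braid zero    (suc (suc (suc j))) = refl
sw-braid (suc k) zero                = refl
sw-braid (suc k) (suc j)             = cong suc (sw-braid k j)

sw-comm : ∀ i j x → suc i < j → sw i (sw j x) ≡ sw j (sw i x)
sw-comm i       zero          x             ()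
sw-comm i       (suc zero)    x             (s≤s ())
sw-comm zero    (suc (suc j)) zero          p = refl
sw-comm zero    (suc (suc j)) (suc zero)    p = refl
sw-comm zero    (suc (suc j)) (suc (suc x)) p = refl
sw-comm (suc i) (suc (suc j)) zero          p = refl
sw-comm (suc i) (suc (suc j)) (suc x)       p = cong suc (sw-comm i (suc j) x (s≤s⁻¹ p))

sw-≤ : ∀ k j → sw k j ≤ suc j
sw-≤ zero    zero          = s≤s z≤n
sw-≤ zero    (suc zero)    = z≤n
sw-≤ zero    (suc (suc j)) = n≤1+n _
sw-≤ (suc k) zero          = z≤n
sw-≤ (suc k) (suc j)       = s≤s (sw-≤ k j)

sw-bound : ∀ k {m} j → suc k < m → j < m → sw k j < m
sw-bound zero    zero          p       q       = p
sw-bound zero    (suc zero)    p       q       = <-trans z<s p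
sw-bound zero    (suc (suc j)) p       q       = q
sw-bound (suc k) zero          p       q       = q
sw-bound (suc k) (suc j)       (s≤s p) (s≤s q) = s≤s (sw-bound k j p q)

-- An adjacent transposition reverses the order of the pair `k`, `suc k` and of no other; the last
-- hypothesis excludes just this pair.
sw-mono : ∀ k {a b} → a < b → (a ≡ k → b ≢ suc k) → sw k a < sw k b
sw-mono zero    {zero}        {suc zero}    p       h = ⊥-elim (h refl refl)
sw-mono zero    {zero}        {suc (suc b)} p       h = s≤s (s≤s z≤n)
sw-mono zero    {suc zero}    {suc zero}    (s≤s ()) h
sw-mono zero    {suc zero}    {suc (suc b)} p       h = s≤s z≤n
sw-mono zero    {suc (suc a)} {suc zero}    (s≤s ()) h
sw-mono zero    {suc (suc a)} {suc (suc b)} p       h = p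
sw-mono (suc k) {zero}        {suc b}       p       h = s≤s z≤n
sw-mono (suc k) {suc a}       {suc b}       (s≤s p) h =
  s≤s (sw-mono k p (λ r s → h (cong suc r) (cong suc s)))

sw-mono⁻ : ∀ k {a b} → sw k a < sw k b → (a ≡ suc k → b ≢ k) → a < b
sw-mono⁻ k {a} {b} p h =
  subst₂ _<_ (sw-invol k a) (sw-invol k b)
    (sw-mono k p λ r s → h (sw-inj k (trans r (sym (sw-r k)))) (sw-inj k (trans s (sym (sw-l k)))))

sw-low : ∀ k j → j < k → sw k j ≡ j
sw-low k j p = sw-o k j (<⇒≢ p) (<⇒≢ (m<n⇒m<1+n p))

sw-high : ∀ k j → suc k < j → sw k j ≡ j
sw-high k j p = sw-o k j (λ r → <⇒≢ (<-trans (n<1+n k) p) (sym r)) (λ r → <⇒≢ p (sym r))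

-- ι seen through the involutions F x = w₀ x. Points are natural numbers, those ≥ m being irrelevant;
-- a generator act k with k + 1 ≥ m is the identity. Multiplication by w₀ reverses the Bruhat order,
-- hence k is a descent of x when F x k < F x (k + 1).
record System (m : ℕ) : Set₁ where
  infix 4 _⊑_
  field
    X        : Set
    _≟X_     : (x y : X) → Dec (x ≡ y)
    rk       : X → ℕ
    _⊑_      : X → X → Set
    F        : X → ℕ → ℕ
    act      : ℕ → X → X
    ê        : X
    mir      : X → X
    F-<      : ∀ x {k} → k < m → F x k < m
    F-invol  : ∀ x k → F x (F x k) ≡ k
    F-fpf    : ∀ x {k} → k < m → F x k ≢ k
    F-ext    : ∀ {x y} → (∀ k → k < m → F x k ≡ F y k) → x ≡ y
    F-act    : ∀ x {k} → suc k < m → ∀ j → F (act k x) j ≡ sw k (F x (sw k j))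
    act-out  : ∀ x {k} → ¬ (suc k < m) → act k x ≡ x
    F-e      : ∀ {j} → j < m → suc (j + F ê j) ≡ m
    F-mir    : ∀ x {i j} → suc (i + j) ≡ m → suc (F (mir x) i + F x j) ≡ m
    rk-e     : rk ê ≡ 0
    rk-desc  : ∀ {x k} → suc k < m → F x k < F x (suc k) → rk x ≡ suc (rk (act k x))
    ⊑-refl   : ∀ {x} → x ⊑ x
    ⊑-trans  : ∀ {x y z} → x ⊑ y → y ⊑ z → x ⊑ z
    rk-mono  : ∀ {x y} → x ⊑ y → rk x ≤ rk y
    desc-⊑   : ∀ {x k} → suc k < m → F x k < F x (suc k) → act k x ⊑ x
    -- The lifting property at a descent of the larger element, in three forms. The inequality for
    -- `x` in `lift₂` also holds when `act k` fixes `x`.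
    lift₁    : ∀ {x y k} → suc k < m → F y k < F y (suc k) → x ⊑ y → act k x ⊑ y
    lift₂    : ∀ {x y k} → suc k < m → F y k < F y (suc k) → F x (suc k) < F x k →
               x ⊑ y → x ⊑ act k y
    lift₃    : ∀ {x y k} → suc k < m → F y k < F y (suc k) → F x k < F x (suc k) →
               x ⊑ y → act k x ⊑ act k y
    -- The simplest rank condition of the Bruhat order: the minimum of `F` over an initial segment
    -- can only drop when the element grows.
    prefix   : ∀ {x y k v} → k < m → x ⊑ y → (∃ λ i → i ≤ k × F x i ≤ v) → ∃ λ i → i ≤ k × F y i ≤ v

Far Adj : ℕ → ℕ → Set
Far i j = (suc i < j) ⊎ (suc j < i)
Adj i j = (j ≡ suc i) ⊎ (i ≡ suc j)

Far-sym : ∀ {i j} → Far i j → Far j i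
Far-sym (inj₁ p) = inj₂ p
Far-sym (inj₂ p) = inj₁ p

Adj-sym : ∀ {i j} → Adj i j → Adj j i
Adj-sym (inj₁ p) = inj₂ p
Adj-sym (inj₂ p) = inj₁ p

data Rel (i j : ℕ) : Set where
  same : i ≡ j → Rel i j
  adj  : Adj i j → Rel i j
  far  : Far i j → Rel i j

rel : ∀ i j → Rel i j
rel i j with <-cmp i j
... | tri≈ _ p _ = same p
... | tri< p _ _ with m≤n⇒m<n∨m≡n p
...   | inj₁ q = far (inj₁ q)
...   | inj₂ q = adj (inj₁ (sym q))
rel i j | tri> _ _ p with m≤n⇒m<n∨m≡n p
...   | inj₁ q = far (inj₂ q)
...   | inj₂ q = adj (inj₂ (sym q))

n≢1+n : ∀ {n : ℕ} → n ≢ suc n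
n≢1+n ()

-- Scalar sequences and the identities behind the operator relations.

-- Laurent-type sequences, so that multiplication by q is a shift without boundary cases.
V : Set
V = ℤ → ℤ

infix 4 _≈_
_≈_ : V → V → Set
a ≈ b = ∀ k → a k ≡ b k

≈-trans : ∀ {a b c} → a ≈ b → b ≈ c → a ≈ c
≈-trans p q k = trans (p k) (q k)

≈-sym : ∀ {a b} → a ≈ b → b ≈ a
≈-sym p k = sym (p k)

≈-reflexive : ∀ {a b} → a ≡ b → a ≈ b
≈-reflexive refl k = refl

0V : V
0V _ = 0ℤ

-- The scalar q - 1 - x.
χ : XPar → V → V
χ x=q  a k = -ᶻ a k
χ x=-1 a k = a (predᶻ k)

-- (q - 1) a + q b.
U : V → V → V
U a b k = (a (predᶻ k) -ᶻ a k) +ᶻ b (predᶻ k)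

χ-cong : ∀ x {a b} → a ≈ b → χ x a ≈ χ x b
χ-cong x=q  p k = cong -ᶻ_ (p k)
χ-cong x=-1 p k = p (predᶻ k)

U-cong : ∀ {a a′ b b′} → a ≈ a′ → b ≈ b′ → U a b ≈ U a′ b′
U-cong p q k = cong₂ _+ᶻ_ (cong₂ _-ᶻ_ (p _) (p k)) (q _)

χ-0 : ∀ x {a} → a ≈ 0V → χ x a ≈ 0V
χ-0 x=q  p k = cong -ᶻ_ (p k)
χ-0 x=-1 p k = p (predᶻ k)

U-0 : ∀ {a b} → a ≈ 0V → b ≈ 0V → U a b ≈ 0V
U-0 p q k = cong₂ _+ᶻ_ (cong₂ _-ᶻ_ (p _) (p k)) (q _)

U-χ : ∀ x a b → U (χ x a) (χ x b) ≈ χ x (U a b)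
U-χ x=q  a b k = lemma (a (predᶻ k)) (a k) (b (predᶻ k))
  where
  lemma : ∀ x y z → ((-ᶻ x) -ᶻ (-ᶻ y)) +ᶻ (-ᶻ z) ≡ -ᶻ ((x -ᶻ y) +ᶻ z)
  lemma = solveᶻ
U-χ x=-1 a b k = refl

-- Both sides expand to (q - 1)² a + q (q - 1) (b + c) + q² d. This is the commutation of two
-- operators at the bottom of a square.
UU : ∀ a b c d → U (U a b) (U c d) ≈ U (U a c) (U b d)
UU a b c d k = lemma (a (predᶻ (predᶻ k))) (a (predᶻ k)) (a k) (b (predᶻ (predᶻ k))) (b (predᶻ k))
                     (c (predᶻ (predᶻ k))) (c (predᶻ k)) (d (predᶻ (predᶻ k)))
  where
  lemma : ∀ a₂ a₁ a₀ b₂ b₁ c₂ c₁ d₂ →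
    ((((a₂ -ᶻ a₁) +ᶻ b₂) -ᶻ ((a₁ -ᶻ a₀) +ᶻ b₁)) +ᶻ ((c₂ -ᶻ c₁) +ᶻ d₂)) ≡
    ((((a₂ -ᶻ a₁) +ᶻ c₂) -ᶻ ((a₁ -ᶻ a₀) +ᶻ c₁)) +ᶻ ((b₂ -ᶻ b₁) +ᶻ d₂))
  lemma = solveᶻ

-- The braid relation at the bottom `z` of a hexagon with `p₁` above `r`, `p₂` above `t` and top
-- `T`. After `UU` has exchanged `r` and `t`, the two sides differ by exchanging `p₁` and `p₂`, and
-- each of these has coefficient q² (q - 1) on either side.
hexagon-identity : ∀ z r t p₁ p₂ T →
  U (U (U z r) (U t p₂)) (U z (U p₁ T)) ≈ U (U (U z t) (U r p₁)) (U z (U p₂ T))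
hexagon-identity z r t p₁ p₂ T k = begin
    (α₁ -ᶻ α₀) +ᶻ (β₁ +ᶻ γ)       ≡⟨ cong₂ (λ a b → (a -ᶻ b) +ᶻ (β₁ +ᶻ γ)) (UU z r t p₂ (predᶻ k)) (UU z r t p₂ k) ⟩
    (α₁′ -ᶻ α₀′) +ᶻ (β₁ +ᶻ γ)     ≡⟨ lemma (z (predᶻ (predᶻ (predᶻ k)))) (z (predᶻ (predᶻ k))) (z (predᶻ k)) (z k)
                                        (t (predᶻ (predᶻ (predᶻ k)))) (t (predᶻ (predᶻ k))) (t (predᶻ k))
                                        (r (predᶻ (predᶻ (predᶻ k)))) (r (predᶻ (predᶻ k))) (r (predᶻ k))
                                        (p₁ (predᶻ (predᶻ (predᶻ k)))) (p₁ (predᶻ (predᶻ k)))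
                                        (p₂ (predᶻ (predᶻ (predᶻ k)))) (p₂ (predᶻ (predᶻ k))) (T (predᶻ (predᶻ (predᶻ k)))) ⟩
    U (U (U z t) (U r p₁)) (U z (U p₂ T)) k ∎
  where
  open ≡-Reasoning
  α₁ = U (U z r) (U t p₂) (predᶻ k)
  α₀ = U (U z r) (U t p₂) k
  α₁′ = U (U z t) (U r p₂) (predᶻ k)
  α₀′ = U (U z t) (U r p₂) k
  β₁ = z (predᶻ (predᶻ k)) -ᶻ z (predᶻ k)
  γ  = U p₁ T (predᶻ (predᶻ k))
  lemma : ∀ z₃ z₂ z₁ z₀ t₃ t₂ t₁ r₃ r₂ r₁ p₃ p₂ q₃ q₂ T₃ →
    (((((z₃ -ᶻ z₂) +ᶻ t₃) -ᶻ ((z₂ -ᶻ z₁) +ᶻ t₂)) +ᶻ ((r₃ -ᶻ r₂) +ᶻ q₃)) -ᶻ ((((z₂ -ᶻ z₁) +ᶻ t₂) -ᶻ ((z₁ -ᶻ z₀) +ᶻ t₁)) +ᶻ ((r₂ -ᶻ r₁) +ᶻ q₂)))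
      +ᶻ ((z₂ -ᶻ z₁) +ᶻ ((p₃ -ᶻ p₂) +ᶻ T₃)) ≡
    (((((z₃ -ᶻ z₂) +ᶻ t₃) -ᶻ ((z₂ -ᶻ z₁) +ᶻ t₂)) +ᶻ ((r₃ -ᶻ r₂) +ᶻ p₃)) -ᶻ ((((z₂ -ᶻ z₁) +ᶻ t₂) -ᶻ ((z₁ -ᶻ z₀) +ᶻ t₁)) +ᶻ ((r₂ -ᶻ r₁) +ᶻ p₂)))
      +ᶻ ((z₂ -ᶻ z₁) +ᶻ ((q₃ -ᶻ q₂) +ᶻ T₃))
  lemma = solveᶻ

-- The braid relation at the bottom of a chain with values `z`, `y`, `x`. The coefficients of `z`
-- agree because the scalar c = q - 1 - x satisfies c² = (q - 1) c + q, whose roots are c = -1 and c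
-- = q: this is where the two admissible values of x enter.
chain-identity : ∀ ξ z y x → χ ξ (U (χ ξ z) (U y x)) ≈ U (χ ξ (U z y)) (U z (χ ξ x))
chain-identity x=q z y x k = lemma (z (predᶻ (predᶻ k))) (z (predᶻ k)) (z k) (y (predᶻ (predᶻ k))) (y (predᶻ k)) (x (predᶻ (predᶻ k)))
  where
  lemma : ∀ z₂ z₁ z₀ y₂ y₁ x₂ →
    -ᶻ (((-ᶻ z₁) -ᶻ (-ᶻ z₀)) +ᶻ ((y₂ -ᶻ y₁) +ᶻ x₂)) ≡
    ((-ᶻ ((z₂ -ᶻ z₁) +ᶻ y₂)) -ᶻ (-ᶻ ((z₁ -ᶻ z₀) +ᶻ y₁))) +ᶻ ((z₂ -ᶻ z₁) +ᶻ (-ᶻ x₂))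
  lemma = solveᶻ
chain-identity x=-1 z y x k = lemma (z (predᶻ (predᶻ (predᶻ k)))) (z (predᶻ (predᶻ k))) (z (predᶻ k))
    (y (predᶻ (predᶻ (predᶻ k)))) (y (predᶻ (predᶻ k))) (x (predᶻ (predᶻ (predᶻ k))))
  where
  lemma : ∀ z₃ z₂ z₁ y₃ y₂ x₃ →
    ((z₃ -ᶻ z₂) +ᶻ ((y₃ -ᶻ y₂) +ᶻ x₃)) ≡
    (((z₃ -ᶻ z₂) +ᶻ y₃) -ᶻ ((z₂ -ᶻ z₁) +ᶻ y₂)) +ᶻ ((z₂ -ᶻ z₁) +ᶻ x₃)
  lemma = solveᶻ

-- Conjugation by generators, descents and ranks.

module Theory {m : ℕ} (S : System m) where
  open System S public

  infix 4 _⋖_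
  _⋖_ : X → X → Set
  x ⋖ y = x ⊑ y × rk y ≡ suc (rk x)

  Desc : X → ℕ → Set
  Desc x k = suc k < m × F x k < F x (suc k)

  Desc? : ∀ x k → Dec (Desc x k)
  Desc? x k = (suc k <? m) ×-dec (F x k <? F x (suc k))

  F-inj : ∀ x {a b} → F x a ≡ F x b → a ≡ b
  F-inj x {a} {b} p = trans (sym (F-invol x a)) (trans (cong (F x) p) (F-invol x b))

  F-swap : ∀ x {a b} → F x a ≡ b → F x b ≡ a
  F-swap x {a} p = trans (cong (F x) (sym p)) (F-invol x a)

  F-l : ∀ x {k} → suc k < m → F (act k x) k ≡ sw k (F x (suc k))
  F-l x {k} p = trans (F-act x p k) (cong (λ a → sw k (F x a)) (sw-l k))

  F-r : ∀ x {k} → suc k < m → F (act k x) (suc k) ≡ sw k (F x k)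
  F-r x {k} p = trans (F-act x p (suc k)) (cong (λ a → sw k (F x a)) (sw-r k))

  F-o : ∀ x {k j} → suc k < m → j ≢ k → j ≢ suc k → F (act k x) j ≡ sw k (F x j)
  F-o x {k} {j} p q r = trans (F-act x p j) (cong (λ a → sw k (F x a)) (sw-o k j q r))

  act-invol : ∀ k x → act k (act k x) ≡ x
  act-invol k x with suc k <? m
  ... | no p = trans (act-out _ p) (act-out x p)
  ... | yes p = F-ext λ j _ → begin
      F (act k (act k x)) j         ≡⟨ F-act _ p j ⟩
      sw k (F (act k x) (sw k j))   ≡⟨ cong (sw k) (F-act x p _) ⟩
      sw k (sw k (F x (sw k (sw k j)))) ≡⟨ sw-invol k _ ⟩
      F x (sw k (sw k j))           ≡⟨ cong (F x) (sw-invol k j) ⟩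
      F x j                         ∎
    where open ≡-Reasoning

  act-inj : ∀ k {x y} → act k x ≡ act k y → x ≡ y
  act-inj k {x} {y} p = trans (sym (act-invol k x)) (trans (cong (act k) p) (act-invol k y))

  act-comm′ : ∀ i j x → suc i < j → act i (act j x) ≡ act j (act i x)
  act-comm′ i j x q with suc i <? m | suc j <? m
  ... | no p | _ = trans (act-out _ p) (cong (act j) (sym (act-out x p)))
  ... | yes _ | no r = trans (cong (act i) (act-out x r)) (sym (act-out _ r))
  ... | yes p | yes r = F-ext λ a _ → begin
      F (act i (act j x)) a                 ≡⟨ F-act _ p a ⟩
      sw i (F (act j x) (sw i a))           ≡⟨ cong (sw i) (F-act x r _) ⟩
      sw i (sw j (F x (sw j (sw i a))))     ≡⟨ sw-comm i j _ q ⟩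
      sw j (sw i (F x (sw j (sw i a))))     ≡⟨ cong (λ b → sw j (sw i (F x b))) (sym (sw-comm i j a q)) ⟩
      sw j (sw i (F x (sw i (sw j a))))     ≡⟨ cong (sw j) (sym (F-act x p _)) ⟩
      sw j (F (act i x) (sw j a))           ≡⟨ sym (F-act _ r a) ⟩
      F (act j (act i x)) a                 ∎
    where open ≡-Reasoning

  act-comm : ∀ {i j} x → Far i j → act i (act j x) ≡ act j (act i x)
  act-comm x (inj₁ p) = act-comm′ _ _ x p
  act-comm x (inj₂ p) = sym (act-comm′ _ _ x p)

  F-act³ : ∀ i j x a → suc i < m → suc j < m →
           F (act i (act j (act i x))) a ≡ sw i (sw j (sw i (F x (sw i (sw j (sw i a))))))
  F-act³ i j x a p r = trans (F-act _ p a) (cong (sw i) (trans (F-act _ r _) (cong (sw j) (F-act x p _))))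

  act-braid′ : ∀ k x → suc (suc k) < m →
               act k (act (suc k) (act k x)) ≡ act (suc k) (act k (act (suc k) x))
  act-braid′ k x r = F-ext λ a _ →
    trans (F-act³ k (suc k) x a p r)
      (trans (sw-braid k _)
        (trans (cong (λ b → sw (suc k) (sw k (sw (suc k) (F x b)))) (sw-braid k a))
          (sym (F-act³ (suc k) k x a r p))))
    where
    p : suc k < m
    p = <-trans (n<1+n _) r

  act-braid : ∀ {i j} x → Adj i j → suc i < m → suc j < m →
              act i (act j (act i x)) ≡ act j (act i (act j x))
  act-braid x (inj₁ refl) p r = act-braid′ _ x r
  act-braid x (inj₂ refl) p r = sym (act-braid′ _ x p)

  Desc-rk : ∀ {x k} → Desc x k → rk x ≡ suc (rk (act k x))
  Desc-rk (p , q) = rk-desc p q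

  Desc-⊑ : ∀ {x k} → Desc x k → act k x ⊑ x
  Desc-⊑ (p , q) = desc-⊑ p q

  Desc-⋖ : ∀ {x k} → Desc x k → act k x ⋖ x
  Desc-⋖ d = Desc-⊑ d , Desc-rk d

  fixed : ∀ {x k} → F x k ≡ suc k → act k x ≡ x
  fixed {x} {k} f with suc k <? m
  ... | no p = act-out x p
  ... | yes p = F-ext λ j _ → go j
    where
    g : F x (suc k) ≡ k
    g = F-swap x f
    go : ∀ j → F (act k x) j ≡ F x j
    go j with j ≟ k | j ≟ suc k
    ... | yes refl | _ = trans (F-l x p) (trans (cong (sw k) g) (trans (sw-l k) (sym f)))
    ... | no _ | yes refl = trans (F-r x p) (trans (cong (sw k) f) (trans (sw-r k) (sym g)))
    ... | no a | no b = trans (F-o x p a b)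
      (sw-o k _ (λ r → b (F-inj x (trans r (sym g)))) (λ r → a (F-inj x (trans r (sym f)))))

  asc : ∀ {x k} → suc k < m → F x (suc k) < F x k → F x k ≢ suc k → Desc (act k x) k
  asc {x} {k} p q r = p , subst₂ _<_ (sym (F-l x p)) (sym (F-r x p)) (sw-mono k q λ _ → r)

  data Stat (k : ℕ) (x : X) : Set where
    dn : Desc x k → Stat k x
    fx : act k x ≡ x → Stat k x
    up : Desc (act k x) k → Stat k x

  stat : ∀ k x → Stat k x
  stat k x with suc k <? m
  ... | no p = fx (act-out x p)
  ... | yes p with <-cmp (F x k) (F x (suc k))
  ...   | tri< q _ _ = dn (p , q)
  ...   | tri≈ _ q _ = ⊥-elim (n≢1+n (F-inj x q))
  ...   | tri> _ _ q with F x k ≟ suc k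
  ...     | yes r = fx (fixed r)
  ...     | no r  = up (asc p q r)

  Desc-irr : ∀ {x k} → Desc x k → Desc (act k x) k → ⊥
  Desc-irr {x} {k} a b = 1+n≰n (≤-trans (≤-reflexive (sym (Desc-rk b)))
    (≤-trans (n≤1+n _) (≤-reflexive (trans (sym (Desc-rk a)) (cong rk (sym (act-invol k x)))))))

  Desc-fx : ∀ {x k} → Desc x k → act k x ≢ x
  Desc-fx a b = 1+n≢n (trans (sym (Desc-rk a)) (cong rk (sym b)))

  up-inv : ∀ {x k} → Desc (act k x) k → suc k < m × F x (suc k) < F x k × F x k ≢ suc k
  up-inv {x} {k} d@(p , q) with <-cmp (F x k) (F x (suc k))
  ... | tri< r _ _ = ⊥-elim (Desc-irr (p , r) d)
  ... | tri≈ _ r _ = ⊥-elim (n≢1+n (F-inj x r))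
  ... | tri> _ _ r = p , r , λ f → Desc-irr (subst (λ y → Desc y k) (fixed f) d) d

  fx-inv : ∀ {x k} → suc k < m → act k x ≡ x → F x k ≡ suc k
  fx-inv {x} {k} p f with <-cmp (F x k) (F x (suc k))
  ... | tri< r _ _ = ⊥-elim (Desc-fx (p , r) f)
  ... | tri≈ _ r _ = ⊥-elim (n≢1+n (F-inj x r))
  ... | tri> _ _ r with F x k ≟ suc k
  ...   | yes q = q
  ...   | no q  = ⊥-elim (Desc-irr (subst (λ y → Desc y k) f (asc p r q)) (asc p r q))

  ¬Desc-asc : ∀ {x k} → suc k < m → ¬ Desc x k → F x (suc k) < F x k
  ¬Desc-asc {x} {k} p d with <-cmp (F x k) (F x (suc k))
  ... | tri< r _ _ = ⊥-elim (d (p , r))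
  ... | tri≈ _ r _ = ⊥-elim (n≢1+n (F-inj x r))
  ... | tri> _ _ r = r

  up-rk : ∀ {x k} → Desc (act k x) k → rk (act k x) ≡ suc (rk x)
  up-rk {x} {k} d = trans (Desc-rk d) (cong (λ y → suc (rk y)) (act-invol k x))

  up-⋖ : ∀ {x k} → Desc (act k x) k → x ⋖ act k x
  up-⋖ {x} {k} d = subst (_⋖ act k x) (act-invol k x) (Desc-⋖ d)

  up-¬ : ∀ {x k} → Desc (act k x) k → ¬ Desc x k
  up-¬ d d′ = Desc-irr d′ d

  rk-act : ∀ k x → rk (act k x) ≤ suc (rk x)
  rk-act k x with stat k x
  ... | dn d = ≤-trans (n≤1+n _) (≤-trans (≤-reflexive (sym (Desc-rk d))) (n≤1+n _))
  ... | fx f = ≤-trans (≤-reflexive (cong rk f)) (n≤1+n _)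
  ... | up d = ≤-reflexive (up-rk d)

  rk-<-Desc : ∀ {k x} → rk (act k x) < rk x → Desc x k
  rk-<-Desc {k} {x} p with stat k x
  ... | dn d = d
  ... | fx f = ⊥-elim (<⇒≢ p (cong rk f))
  ... | up d = ⊥-elim (<-asym p (≤-reflexive (sym (up-rk d))))

  L₁ : ∀ {x y k} → Desc y k → x ⊑ y → act k x ⊑ y
  L₁ (p , q) = lift₁ p q

  L₂ : ∀ {x y k} → Desc y k → ¬ Desc x k → x ⊑ y → x ⊑ act k y
  L₂ (p , q) r = lift₂ p q (¬Desc-asc p r)

  L₃ : ∀ {x y k} → Desc y k → Desc x k → x ⊑ y → act k x ⊑ act k y
  L₃ (p , q) (_ , r) = lift₃ p q r

  -- Conjugation by `j` leaves the positions `i`, `suc i` in place and could reverse the order of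
  -- their values only if these are `j` and `suc j`. But then `F w j ≡ i` and `F w (suc j) ≡ suc i`,
  -- so `j` would be a descent.
  Desc-far : ∀ {i j w} → Far i j → Desc w i → ¬ Desc w j → Desc (act j w) i
  Desc-far {i} {j} {w} f (p , q) nd with suc j <? m
  ... | no r = subst (λ y → Desc y i) (sym (act-out w r)) (p , q)
  ... | yes r = p , subst₂ _<_ (sym (F-o w r (i≢j f) (i≢1+j f))) (sym (F-o w r (1+i≢j f) (1+i≢1+j f)))
      (sw-mono j q λ a b → nd (r , subst₂ _<_ (sym (F-swap w a)) (sym (F-swap w b)) (n<1+n i)))
    where
    i≢j : ∀ {i j} → Far i j → i ≢ j
    i≢j (inj₁ a) = <⇒≢ (<-trans (n<1+n _) a)
    i≢j (inj₂ a) b = <⇒≢ (<-trans (n<1+n _) a) (sym b)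
    i≢1+j : ∀ {i j} → Far i j → i ≢ suc j
    i≢1+j (inj₁ a) = <⇒≢ (<-trans (n<1+n _) (<-trans a (n<1+n _)))
    i≢1+j (inj₂ a) b = <⇒≢ a (sym b)
    1+i≢j : ∀ {i j} → Far i j → suc i ≢ j
    1+i≢j (inj₁ a) = <⇒≢ a
    1+i≢j (inj₂ a) b = <⇒≢ (<-trans (<-trans (n<1+n _) a) (n<1+n _)) (sym b)
    1+i≢1+j : ∀ {i j} → Far i j → suc i ≢ suc j
    1+i≢1+j f a = i≢j f (suc-injective a)

  private
    strict-top : ∀ {x} → (∀ k → ¬ Desc x k) → ∀ j → j < m → F x j + j < m
    strict-top {x} h zero p = subst (_< m) (sym (+-identityʳ _)) (F-< x p)
    strict-top {x} h (suc j) p = ≤-<-trans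
      (subst (_≤ F x j + j) (sym (+-suc _ j)) (+-monoˡ-≤ j (¬Desc-asc p (h j))))
      (strict-top h j (<-trans (n<1+n _) p))

    strict-bottom : ∀ {x} → (∀ k → ¬ Desc x k) → ∀ d j → suc (j + d) ≡ m → d ≤ F x j
    strict-bottom h zero j p = z≤n
    strict-bottom {x} h (suc d) j p = ≤-trans (s≤s (strict-bottom h d (suc j) p′)) (¬Desc-asc 1+j<m (h j))
      where
      p′ : suc (suc j + d) ≡ m
      p′ = trans (cong suc (sym (+-suc j d))) p
      1+j<m : suc j < m
      1+j<m = subst (suc (suc j) ≤_) p′ (s≤s (s≤s (m≤m+n j d)))

  -- Without descents `F x` is strictly decreasing on the points below `m`, and the reversal `F ê`
  -- is the only such self-map; `strict-top` and `strict-bottom` squeeze each value.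
  no-desc : ∀ {x} → (∀ k → ¬ Desc x k) → x ≡ ê
  no-desc {x} h = F-ext λ j p → suc-injective (+-cancelˡ-≡ j _ _ (trans (+-suc j _) (trans (go j p) (trans (sym (F-e p)) (sym (+-suc j _))))))
    where
    go : ∀ j → j < m → suc (j + F x j) ≡ m
    go j p = ≤-antisym (subst (_≤ m) (cong suc (+-comm (F x j) j)) (strict-top h j p))
      (subst (_≤ suc (j + F x j)) (F-e p) (s≤s (+-monoʳ-≤ j (strict-bottom h _ j (F-e p)))))

  Desc-e : ∀ k → ¬ Desc ê k
  Desc-e k (p , q) = <⇒≱ q (≤-trans (n≤1+n _) (≤-reflexive
    (+-cancelˡ-≡ k _ _ (suc-injective (trans (cong suc (+-suc k _)) (trans (F-e p) (sym (F-e (<-trans (n<1+n k) p)))))))))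

  desc : ∀ {x} → x ≢ ê → ∃ (Desc x)
  desc {x} ne with anyUpTo? (Desc? x) m
  ... | yes (k , _ , d) = k , d
  ... | no h = ⊥-elim (ne (no-desc λ k d → h (k , <-trans (n<1+n k) (proj₁ d) , d)))

  rk0 : ∀ {x} → rk x ≡ 0 → x ≡ ê
  rk0 {x} p with x ≟X ê
  ... | yes q = q
  ... | no q with desc q
  ...   | k , d with trans (sym p) (Desc-rk d)
  ...     | ()

  rk>0 : ∀ {x n} → rk x ≡ suc n → x ≢ ê
  rk>0 p refl with trans (sym rk-e) p
  ... | ()

  e-min : ∀ x → ê ⊑ x
  e-min x = go (suc (rk x)) x (n<1+n _)
    where
    go : ∀ n x → rk x < n → ê ⊑ x
    go (suc n) x p with x ≟X ê
    ... | yes refl = ⊑-refl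
    ... | no q with desc q
    ...   | k , d = ⊑-trans (go n (act k x) (<-≤-trans (≤-reflexive (sym (Desc-rk d))) (s≤s⁻¹ p))) (Desc-⊑ d)

  ⊑e : ∀ {x} → x ⊑ ê → x ≡ ê
  ⊑e {x} p = rk0 (n≤0⇒n≡0 (subst (rk x ≤_) rk-e (rk-mono p)))

  -- Lifting at fixed elements and gradedness of the order.

  rk-dn : ∀ {x k n} → Desc x k → rk x < suc n → rk (act k x) < n
  rk-dn d p = <-≤-trans (≤-reflexive (sym (Desc-rk d))) (s≤s⁻¹ p)

  -- The points `k` and `suc k` are partners in `y`. The descent `t` puts the partner of the third
  -- point on the far side; injectivity and the absence of fixed points push it beyond all three
  -- points, and conjugation by `t` keeps it there.
  fixed-desc : ∀ {y k t} → Adj k t → suc k < m → act k y ≡ y → Desc y t → Desc (act t y) k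
  fixed-desc {y} {k} (inj₁ refl) p f (q , d) = p , subst₂ _<_ (sym lhs) (sym (trans (F-l y q) (sw-high (suc k) _ big))) big
    where
    fk : F y k ≡ suc k
    fk = fx-inv p f
    fk′ : F y (suc k) ≡ k
    fk′ = F-swap y fk
    lhs : F (act (suc k) y) k ≡ suc (suc k)
    lhs = trans (F-o y q (λ ()) (λ ())) (trans (cong (sw (suc k)) fk) (sw-l (suc k)))
    big : suc (suc k) < F y (suc (suc k))
    big = ≤∧≢⇒< (≤∧≢⇒< (subst (_< F y (suc (suc k))) fk′ d) λ r → contr (F-inj y (trans fk r)))
                (λ r → F-fpf y q (sym r))
      where
      contr : k ≡ suc (suc k) → ⊥
      contr ()
  fixed-desc {y} {_} {t} (inj₂ refl) p f (q , d) = p , subst₂ _<_ (sym (trans (F-r y q) (sw-low t _ small))) (sym rhs) small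
    where
    f1 : F y (suc t) ≡ suc (suc t)
    f1 = fx-inv p f
    f2 : F y (suc (suc t)) ≡ suc t
    f2 = F-swap y f1
    rhs : F (act t y) (suc (suc t)) ≡ t
    rhs = trans (F-o y q (λ ()) (λ ())) (trans (cong (sw t) f2) (sw-r t))
    small : F y t < t
    small = ≤∧≢⇒< (s≤s⁻¹ (≤∧≢⇒< (s≤s⁻¹ (subst (F y t <_) f1 d)) λ r → contr (F-inj y (trans r (sym f2)))))
                  (F-fpf y (<-trans (n<1+n t) q))
      where
      contr : t ≡ suc (suc t) → ⊥
      contr ()

  -- Lifting when `y` is fixed, by induction on the rank along a descent `t` of `y`. A far `t`
  -- commutes with `k`. For an adjacent `t` the orbit of `y` is a chain whose bottom `z` is fixed by
  -- `t` instead of `k`, so the induction hypothesis is applied with the two generators exchanged.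
  lift-fixed : ∀ {x y k} → act k y ≡ y → x ⊑ y → act k x ⊑ y
  lift-fixed {x} {y} {k} = go (suc (rk y)) x y k (n<1+n _)
    where
    go : ∀ n x y k → rk y < n → act k y ≡ y → x ⊑ y → act k x ⊑ y
    go (suc n) x y k b f x⊑y with suc k <? m
    ... | no p = subst (_⊑ y) (sym (act-out x p)) x⊑y
    ... | yes p with y ≟X ê
    ...   | yes refl = subst (λ z → act k z ⊑ ê) (sym (⊑e x⊑y)) (subst (_⊑ ê) (sym f) ⊑-refl)
    ...   | no y≢e with desc y≢e
    ...     | t , d with rel k t
    ...       | same refl = ⊥-elim (Desc-fx d f)
    ...       | far ft = far-case (Desc? x t)
      where
      f′ : act k (act t y) ≡ act t y
      f′ = trans (act-comm y ft) (cong (act t) f)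
      far-case : Dec (Desc x t) → act k x ⊑ y
      far-case (no nd) = ⊑-trans (go n x (act t y) k (rk-dn d b) f′ (L₂ d nd x⊑y)) (Desc-⊑ d)
      far-case (yes dx) = subst (_⊑ y) (act-invol t _) (L₁ d (⊑-trans
        (subst (_⊑ act t y) (act-comm x ft) (go n (act t x) (act t y) k (rk-dn d b) f′ (L₃ d dx x⊑y)))
        (Desc-⊑ d)))
    ...       | adj a = adj-case (Desc? x t)
      where
      dk : Desc (act t y) k
      dk = fixed-desc a p f d
      z = act k (act t y)
      tz : act t z ≡ z
      tz = trans (sym (act-braid y a p (proj₁ d))) (cong (λ u → act k (act t u)) f)
      z⊑ : z ⊑ act t y
      z⊑ = Desc-⊑ dk
      rkz : rk z < n
      rkz = ≤-<-trans (rk-mono z⊑) (rk-dn d b)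
      ty⊑ : act t y ⊑ y
      ty⊑ = Desc-⊑ d
      adj-case : Dec (Desc x t) → act k x ⊑ y
      adj-case (no nd) = ⊑-trans (L₁ dk (L₂ d nd x⊑y)) ty⊑
      adj-case (yes dx) with Desc? (act t x) k
      ... | no nd = ⊑-trans (L₁ dk (⊑-trans
              (subst (_⊑ z) (act-invol t x) (go n (act t x) z t rkz tz (L₂ dk nd (L₃ d dx x⊑y)))) z⊑)) ty⊑
      ... | yes dd = subst (_⊑ y) (act-invol t _) (L₁ d (⊑-trans (subst (_⊑ act t y) eq
              (L₁ dk (⊑-trans (go n _ z t rkz tz (L₃ dk dd (L₃ d dx x⊑y))) z⊑))) ty⊑))
        where
        eq : act k (act t (act k (act t x))) ≡ act t (act k x)
        eq = trans (act-braid (act t x) a p (proj₁ d)) (cong (λ u → act t (act k u)) (act-invol t x))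

  rank-eq : ∀ {x y} → x ⊑ y → rk x ≡ rk y → x ≡ y
  rank-eq {x} {y} = go (suc (rk y)) x y (n<1+n _)
    where
    go : ∀ n x y → rk y < n → x ⊑ y → rk x ≡ rk y → x ≡ y
    go (suc n) x y b le eq with y ≟X ê
    ... | yes refl = ⊑e le
    ... | no y≢e with desc y≢e
    ...   | t , d with Desc? x t
    ...     | yes dx = act-inj t (go n _ _ (rk-dn d b) (L₃ d dx le)
                         (suc-injective (trans (sym (Desc-rk dx)) (trans eq (Desc-rk d)))))
    ...     | no nd = ⊥-elim (1+n≰n (≤-trans (≤-reflexive (trans (sym (Desc-rk d)) (sym eq))) (rk-mono (L₂ d nd le))))

  ⊑-antisym : ∀ {x y} → x ⊑ y → y ⊑ x → x ≡ y
  ⊑-antisym p q = rank-eq p (≤-antisym (rk-mono p) (rk-mono q))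

  ≢⇒rk< : ∀ {x y} → x ⊑ y → x ≢ y → rk x < rk y
  ≢⇒rk< p q = ≤∧≢⇒< (rk-mono p) (λ r → q (rank-eq p r))

  act-compat : ∀ {k x y} → x ⋖ y → act k x ≢ y → act k x ⊑ act k y
  act-compat {k} {x} {y} (le , r) ne with stat k y
  ... | up d = L₁ d (⊑-trans le (proj₁ (up-⋖ d)))
  ... | fx f = subst (act k x ⊑_) (sym f) (lift-fixed f le)
  ... | dn d with Desc? x k
  ...   | yes dx = L₃ d dx le
  ...   | no nd = ⊥-elim (ne (trans (cong (act k) (rank-eq (L₂ d nd le)
                    (suc-injective (trans (sym r) (Desc-rk d))))) (act-invol k y)))

  -- Gradedness by `rk`. If `t` is a descent of both elements, a cover of `act t x` below `act t y`
  -- is raised by `act t` to a cover of `x`, unless it is `x` itself; then `x` already lies below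
  -- `act t y`.
  cover-below : ∀ {x y} → x ⊑ y → x ≢ y → ∃ λ z → x ⋖ z × z ⊑ y
  cover-below {x} {y} = go (suc (rk y)) x y (n<1+n _)
    where
    go : ∀ n x y → rk y < n → x ⊑ y → x ≢ y → ∃ λ z → x ⋖ z × z ⊑ y
    go (suc n) x y b le ne with y ≟X ê
    ... | yes refl = ⊥-elim (ne (⊑e le))
    ... | no y≢e with desc y≢e
    ...   | t , d = main (Desc? x t)
      where
      ty = act t y
      direct : x ⊑ ty → ∃ λ z → x ⋖ z × z ⊑ y
      direct le′ with x ≟X ty
      ... | yes refl = y , Desc-⋖ d , ⊑-refl
      ... | no q with go n x ty (rk-dn d b) le′ q
      ...   | z , c , l = z , c , ⊑-trans l (Desc-⊑ d)
      main : Dec (Desc x t) → ∃ λ z → x ⋖ z × z ⊑ y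
      main (no nd) = direct (L₂ d nd le)
      main (yes dx) with go n (act t x) ty (rk-dn d b) (L₃ d dx le) (λ q → ne (act-inj t q))
      ... | z , c , l with act t (act t x) ≟X z
      ...   | yes q = direct (subst (_⊑ ty) (trans (sym q) (act-invol t x)) l)
      ...   | no q = act t z , (le′ , rkz) , L₁ d (⊑-trans l (Desc-⊑ d))
        where
        le′ : x ⊑ act t z
        le′ = subst (_⊑ act t z) (act-invol t x) (act-compat c q)
        eqrk : rk z ≡ rk x
        eqrk = trans (proj₂ c) (sym (Desc-rk dx))
        rkz : rk (act t z) ≡ suc (rk x)
        rkz = ≤-antisym (subst (λ a → rk (act t z) ≤ suc a) eqrk (rk-act t z))
          (≢⇒rk< le′ λ r → 1+n≢n (trans (sym (proj₂ c)) (cong rk (trans (sym (act-invol t z)) (cong (act t) (sym r))))))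

  cover-above : ∀ {x y} → x ⊑ y → x ≢ y → ∃ λ z → x ⊑ z × z ⋖ y
  cover-above {x} {y} p q = go (rk y ∸ rk x) x p q ≤-refl
    where
    go : ∀ n x → x ⊑ y → x ≢ y → rk y ∸ rk x ≤ n → ∃ λ z → x ⊑ z × z ⋖ y
    go zero x p q b = ⊥-elim (<⇒≱ (≢⇒rk< p q) (m∸n≡0⇒m≤n (n≤0⇒n≡0 b)))
    go (suc n) x p q b with cover-below p q
    ... | z , c , l with z ≟X y
    ...   | yes refl = x , ⊑-refl , c
    ...   | no r with go n z l r (s≤s⁻¹ (≤-trans (subst (λ a → suc (rk y ∸ a) ≤ rk y ∸ rk x) (sym (proj₂ c))
                        (∸-monoʳ-< (n<1+n _) (subst (_≤ rk y) (proj₂ c) (rk-mono l)))) b))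
    ...     | w , l′ , c′ = w , ⊑-trans (proj₁ c) l′ , c′

  _⊑?_ : ∀ x y → Dec (x ⊑ y)
  x ⊑? y = go (suc (rk y)) x y (n<1+n _)
    where
    go : ∀ n x y → rk y < n → Dec (x ⊑ y)
    go (suc n) x y b with y ≟X ê
    ... | yes refl with x ≟X ê
    ...   | yes refl = yes ⊑-refl
    ...   | no q = no λ l → q (⊑e l)
    go (suc n) x y b | no y≢e with desc y≢e
    ... | t , d with Desc? x t
    ...   | no nd with go n x (act t y) (rk-dn d b)
    ...     | yes l = yes (⊑-trans l (Desc-⊑ d))
    ...     | no q = no λ l → q (L₂ d nd l)
    go (suc n) x y b | no y≢e | t , d | yes dx with go n (act t x) (act t y) (rk-dn d b)
    ... | yes l = yes (subst (_⊑ y) (act-invol t x) (L₁ d (⊑-trans l (Desc-⊑ d))))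
    ... | no q = no λ l → q (L₃ d dx l)

  -- Mirror symmetry.

  -- `k` and `k′` index generators exchanged by the automorphism `θ`; `mir` turns conjugation by one
  -- into conjugation by the other.
  record Mir (k k′ : ℕ) : Set where
    constructor mk
    field sum≡ : suc (suc (k + k′)) ≡ m

  Mir-sym : ∀ {k k′} → Mir k k′ → Mir k′ k
  Mir-sym {k} {k′} (mk p) = mk (trans (cong (λ a → suc (suc a)) (+-comm k′ k)) p)

  mirror : ∀ {k} → suc k < m → ∃ (Mir k)
  mirror {k} p with m≤n⇒∃[o]m+o≡n p
  ... | o , q = o , mk q

  Mir-< : ∀ {k k′} → Mir k k′ → suc k < m
  Mir-< {k} {k′} (mk p) = subst (suc (suc k) ≤_) p (s≤s (s≤s (m≤m+n k k′)))

  Mir-suc : ∀ {k k′} → Mir (suc k) k′ → Mir k (suc k′)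
  Mir-suc {k} {k′} (mk p) = mk (trans (cong (λ a → suc (suc a)) (+-suc k k′)) p)

  Mir-func : ∀ {k a b} → Mir k a → Mir k b → a ≡ b
  Mir-func {k} (mk p) (mk q) = +-cancelˡ-≡ k _ _ (suc-injective (suc-injective (trans p (sym q))))

  sw-mir : ∀ {k k′ i j} → Mir k k′ → suc (i + j) ≡ m → suc (sw k′ i + sw k j) ≡ m
  sw-mir {k} {k′} {i} {j} (mk p) q with j ≟ k | j ≟ suc k
  ... | yes refl | _ = trans (cong₂ (λ a b → suc (a + b)) (trans (cong (sw k′) i≡) (sw-r k′)) (sw-l k))
      (trans (cong suc (trans (+-suc k′ k) (cong suc (+-comm k′ k)))) p)
    where
    i≡ : i ≡ suc k′
    i≡ = +-cancelʳ-≡ k _ _ (suc-injective (trans q (trans (sym p) (cong (λ a → suc (suc a)) (+-comm k k′)))))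
  ... | no _ | yes refl = trans (cong₂ (λ a b → suc (a + b)) (trans (cong (sw k′) i≡) (sw-l k′)) (sw-r k))
      (trans (cong (λ a → suc (suc a)) (+-comm k′ k)) p)
    where
    i≡ : i ≡ k′
    i≡ = +-cancelʳ-≡ (suc k) _ _ (suc-injective (trans q (trans (sym p) (cong suc (trans (cong suc (+-comm k k′)) (sym (+-suc k′ k)))))))
  ... | no a | no b = trans (cong₂ (λ a b → suc (a + b)) (sw-o k′ i i≢ i≢′) (sw-o k j a b)) q
    where
    i≢ : i ≢ k′
    i≢ refl = b (+-cancelˡ-≡ i _ _ (suc-injective (trans q (trans (sym p) (cong suc (trans (cong suc (+-comm k i)) (sym (+-suc i k))))))))
    i≢′ : i ≢ suc k′
    i≢′ refl = a (+-cancelˡ-≡ (suc k′) _ _ (suc-injective (trans q (trans (sym p) (cong (λ c → suc (suc c)) (+-comm k k′))))))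

  private
    opp′ : ∀ {i} → i < m → ∃ λ j → suc (i + j) ≡ m
    opp′ p = m≤n⇒∃[o]m+o≡n p

    cancel : ∀ a b c → suc (a + c) ≡ m → suc (b + c) ≡ m → a ≡ b
    cancel a b c p q = +-cancelʳ-≡ c _ _ (suc-injective (trans p (sym q)))

    flip-sum : ∀ a b → suc (a + b) ≡ m → suc (b + a) ≡ m
    flip-sum a b p = trans (cong suc (+-comm b a)) p

  mir-act : ∀ {k k′} x → Mir k k′ → mir (act k x) ≡ act k′ (mir x)
  mir-act {k} {k′} x p = F-ext go
    where
    go : ∀ i → i < m → F (mir (act k x)) i ≡ F (act k′ (mir x)) i
    go i i<m with opp′ i<m
    ... | j , q = cancel _ _ (F (act k x) j) (F-mir (act k x) {i} {j} q)
      (subst₂ (λ a b → suc (a + b) ≡ m) (sym (F-act (mir x) (Mir-< (Mir-sym p)) i)) (sym (F-act x (Mir-< p) j))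
        (sw-mir {i = F (mir x) (sw k′ i)} {j = F x (sw k j)} p
          (F-mir x {sw k′ i} {sw k j} (sw-mir {i = i} {j = j} p q))))

  mir-invol : ∀ x → mir (mir x) ≡ x
  mir-invol x = F-ext λ i i<m → let (j , q) = opp′ i<m in
    cancel _ _ (F (mir x) j) (F-mir (mir x) {i} {j} q) (flip-sum (F (mir x) j) (F x i) (F-mir x {j} {i} (flip-sum i j q)))

  mir-Desc : ∀ {k k′ x} → Mir k k′ → Desc x k → Desc (mir x) k′
  mir-Desc {k} {k′} {x} mp@(mk p) (_ , d) = Mir-< (Mir-sym mp) ,
    +-cancelʳ-< (F x (suc k)) (F (mir x) k′) (F (mir x) (suc k′))
      (subst (_< F (mir x) (suc k′) + F x (suc k))
        (suc-injective (trans (F-mir x {suc k′} {k} (trans (cong (λ a → suc (suc a)) (+-comm k′ k)) p))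
          (sym (F-mir x {k′} {suc k} (trans (cong suc (trans (+-suc k′ k) (cong suc (+-comm k′ k)))) p)))))
        (+-monoʳ-< (F (mir x) (suc k′)) d))

  mir-Desc⁻ : ∀ {k k′ x} → Mir k k′ → Desc (mir x) k → Desc x k′
  mir-Desc⁻ {k′ = k′} {x} p d = subst (λ y → Desc y k′) (mir-invol x) (mir-Desc p d)

  mir-e : mir ê ≡ ê
  mir-e = no-desc λ k d → Desc-e _ (mir-Desc⁻ (proj₂ (mirror (proj₁ d))) d)

  mir-rk : ∀ x → rk (mir x) ≡ rk x
  mir-rk x = go (suc (rk x)) x (n<1+n _)
    where
    go : ∀ n x → rk x < n → rk (mir x) ≡ rk x
    go (suc n) x b with x ≟X ê
    ... | yes refl = cong rk mir-e
    ... | no q with desc q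
    ...   | t , d with mirror (proj₁ d)
    ...     | t′ , p = trans (Desc-rk (mir-Desc p d)) (trans (cong (λ y → suc (rk y)) (sym (mir-act x p)))
                (trans (cong suc (go n _ (rk-dn d b))) (sym (Desc-rk d))))

  mir-⊑ : ∀ {x y} → x ⊑ y → mir x ⊑ mir y
  mir-⊑ {x} {y} = go (suc (rk y)) x y (n<1+n _)
    where
    go : ∀ n x y → rk y < n → x ⊑ y → mir x ⊑ mir y
    go (suc n) x y b le with y ≟X ê
    ... | yes refl = subst (λ z → mir z ⊑ mir ê) (sym (⊑e le)) ⊑-refl
    ... | no q with desc q
    ...   | t , d with mirror (proj₁ d)
    ...     | t′ , p = main (Desc? x t)
      where
      d′ : Desc (mir y) t′
      d′ = mir-Desc p d
      low : ∀ {w} → w ⊑ act t y → mir w ⊑ mir y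
      low l = ⊑-trans (go n _ (act t y) (rk-dn d b) l) (subst (_⊑ mir y) (sym (mir-act y p)) (Desc-⊑ d′))
      main : Dec (Desc x t) → mir x ⊑ mir y
      main (no nd) = low (L₂ d nd le)
      main (yes dx) = subst (_⊑ mir y) (trans (cong (act t′) (mir-act x p)) (act-invol t′ _))
        (L₁ d′ (low (L₃ d dx le)))

  mir-⋖ : ∀ {x y} → x ⋖ y → mir x ⋖ mir y
  mir-⋖ {x} {y} (p , q) = mir-⊑ p , trans (mir-rk y) (trans q (cong suc (sym (mir-rk x))))

  -- Elements of rank at least three are determined by their coatoms.

  record SameCo (x y : X) : Set where
    constructor sameCo
    field
      rk≡  : rk x ≡ rk y
      to   : ∀ {c} → c ⋖ x → c ⊑ y
      from : ∀ {c} → c ⋖ y → c ⊑ x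

    to⋖ : ∀ {c} → c ⋖ x → c ⋖ y
    to⋖ p = to p , trans (sym rk≡) (proj₂ p)

    from⋖ : ∀ {c} → c ⋖ y → c ⋖ x
    from⋖ p = from p , trans rk≡ (proj₂ p)

  open SameCo

  SameCo-sym : ∀ {x y} → SameCo x y → SameCo y x
  SameCo-sym (sameCo r t f) = sameCo (sym r) f t

  SameCo-mir : ∀ {x y} → SameCo x y → SameCo (mir x) (mir y)
  SameCo-mir {x} {y} s = sameCo (trans (mir-rk x) (trans (rk≡ s) (sym (mir-rk y)))) (half s) (half (SameCo-sym s))
    where
    half : ∀ {x y} → SameCo x y → ∀ {c} → c ⋖ mir x → c ⊑ mir y
    half {x} {y} s {c} p = subst (_⊑ mir y) (mir-invol c)
      (mir-⊑ (to s (subst (mir c ⋖_) (mir-invol x) (mir-⋖ p))))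

  -- `act s x` is a coatom of `x`, hence lies below `y`, and lifting it back along `s` puts `x`
  -- below `y`.
  common-desc : ∀ {x y s} → SameCo x y → Desc x s → Desc y s → x ≡ y
  common-desc {x} {y} {s} c dx dy =
    rank-eq (subst (_⊑ y) (act-invol s x) (L₁ dy (to c (Desc-⋖ dx)))) (rk≡ c)

  coatom-desc : ∀ {x c s} → Desc x s → c ⋖ x → c ≢ act s x → Desc c s
  coatom-desc {x} {c} {s} d p ne with Desc? c s
  ... | yes q = q
  ... | no q = ⊥-elim (ne (rank-eq (L₂ d q (proj₁ p)) (suc-injective (trans (sym (proj₂ p)) (Desc-rk d)))))

  private
    rk-2 : ∀ {x s t} → Desc x s → Desc (act s x) t → rk x ≡ suc (suc (rk (act t (act s x))))
    rk-2 d d′ = trans (Desc-rk d) (cong suc (Desc-rk d′))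

  -- By the braid relation two conjugations lead from the element three ranks below `x` to
  -- `act t x`, whose rank is therefore smaller than that of `x`.
  braid-Desc : ∀ {x s t} → Adj s t → Desc x s → Desc (act s x) t → Desc (act t (act s x)) s → Desc x t
  braid-Desc {x} {s} {t} a d₁ d₂ d₃ = rk-<-Desc (≤-trans (s≤s bound) (≤-reflexive (sym (trans (rk-2 d₁ d₂) (cong (λ n → suc (suc n)) (Desc-rk d₃))))))
    where
    w = act s (act t (act s x))
    bound : rk (act t x) ≤ suc (suc (rk w))
    bound = ≤-trans (subst (λ u → rk u ≤ suc (rk (act t w))) back (rk-act s (act t w))) (s≤s (rk-act t w))
      where
      back : act s (act t w) ≡ act t x
      back = trans (cong (λ u → act s (act t u)) (act-braid x a (proj₁ d₁) (proj₁ d₂)))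
        (trans (cong (act s) (act-invol t _)) (act-invol s _))

  -- x and y are the two elements of rank two in the hexagon with bottom z
  -- under the generators k and suc k; a descent of z at i = pred k then
  -- separates the coatoms of x from those of y.
  module AdjacentDescents {x y z i} (sc : SameCo x y) (x≢y : x ≢ y)
    (x≡ : act (suc i) (act (suc (suc i)) z) ≡ x) (y≡ : act (suc (suc i)) (act (suc i) z) ≡ y)
    (uk : Desc (act (suc i) z) (suc i)) (ut : Desc (act (suc (suc i)) z) (suc (suc i)))
    (dx : Desc x (suc i)) (dy : Desc y (suc (suc i))) (dz : Desc z i) where
    private
      k = suc i
      t = suc k
      g A B C : ℕ
      g = F z i
      A = F z k
      B = F z t
      C = F z (suc t)
      k<m : suc k < m
      k<m = proj₁ uk
      t<m : suc t < m
      t<m = proj₁ ut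
      i<m : suc i < m
      i<m = proj₁ dz
      B<A : B < A
      B<A = proj₁ (proj₂ (up-inv uk))
      C<B : C < B
      C<B = proj₁ (proj₂ (up-inv ut))
      A≢t : A ≢ t
      A≢t = proj₂ (proj₂ (up-inv uk))
      B≢k : B ≢ k
      B≢k p = A≢t (F-swap z p)
      B≢t : B ≢ t
      B≢t = F-fpf z k<m
      B≢1+t : B ≢ suc t
      B≢1+t = proj₂ (proj₂ (up-inv ut))
      C≢1+t : C ≢ suc t
      C≢1+t = F-fpf z t<m
      C≢t : C ≢ t
      C≢t p = B≢1+t (F-swap z p)
      C≢k : C ≢ k
      C≢k p = B≢t (≤-antisym (s≤s⁻¹ (subst (B <_) (F-swap z p) B<A)) (subst (_< B) p C<B))

      C<sw : ∀ {a} → C < a → C < sw t (sw k a)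
      C<sw p = subst (_< _) (trans (cong (sw t) (sw-o k C C≢k C≢t)) (sw-o t C C≢t C≢1+t))
        (sw-mono t (sw-mono k p λ r _ → C≢k r) λ r _ → C≢t (trans (sym (sw-o k C C≢k C≢t)) r))

      sw<C : ∀ {a} → C < sw k (sw t a) → C < a
      sw<C {a} p = subst (C <_) (trans (cong (sw t) (sw-invol k _)) (sw-invol t a)) (C<sw p)

      sw<B : ∀ {a} → B < sw t (sw k a) → B < a
      sw<B {a} p = subst (B <_) (trans (cong (sw k) (sw-invol t _)) (sw-invol k a))
        (subst (_< _) (trans (cong (sw k) (sw-o t B B≢t B≢1+t)) (sw-o k B B≢k B≢t))
          (sw-mono k (sw-mono t p λ r _ → B≢t r) λ r _ → B≢k (trans (sym (sw-o t B B≢t B≢1+t)) r)))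

      sw<B⁺ : ∀ {a} → a < B → sw t (sw k a) < B
      sw<B⁺ p = subst (_ <_) (trans (cong (sw t) (sw-o k B B≢k B≢t)) (sw-o t B B≢t B≢1+t))
        (sw-mono t (sw-mono k p λ _ → B≢t) λ _ r → B≢1+t (trans (sym (sw-o k B B≢k B≢t)) r))

      C>sw : ∀ {a} → sw k (sw t a) < C → a < C
      C>sw {a} p = subst₂ _<_ (trans (cong (sw t) (sw-invol k _)) (sw-invol t a))
        (trans (cong (sw t) (sw-o k C C≢k C≢t)) (sw-o t C C≢t C≢1+t))
        (sw-mono t (sw-mono k p λ _ → C≢t) λ _ r → C≢1+t (trans (sym (sw-o k C C≢k C≢t)) r))

      Fx-i : F x i ≡ sw k (sw t g)
      Fx-i = trans (cong (λ w → F w i) (sym x≡)) (trans (F-o _ k<m (λ ()) (λ ())) (cong (sw k) (F-o z t<m (λ ()) (λ ()))))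
      Fx-k : F x k ≡ C
      Fx-k = trans (cong (λ w → F w k) (sym x≡)) (trans (F-l _ k<m) (trans (cong (sw k) (F-l z t<m))
        (trans (cong (sw k) (sw-o t C C≢t C≢1+t)) (sw-o k C C≢k C≢t))))
      Fy-i : F y i ≡ sw t (sw k g)
      Fy-i = trans (cong (λ w → F w i) (sym y≡)) (trans (F-o _ t<m (λ ()) (λ ())) (cong (sw t) (F-o z k<m (λ ()) (λ ()))))
      Fy-k : F y k ≡ B
      Fy-k = trans (cong (λ w → F w k) (sym y≡)) (trans (F-o _ t<m (λ ()) (λ ())) (trans (cong (sw t) (F-l z k<m))
        (trans (cong (sw t) (sw-o k B B≢k B≢t)) (sw-o t B B≢t B≢1+t))))
      Fy-t : F y t ≡ C
      Fy-t = trans (cong (λ w → F w t) (sym y≡)) (trans (F-l _ t<m) (trans (cong (sw t) (F-o z k<m (λ ()) (λ ())))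
        (trans (cong (sw t) (sw-o k C C≢k C≢t)) (sw-o t C C≢t C≢1+t))))

      sx≡ : act k x ≡ act t z
      sx≡ = trans (cong (act k) (sym x≡)) (act-invol k _)
      ty≡ : act t y ≡ act k z
      ty≡ = trans (cong (act t) (sym y≡)) (act-invol t _)

      dtz : Desc (act t z) i
      dtz = Desc-far (inj₁ ≤-refl) dz (up-¬ ut)

      C≡i : C ≡ i → g ≡ suc t
      C≡i p = F-swap z p

      -- `act i y` is a coatom of `y`, hence of `x`, so it must have the descent `k`; its values at
      -- `k` and `t` come in the wrong order.
      case-y : Desc y i → ¬ Desc x i → ⊥
      case-y dyi ndx = <-asym (proj₂ (coatom-desc dx (from⋖ sc (Desc-⋖ dyi)) ne))
          (subst₂ _<_ (sym (trans (F-o y i<m (λ ()) (λ ())) (cong (sw i) Fy-t)))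
                      (sym (trans (F-r y i<m) (cong (sw i) Fy-i)))
            (sw-mono i (C<sw C<g) λ p q → contr (trans (sym q) (trans (cong (λ a → sw t (sw k a)) (C≡i p))
              (trans (cong (sw t) (sw-high k (suc t) ≤-refl)) (sw-r t))))))
        where
        contr : suc i ≡ suc (suc i) → ⊥
        contr ()
        C<g : C < g
        C<g = sw<C (subst₂ _<_ Fx-k Fx-i (¬Desc-asc i<m ndx))
        ne : act i y ≢ act k x
        ne p = Desc-irr dyi (subst (λ w → Desc w i) (sym (trans p sx≡)) dtz)

      -- The witness `c` is `x` with `z` replaced by `act i z`. It is a coatom of `x`, hence of `y`,
      -- and would need the descent `t`, which `B < g` forbids.
      case-none : ¬ Desc y i → ¬ Desc x i → ⊥
      case-none ndy ndx = <-asym (proj₂ (coatom-desc dy c⋖y ne))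
          (subst₂ _<_ (sym Fc-1+t) (sym Fc-t) g-last)
        where
        C<g : C < g
        C<g = sw<C (subst₂ _<_ Fx-k Fx-i (¬Desc-asc i<m ndx))
        B<g : B < g
        B<g = sw<B (subst₂ _<_ Fy-k Fy-i (¬Desc-asc i<m ndy))
        u = act t (act i z)
        c = act k u
        u≡ : u ≡ act i (act t z)
        u≡ = act-comm z (inj₂ ≤-refl)
        Fu-k : F u k ≡ sw t (sw i g)
        Fu-k = trans (F-o _ t<m (λ ()) (λ ())) (cong (sw t) (F-r z i<m))
        Fu-t : F u t ≡ sw t (sw i C)
        Fu-t = trans (F-l _ t<m) (cong (sw t) (F-o z i<m (λ ()) (λ ())))
        Fu-1+t : F u (suc t) ≡ sw t (sw i B)
        Fu-1+t = trans (F-r _ t<m) (cong (sw t) (F-o z i<m (λ ()) (λ ())))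
        Fc-t : F c t ≡ sw k (sw t (sw i g))
        Fc-t = trans (F-r u k<m) (cong (sw k) Fu-k)
        Fc-1+t : F c (suc t) ≡ sw k (sw t (sw i B))
        Fc-1+t = trans (F-o u k<m (λ ()) (λ ())) (cong (sw k) Fu-1+t)
        i≢ : ∀ {n} → suc n ≢ suc (suc n)
        i≢ ()
        sw-i-high : ∀ {a} → sw i a ≡ t → a ≡ t
        sw-i-high {a} p = sw-inj i (trans p (sym (sw-high i t ≤-refl)))
        up₁ : sw t (sw i C) < sw t (sw i g)
        up₁ = sw-mono t (sw-mono i C<g λ p q → contr (trans (sym (C≡i p)) q)) λ p _ → C≢t (sw-i-high p)
          where
          contr : suc (suc (suc i)) ≡ suc i → ⊥
          contr ()
        not-fixed : sw t (sw i g) ≢ t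
        not-fixed p = <-irrefl refl (<-≤-trans B<1+i (subst (_< B) C≡ C<B))
          where
          g≡ : g ≡ suc t
          g≡ = sw-inj i (trans (sw-inj t (trans p (sym (sw-r t)))) (sym (sw-high i (suc t) (n≤1+n _))))
          C≡ : C ≡ i
          C≡ = F-swap z g≡
          B<1+i : B < k
          B<1+i = ≤∧≢⇒< (s≤s⁻¹ (≤∧≢⇒< (s≤s⁻¹ (subst (B <_) g≡ B<g)) B≢t)) B≢k
        dc : Desc c k
        dc = asc k<m (subst₂ _<_ (sym Fu-t) (sym Fu-k) up₁) (λ p → not-fixed (trans (sym Fu-k) p))
        rku : rk (act t z) ≡ suc (rk u)
        rku = trans (Desc-rk dtz) (cong (λ w → suc (rk w)) (sym u≡))
        dx′ : Desc (act k (act t z)) k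
        dx′ = subst (λ w → Desc w k) (sym x≡) dx
        c⋖x : c ⋖ x
        c⋖x = L₁ dx (⊑-trans (L₁ ut (⊑-trans (Desc-⊑ dz) (proj₁ (up-⋖ ut))))
                (subst (_⊑ x) sx≡ (Desc-⊑ dx)))
          , trans (trans (Desc-rk dx) (cong (λ w → suc (rk w)) sx≡)) (cong suc (trans rku (sym (up-rk dc))))
        c⋖y : c ⋖ y
        c⋖y = to⋖ sc c⋖x
        ne : c ≢ act t y
        ne p = <⇒≢ (<-trans (≤-reflexive (sym (Desc-rk dz))) (≤-reflexive (sym (up-rk ut))))
                 (cong rk (act-inj t (trans (act-inj k (trans p ty≡)) (sym (act-invol t z)))))
        g-last : sw k (sw t (sw i B)) < sw k (sw t (sw i g))
        g-last = sw-mono k (sw-mono t (sw-mono i B<g λ p q → c₁ (trans (sym (F-swap z p)) q))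
                   (λ p _ → B≢t (sw-i-high p)))
                   λ p q → c₂ (trans (sym q) (g-val (B-val p)))
          where
          c₁ : suc (suc i) ≡ suc i → ⊥
          c₁ ()
          c₂ : suc (suc i) ≡ suc (suc (suc i)) → ⊥
          c₂ ()
          B-val : sw t (sw i B) ≡ k → B ≡ i
          B-val p = sw-inj i (trans (sw-inj t (trans p (sym (sw-low t k ≤-refl)))) (sym (sw-l i)))
          g-val : B ≡ i → sw t (sw i g) ≡ suc t
          g-val p = trans (cong (λ a → sw t (sw i a)) (F-swap z p)) (trans (cong (sw t) (sw-high i t ≤-refl)) (sw-l t))

    hexagon-⊥ : ⊥
    hexagon-⊥ with Desc? x i | Desc? y i
    ... | yes a | yes b = x≢y (common-desc sc a b)
    ... | no a  | yes b = case-y b a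
    ... | no a  | no b  = case-none b a
    -- A descent of `x` at `i` puts `g` below `C`, hence below `B`, and this makes `i` a descent of
    -- `y` as well.
    ... | yes (_ , a) | no b = b (i<m , subst₂ _<_ (sym Fy-i) (sym Fy-k)
        (sw<B⁺ (<-trans (C>sw (subst₂ _<_ Fx-i Fx-k a)) C<B)))

  rk-pos : ∀ {x n} → rk x ≡ suc n → ∃ (Desc x)
  rk-pos p = desc (rk>0 p)

  private
    -- Each of `act k x` and `act t y` is a coatom of the other element and inherits its descent.
    -- Two steps down from `x` and from `y` then end in the same `z`, so `x` and `y` have rank two
    -- in a hexagon over `z`. The rank hypothesis gives `z` a descent, and its position relative to
    -- `k` and `t` decides how it tells `x` from `y`.
    clash-adj : ∀ {x y k n} → SameCo x y → x ≢ y → rk x ≡ suc (suc (suc n)) →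
                Desc x k → Desc y (suc k) → act k x ≢ act (suc k) y → ⊥
    clash-adj {x} {y} {k} {n} sc x≢y r dx dy ne = separate (rk-pos rkz)
      where
      t = suc k
      z = act t (act k x)
      z′ = act k (act t y)
      d₁ : Desc (act k x) t
      d₁ = coatom-desc dy (to⋖ sc (Desc-⋖ dx)) ne
      d₂ : Desc (act t y) k
      d₂ = coatom-desc dx (from⋖ sc (Desc-⋖ dy)) (λ p → ne (sym p))
      rkz : rk z ≡ suc n
      rkz = suc-injective (suc-injective (trans (sym (trans (Desc-rk dx) (cong suc (Desc-rk d₁)))) r))
      rkz′ : rk z′ ≡ suc n
      rkz′ = suc-injective (suc-injective (trans (sym (trans (Desc-rk dy) (cong suc (Desc-rk d₂)))) (trans (sym (rk≡ sc)) r)))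
      nz : ¬ Desc z k
      nz d = x≢y (common-desc sc (braid-Desc (inj₁ refl) dx d₁ d) dy)
      z≡z′ : z ≡ z′
      z≡z′ = rank-eq (L₂ d₂ nz (L₃ dy d₁ (to sc (Desc-⋖ dx)))) (trans rkz (sym rkz′))
      x≡ : act k (act t z) ≡ x
      x≡ = trans (cong (act k) (act-invol t _)) (act-invol k x)
      kz≡ : act k z ≡ act t y
      kz≡ = trans (cong (act k) z≡z′) (act-invol k _)
      y≡ : act t (act k z) ≡ y
      y≡ = trans (cong (act t) kz≡) (act-invol t y)
      uk : Desc (act k z) k
      uk = subst (λ w → Desc w k) (sym kz≡) d₂
      ut : Desc (act t z) t
      ut = subst (λ w → Desc w t) (sym (act-invol t _)) d₁
      x-far : ∀ {h} → Far h k → Far h t → Desc z h → ⊥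
      x-far {h} fk ft d = x≢y (common-desc sc
        (subst (λ w → Desc w h) x≡ (Desc-far fk (Desc-far ft d (up-¬ ut)) (up-¬ (subst (λ w → Desc w k) (sym x≡) dx))))
        (subst (λ w → Desc w h) y≡ (Desc-far ft (Desc-far fk d (up-¬ uk)) (up-¬ (subst (λ w → Desc w t) (sym y≡) dy)))))
      separate : ∃ (Desc z) → ⊥
      separate (h , d) with rel h k
      ... | same refl = up-¬ uk d
      ... | adj (inj₂ refl) = up-¬ ut d
      ... | adj (inj₁ refl) = AdjacentDescents.hexagon-⊥ sc x≢y x≡ y≡ uk ut dx dy d
      ... | far fk with rel h t
      ...   | same refl = up-¬ ut d
      ...   | far ft = x-far fk ft d
      ...   | adj (inj₁ refl) = [ (λ q → <⇒≱ q (n≤1+n _)) , (λ q → <⇒≱ q (n≤1+n _)) ]′ fk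
      -- A descent of `z` just above `t` becomes one just below the hexagon generators under `mir`,
      -- with the roles of `x` and `y` exchanged.
      ...   | adj (inj₂ refl) with mirror (proj₁ d)
      ...     | i′ , p = AdjacentDescents.hexagon-⊥ (SameCo-mir (SameCo-sym sc)) (λ q → x≢y (sym (trans (sym (mir-invol y)) (trans (cong mir q) (mir-invol x)))))
                  (mirrored k t y≡ p₁ p₂) (mirrored t k x≡ p₂ p₁)
                  (subst (λ w → Desc w (suc i′)) (mir-act z p₁) (mir-Desc p₁ ut))
                  (subst (λ w → Desc w (suc (suc i′))) (mir-act z p₂) (mir-Desc p₂ uk))
                  (mir-Desc p₁ dy) (mir-Desc p₂ dx) (mir-Desc p d)
        where
        p₁ : Mir t (suc i′)
        p₁ = Mir-suc p
        p₂ : Mir k (suc (suc i′))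
        p₂ = Mir-suc p₁
        mirrored : ∀ a b {a′ b′ w} → act b (act a z) ≡ w → Mir b b′ → Mir a a′ → act b′ (act a′ (mir z)) ≡ mir w
        mirrored a b q pb pa = trans (cong (act _) (sym (mir-act z pa))) (trans (sym (mir-act _ pb)) (cong mir q))

  clash : ∀ {x y s t n} → SameCo x y → x ≢ y → rk x ≡ suc (suc (suc n)) →
          Desc x s → Desc y t → act s x ≢ act t y → ⊥
  clash {x} {y} {s} {t} sc x≢y r dx dy ne with rel s t
  ... | same refl = x≢y (common-desc sc dx dy)
  ... | adj (inj₁ refl) = clash-adj sc x≢y r dx dy ne
  ... | adj (inj₂ refl) = clash-adj (SameCo-sym sc) (λ p → x≢y (sym p)) (trans (sym (rk≡ sc)) r) dy dx (λ p → ne (sym p))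
  ... | far f = x≢y (common-desc sc
          (subst (λ w → Desc w t) (act-invol s x)
            (Desc-far (Far-sym f) (coatom-desc dy (to⋖ sc (Desc-⋖ dx)) ne) (up-¬ (subst (λ w → Desc w s) (sym (act-invol s x)) dx))))
          dy)

  private
    up-of : ∀ {x s} → Desc x s → ¬ Desc (act s x) s
    up-of d d′ = Desc-irr d d′

    Desc-act : ∀ {x s} → Desc x s → Desc (act s (act s x)) s
    Desc-act {x} {s} d = subst (λ w → Desc w s) (sym (act-invol s x)) d

    no-return : ∀ {x d i} → Desc d i → Desc x i → act i x ≢ d
    no-return {x} {d} {i} dd dx p = Desc-irr dx (subst (λ w → Desc w i) (sym p) dd)

    -- `F d` decreases except from `i` to `t`. By `clash`, `i` is a descent of neither `x` nor `y`,
    -- which gives `δ < β < γ < α`. Being an involution, `F d` then also rises at the index `β`, so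
    -- `β ≡ i` would be a fixed point.
    shared-adj : ∀ {x y k n} → SameCo x y → x ≢ y → rk x ≡ suc (suc (suc n)) →
                 Desc x k → Desc y (suc (suc k)) → act k x ≡ act (suc (suc k)) y →
                 (∀ h → Desc (act k x) h → h ≡ suc k) → Desc (act k x) (suc k) → ⊥
    shared-adj {x} {y} {k} sc x≢y r dx dy eq only di = F-fpf d (<-trans (n<1+n _) i<m) (trans (cong (F d) (sym β≡i)) (F-invol d i))
      where
      i = suc k
      t = suc i
      d = act k x
      k<m : suc k < m
      k<m = proj₁ dx
      i<m : suc i < m
      i<m = proj₁ di
      t<m : suc t < m
      t<m = proj₁ dy
      α = F d k
      β = F d i
      γ = F d t
      δ = F d (suc t)
      dt : Desc (act t d) t
      dt = subst (λ w → Desc (act t w) t) (sym eq) (Desc-act dy)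
      dk : Desc (act k d) k
      dk = Desc-act dx
      x≡ : act k d ≡ x
      x≡ = act-invol k x
      y≡ : act t d ≡ y
      y≡ = trans (cong (act t) eq) (act-invol t y)
      nx : ¬ Desc x i
      nx q = clash sc x≢y r q dy (λ p → no-return di q (trans p (sym eq)))
      ny : ¬ Desc y i
      ny q = clash sc x≢y r dx q (λ p → no-return di q (sym p))
      α>β : β < α
      α>β = proj₁ (proj₂ (up-inv dk))
      α>γ : γ < α
      α>γ = sw-mono⁻ k (subst₂ _<_
        (trans (cong (λ w → F w t) (sym x≡)) (F-o d k<m (λ ()) (λ ())))
        (trans (cong (λ w → F w i) (sym x≡)) (F-r d k<m)) (¬Desc-asc i<m nx))
        (λ _ p → F-fpf d (<-trans (n<1+n k) k<m) p)
      β>δ : δ < β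
      β>δ = sw-mono⁻ t (subst₂ _<_
        (trans (cong (λ w → F w t) (sym y≡)) (F-l d t<m))
        (trans (cong (λ w → F w i) (sym y≡)) (F-o d t<m (λ ()) (λ ()))) (¬Desc-asc i<m ny))
        (λ p _ → F-fpf d t<m p)
      β<γ : β < γ
      β<γ = proj₂ di
      dec : ∀ h → suc h < m → h ≢ i → F d (suc h) < F d h
      dec h p ne = ¬Desc-asc p (λ q → ne (only h q))
      above : ∀ j → j < i → α ≤ F d j
      above j j<i = go (k ∸ j) j (m+[n∸m]≡n (s≤s⁻¹ j<i))
        where
        go : ∀ n j → j + n ≡ k → α ≤ F d j
        go zero j p = ≤-reflexive (cong (F d) (trans (sym p) (+-identityʳ j)))
        go (suc n) j p = ≤-trans (go n (suc j) p′) (<⇒≤ (dec j (<-trans (s≤s j<k) k<m) (λ q → <⇒≱ j<k (≤-trans (n≤1+n k) (≤-reflexive (sym q))))))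
          where
          p′ : suc j + n ≡ k
          p′ = trans (sym (+-suc j n)) p
          j<k : j < k
          j<k = subst (suc j ≤_) p′ (s≤s (m≤m+n j n))
      below : ∀ n → suc (t + n) < m → F d (suc (t + n)) ≤ δ
      below zero p = ≤-reflexive (cong (λ a → F d (suc a)) (+-identityʳ t))
      below (suc n) p = ≤-trans (<⇒≤ (subst (λ a → F d (suc a) < F d (suc (t + n))) (sym (+-suc t n))
        (dec (suc (t + n)) p′ (λ q → <⇒≢ (s≤s (m≤n⇒m≤1+n (m≤m+n i n))) (sym q)))))
        (below n (<-trans (n<1+n _) p′))
        where
        p′ : suc (suc (t + n)) < m
        p′ = subst (λ a → suc a < m) (+-suc t n) p
      π = F d (suc β)
      Fπ : F d π ≡ suc β
      Fπ = F-invol d (suc β)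
      -- No value lies strictly between β and γ, hence γ = β + 1 and β is a descent.
      π≡t : π ≡ t
      π≡t with <-cmp π t
      ... | tri≈ _ p _ = p
      ... | tri< p _ _ with m≤n⇒m<n∨m≡n (s≤s⁻¹ p)
      ...   | inj₁ q = ⊥-elim (<⇒≱ (<-≤-trans (s≤s β<γ) α>γ) (≤-trans (above π q) (≤-reflexive Fπ)))
      ...   | inj₂ q = ⊥-elim (1+n≢n (trans (sym Fπ) (cong (F d) q)))
      π≡t | tri> _ _ p with m≤n⇒∃[o]m+o≡n p
      ... | o , q = ⊥-elim (<⇒≱ (<-trans β>δ (n<1+n β))
              (≤-trans (≤-reflexive (trans (sym Fπ) (cong (F d) (sym q)))) (below o (subst (_< m) (sym q) (F-< d 1+β<m)))))
        where
        1+β<m : suc β < m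
        1+β<m = ≤-<-trans β<γ (F-< d i<m)
      β≡i : β ≡ i
      β≡i = only β (≤-<-trans β<γ (F-< d i<m) , subst₂ _<_ (sym (F-invol d i)) (sym π≡t) (n<1+n i))

    -- A descent of the common coatom `d` that is far from `s` or `t` is also a descent of `x` or
    -- `y`, and `clash` applies to it. So every descent of `d` is adjacent to both `s` and `t`, that
    -- is, it is the index between them.
    shared : ∀ {x y s t n} → SameCo x y → x ≢ y → rk x ≡ suc (suc (suc n)) →
             Desc x s → Desc y t → act s x ≡ act t y → ⊥
    shared {x} {y} {s} {t} {n} sc x≢y r dx dy eq = go (rk-pos rkd)
      where
      d = act s x
      rkd : rk d ≡ suc (suc n)
      rkd = suc-injective (trans (sym (Desc-rk dx)) r)
      nt : ¬ Desc d t
      nt q = Desc-irr dy (subst (λ w → Desc w t) eq q)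
      ¬far-s : ∀ {h} → Desc d h → ¬ Far h s
      ¬far-s {h} q f = clash sc x≢y r dx′ dy (λ p → no-return q dx′ (trans p (sym eq)))
        where
        dx′ : Desc x h
        dx′ = subst (λ w → Desc w h) (act-invol s x) (Desc-far f q (up-of dx))
      ¬far-t : ∀ {h} → Desc d h → ¬ Far h t
      ¬far-t {h} q f = clash sc x≢y r dx dy′ (λ p → no-return q dy′ (sym p))
        where
        dy′ : Desc y h
        dy′ = subst (λ w → Desc w h) (trans (cong (act t) eq) (act-invol t y)) (Desc-far f q nt)
      adjs : ∀ {h} → Desc d h → Adj h s × Adj h t
      adjs {h} q with rel h s | rel h t
      ... | same refl | _ = ⊥-elim (up-of dx q)
      ... | far f | _ = ⊥-elim (¬far-s q f)
      ... | _ | same refl = ⊥-elim (nt q)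
      ... | _ | far f = ⊥-elim (¬far-t q f)
      ... | adj a | adj b = a , b
      go : ∃ (Desc d) → ⊥
      go (i , q) with adjs q
      ... | inj₁ refl , inj₁ refl = x≢y (common-desc sc dx dy)
      ... | inj₂ refl , inj₂ p = x≢y (common-desc sc dx (subst (Desc y) (suc-injective (sym p)) dy))
      ... | inj₂ refl , inj₁ refl = shared-adj sc x≢y r dx dy eq only q
        where
        only : ∀ h → Desc d h → h ≡ suc s
        only h q′ with adjs q′
        ... | inj₂ p , _ = p
        ... | inj₁ refl , inj₁ ()
        ... | inj₁ refl , inj₂ ()
      ... | inj₁ refl , inj₂ refl = shared-adj (SameCo-sym sc) (λ p → x≢y (sym p)) (trans (sym (rk≡ sc)) r) dy dx (sym eq)
            (λ h q′ → only h (subst (λ w → Desc w h) (sym eq) q′)) (subst (λ w → Desc w i) eq q)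
        where
        only : ∀ h → Desc d h → h ≡ suc t
        only h q′ with adjs q′
        ... | _ , inj₂ p = p
        ... | inj₁ () , inj₁ refl
        ... | inj₂ () , inj₁ refl

  -- The rank bound is sharp: in rank two, conjugating one atom by `l` or by the mirror index of `l`
  -- can give two elements with the same two atoms.
  coatoms-determine : ∀ {x y n} → SameCo x y → rk x ≡ suc (suc (suc n)) → x ≡ y
  coatoms-determine {x} {y} sc r with x ≟X y
  ... | yes p = p
  ... | no p with rk-pos r | rk-pos (trans (sym (rk≡ sc)) r)
  ...   | s , dx | t , dy with act s x ≟X act t y
  ...     | yes q = ⊥-elim (shared sc p r dx dy q)
  ...     | no q  = ⊥-elim (clash sc p r dx dy q)

  -- Elements of rank at least three have at least two coatoms.

  private
    -- Here `z`, `d`, `x` form a chain-like orbit. A descent `h` of `z` next to the orbit generators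
    -- is passed up: `act k (act i (act h z))` is a coatom of `x` with descent `k`, which `act k x`
    -- does not have. A descent far from both generators is already a descent of `x`.
    tail-case : ∀ {x k n} → rk x ≡ suc (suc (suc n)) → (∀ {c} → c ⋖ x → c ≡ act k x) →
                Desc x k → Desc (act k x) (suc k) → act (suc k) x ≡ x →
                act k (act (suc k) (act k x)) ≡ act (suc k) (act k x) → ⊥
    tail-case {x} {k} {n} r unique dx di xi zk = go (rk-pos rkz)
      where
      i = suc k
      d = act k x
      z = act i d
      k<m : suc k < m
      k<m = proj₁ dx
      i<m : suc i < m
      i<m = proj₁ di
      rkz : rk z ≡ suc n
      rkz = suc-injective (suc-injective (trans (sym (trans (Desc-rk dx) (cong suc (Desc-rk di)))) r))
      x≡ : act k (act i z) ≡ x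
      x≡ = trans (cong (act k) (act-invol i d)) (act-invol k x)
      Fz-k : F z k ≡ i
      Fz-k = fx-inv k<m zk
      Fz-i : F z i ≡ k
      Fz-i = F-swap z Fz-k
      Fx-i : F x i ≡ suc i
      Fx-i = fx-inv i<m xi
      Fx-1+i : F x (suc i) ≡ i
      Fx-1+i = F-swap x Fx-i
      p = F z (suc i)
      Fx-k : F x k ≡ sw k (sw i p)
      Fx-k = trans (cong (λ w → F w k) (sym x≡)) (trans (F-l _ k<m) (cong (sw k) (F-l z i<m)))
      finish : ∀ {h} → Desc z h → Desc (act i (act h z)) i → Desc (act k (act i (act h z))) k → ⊥
      finish {h} dh d₁ d₂ = Desc-irr dx (subst (λ w → Desc w k) (unique c⋖x) d₂)
        where
        c⋖x : act k (act i (act h z)) ⋖ x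
        c⋖x = L₁ dx (⊑-trans (L₁ di (⊑-trans (Desc-⊑ dh) (Desc-⊑ di))) (Desc-⊑ dx))
            , trans (Desc-rk dx) (cong suc (trans (Desc-rk di) (trans (cong suc (trans (Desc-rk dh) (sym (up-rk d₁)))) (sym (up-rk d₂)))))
      ≢1 : ∀ {a} → suc a ≢ a
      ≢1 ()
      ≢2 : ∀ {a} → a ≢ suc (suc a)
      ≢2 ()
      high : Desc z (suc i) → ¬ Desc x (suc i) → ⊥
      high dh nx = finish dh
          (asc i<m (subst₂ _<_ (sym Fu-1+i) (sym Fu-i) v<k) (λ q → ≢2 (trans (sym Fu-i) q)))
          (asc k<m (subst₂ _<_ (sym Fu′-i) (sym Fu′-k) (<-trans v<k (<-trans (n<1+n k) (n<1+n i)))) (λ q → ≢1 (trans (sym Fu′-k) q)))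
        where
        h = suc i
        h<m : suc h < m
        h<m = proj₁ dh
        v = F z (suc h)
        σv<i : sw k (sw i v) < i
        σv<i = subst₂ _<_
          (trans (cong (λ w → F w (suc h)) (sym x≡)) (trans (F-o _ k<m (λ ()) (λ ())) (cong (sw k) (F-o z i<m (λ ()) (λ ())))))
          Fx-1+i (¬Desc-asc h<m nx)
        v≢k : v ≢ k
        v≢k q = ≢2 (sym (suc-injective (trans (sym (F-swap z q)) Fz-k)))
        v≢i : v ≢ i
        v≢i q = c (trans (sym (F-swap z q)) Fz-i)
          where
          c : suc (suc (suc k)) ≢ k
          c ()
        v≢h : v ≢ h
        v≢h q = <-asym (proj₂ dh) (subst₂ _<_ (sym q) (sym (F-swap z q)) (n<1+n h))
        v<k : v < k
        v<k = ≤∧≢⇒< (s≤s⁻¹ (subst (_< i) (trans (cong (sw k) (sw-o i v v≢i v≢h)) (sw-o k v v≢k v≢i)) σv<i)) v≢k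
        u = act h z
        Fu-i : F u i ≡ k
        Fu-i = trans (F-o z h<m (λ ()) (λ ())) (trans (cong (sw h) Fz-i) (sw-low h k (n≤1+n _)))
        Fu-1+i : F u (suc i) ≡ v
        Fu-1+i = trans (F-l z h<m) (sw-low h v (<-trans v<k (n≤1+n _)))
        u′ = act i u
        Fu′-k : F u′ k ≡ suc i
        Fu′-k = trans (F-o u i<m (λ ()) (λ ())) (trans (cong (sw i) (trans (F-o z h<m (λ ()) (λ ()))
          (trans (cong (sw h) Fz-k) (sw-low h i (n<1+n i))))) (sw-l i))
        Fu′-i : F u′ i ≡ v
        Fu′-i = trans (F-l u i<m) (trans (cong (sw i) Fu-1+i) (sw-low i v (<-trans v<k (n<1+n k))))
      low : ∀ {h} → k ≡ suc h → Desc z h → ¬ Desc x h → ⊥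
      low {h} refl dh nx = finish dh
          (asc i<m (subst₂ _<_ (sym Fu-1+i) (sym Fu-i) (<-trans p<v v<h)) (λ q → c (trans (sym Fu-i) q)))
          (asc k<m (subst₂ _<_ (sym Fu′-i) (sym Fu′-k) p<v) (λ q → <⇒≢ (<-trans v<h (<-trans (n<1+n h) (n<1+n k))) (trans (sym Fu′-k) q)))
        where
        c : h ≢ suc (suc (suc h))
        c ()
        h<m : suc h < m
        h<m = proj₁ dh
        v = F z h
        v<h : v < h
        v<h = ≤∧≢⇒< (s≤s⁻¹ (≤∧≢⇒< (s≤s⁻¹ (subst (v <_) Fz-k (proj₂ dh))) λ q → ≢2 (trans (sym (F-swap z q)) Fz-k)))
                (F-fpf z (<-trans (n<1+n h) h<m))
        Fx-h : F x h ≡ v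
        Fx-h = trans (cong (λ w → F w h) (sym x≡)) (trans (F-o _ k<m (λ ()) (λ ())) (trans (cong (sw k) (trans (F-o z i<m (λ ()) (λ ()))
          (sw-low i v (<-trans v<h (n≤1+n _))))) (sw-low k v (<-trans v<h (n<1+n h)))))
        σp<v : sw k (sw i p) < v
        σp<v = subst₂ _<_ Fx-k Fx-h (¬Desc-asc h<m nx)
        p≡ : sw k (sw i p) ≡ p
        p≡ = sym (trans (sym (trans (cong (sw i) (sw-invol k _)) (sw-invol i p)))
          (trans (cong (sw i) (sw-low k _ (<-trans σp<v (<-trans v<h (n<1+n h))))) (sw-low i _ (<-trans σp<v (<-trans v<h (n≤1+n _))))))
        p<v : p < v
        p<v = subst (_< v) p≡ σp<v
        u = act h z
        Fu-k : F u k ≡ v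
        Fu-k = trans (F-r z h<m) (sw-low h v v<h)
        Fu-i : F u i ≡ h
        Fu-i = trans (F-o z h<m (λ ()) (λ ())) (trans (cong (sw h) Fz-i) (sw-r h))
        Fu-1+i : F u (suc i) ≡ p
        Fu-1+i = trans (F-o z h<m (λ ()) (λ ())) (sw-low h p (<-trans p<v v<h))
        u′ = act i u
        Fu′-k : F u′ k ≡ v
        Fu′-k = trans (F-o u i<m (λ ()) (λ ())) (trans (cong (sw i) Fu-k) (sw-low i v (<-trans v<h (n≤1+n _))))
        Fu′-i : F u′ i ≡ p
        Fu′-i = trans (F-l u i<m) (trans (cong (sw i) Fu-1+i) (sw-low i p (<-trans p<v (<-trans v<h (n≤1+n _)))))
      ¬high : ¬ Desc x (suc i)
      ¬high dh = <⇒≱ (subst₂ _<_ Fx≡ Fx-i (proj₂ dx)) (n≤1+n _)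
        where
        Fx≡ : F x k ≡ suc (suc i)
        Fx≡ = sw-inj (suc i) (trans (sym (F-o x (proj₁ dh) (λ ()) (λ ())))
          (trans (cong (λ w → F w k) (unique (Desc-⋖ dh)))
            (trans (F-l x k<m) (trans (cong (sw k) Fx-i) (trans (sw-high k (suc i) ≤-refl) (sym (sw-r (suc i))))))))
      ¬low : ∀ {h} → k ≡ suc h → ¬ Desc x h
      ¬low {h} refl dh = ≢1 (trans (sym (sw-high h i ≤-refl)) (trans (cong (sw h) (sym Fx-1+i))
        (trans (sym (F-o x (proj₁ dh) (λ ()) (λ ()))) (trans (cong (λ w → F w (suc i)) (unique (Desc-⋖ dh)))
          (trans (F-o x k<m (λ ()) (λ ())) (trans (cong (sw k) Fx-1+i) (sw-r k)))))))
      go : ∃ (Desc z) → ⊥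
      go (h , dh) with rel h k
      ... | same refl = Desc-fx dh zk
      ... | adj (inj₁ q) = low q dh (¬low q)
      ... | adj (inj₂ refl) = Desc-irr di dh
      ... | far fk with rel h i
      ...   | same refl = Desc-irr di dh
      ...   | adj (inj₂ refl) = high dh ¬high
      ...   | adj (inj₁ refl) = [ (λ q → <⇒≱ q (n≤1+n _)) , (λ q → <⇒≱ q (n≤1+n _)) ]′ fk
      ...   | far fi = no-return dd dx′ (unique (Desc-⋖ dx′))
        where
        dd : Desc d h
        dd = subst (λ w → Desc w h) (act-invol i d) (Desc-far fi dh (Desc-irr di))
        dx′ : Desc x h
        dx′ = subst (λ w → Desc w h) (act-invol k x) (Desc-far fk dd (Desc-irr dx))

  -- Take a descent `k` of `x` and a descent `i` of `act k x`. Outside the chain-like case a second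
  -- coatom is visible: `act i x` if `i` is a descent of `x`, or else `act k z`. The chain-like case
  -- goes to `tail-case`, mirrored if `i` lies below `k`.
  ¬unique-coatom : ∀ {x d n} → rk x ≡ suc (suc (suc n)) → (∀ {c} → c ⋖ x → c ≡ d) → ⊥
  ¬unique-coatom {x} {d₀} {n} r unique₀ with rk-pos r
  ... | k , dx = go (rk-pos rkd)
    where
    d = act k x
    rkd : rk d ≡ suc (suc n)
    rkd = suc-injective (trans (sym (Desc-rk dx)) r)
    unique : ∀ {c} → c ⋖ x → c ≡ d
    unique p = trans (unique₀ p) (sym (unique₀ (Desc-⋖ dx)))
    ¬both : ∀ {i} → Desc d i → ¬ Desc x i
    ¬both di dxi = no-return di dxi (unique (Desc-⋖ dxi))
    go : ∃ (Desc d) → ⊥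
    go (i , di) with rel i k
    ... | same refl = Desc-irr dx di
    ... | far f = ¬both di (subst (λ w → Desc w i) (act-invol k x) (Desc-far f di (Desc-irr dx)))
    ... | adj a = main (stat k z)
      where
      z = act i d
      main : Stat k z → ⊥
      main (dn q) = ¬both di (braid-Desc (Adj-sym a) dx di q)
      main (up q) = <⇒≢ (<-trans (≤-reflexive (sym (Desc-rk di))) (≤-reflexive (sym (Desc-rk dx))))
          (cong rk (act-inj k (unique c⋖x)))
        where
        c⋖x : act k z ⋖ x
        c⋖x = L₁ dx (⊑-trans (Desc-⊑ di) (Desc-⊑ dx)) , trans (Desc-rk dx) (cong suc (trans (Desc-rk di) (sym (up-rk q))))
      main (fx zk) = by-adj a
        where
        x≡ : act k (act i z) ≡ x
        x≡ = trans (cong (act k) (act-invol i d)) (act-invol k x)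
        xi : act i x ≡ x
        xi = trans (cong (act i) (sym x≡)) (trans (sym (act-braid z (Adj-sym a) (proj₁ dx) (proj₁ di)))
               (trans (cong (λ w → act k (act i w)) zk) x≡))
        by-adj : Adj i k → ⊥
        by-adj (inj₂ refl) = tail-case r unique dx di xi zk
        by-adj (inj₁ refl) with mirror (proj₁ dx)
        ... | k′ , p = tail-case (trans (mir-rk x) r) unique′ (mir-Desc p dx)
              (subst (λ w → Desc w (suc k′)) (mir-act x p) (mir-Desc p′ di))
              (trans (sym (mir-act x p′)) (cong mir xi))
              (subst₂ _≡_ (trans (mir-act z p) (cong (act k′) z′)) z′ (cong mir zk))
          where
          p′ : Mir i (suc k′)
          p′ = Mir-suc p
          z′ : mir z ≡ act (suc k′) (act k′ (mir x))
          z′ = trans (mir-act d p′) (cong (act (suc k′)) (mir-act x p))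
          unique′ : ∀ {c} → c ⋖ mir x → c ≡ act k′ (mir x)
          unique′ {c} q = trans (sym (mir-invol c)) (trans (cong mir (unique (subst (mir c ⋖_) (mir-invol x) (mir-⋖ q)))) (mir-act x p))

  -- Matchings on lower sets.

  data Local (M : X → X) (x : X) : Set where
    down : M x ⋖ x → Local M x
    fix  : M x ≡ x → Local M x
    rise : x ⋖ M x → Local M x

  -- `M` is a total map of which only the values on the lower set `I` matter, so that conjugations,
  -- which match the whole poset, and matchings of a single interval fall under one notion.
  -- Strictness in `compat` would follow from `inj`.
  record Matching (I : X → Set) (M : X → X) : Set where
    field
      lower  : ∀ {x y} → I y → x ⊑ y → I x
      closed : ∀ {x} → I x → I (M x)
      invol  : ∀ {x} → I x → M (M x) ≡ x
      local  : ∀ {x} → I x → Local M x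
      compat : ∀ {x y} → I x → I y → x ⋖ y → M x ≢ y → M x ⊑ M y

    inj : ∀ {x y} → I x → I y → M x ≡ M y → x ≡ y
    inj p q r = trans (sym (invol p)) (trans (cong M r) (invol q))

    flip : ∀ {x y} → I x → M x ≡ y → M y ≡ x
    flip p r = trans (cong M (sym r)) (invol p)

    -- Follow covers from `x` up to `y`. `compat` applies to each of them except one provided by `M`
    -- itself, and there `M x` is already on the way to `y`.
    push : ∀ {x y} → I y → x ⊑ y → M x ⊑ M y ⊎ M x ⊑ y
    push {x} {y} Iy le = go (rk y ∸ rk x) x le ≤-refl
      where
      go : ∀ n x → x ⊑ y → rk y ∸ rk x ≤ n → M x ⊑ M y ⊎ M x ⊑ y
      go n x le b with x ≟X y
      go n x le b | yes refl = inj₁ ⊑-refl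
      go n x le b | no ne with cover-below le ne
      go zero x le b | no ne | _ = ⊥-elim (<⇒≱ (≢⇒rk< le ne) (m∸n≡0⇒m≤n (n≤0⇒n≡0 b)))
      go (suc n) x le b | no ne | z , c , l with M x ≟X z
      ... | yes refl = inj₂ l
      ... | no q with go n z l (s≤s⁻¹ (≤-trans (subst (λ a → suc (rk y ∸ a) ≤ rk y ∸ rk x) (sym (proj₂ c))
                       (∸-monoʳ-< (n<1+n _) (subst (_≤ rk y) (proj₂ c) (rk-mono l)))) b))
      ...   | inj₁ r = inj₁ (⊑-trans (compat (lower Iy le) (lower Iy l) c q) r)
      ...   | inj₂ r = inj₂ (⊑-trans (compat (lower Iy le) (lower Iy l) c q) r)

    pull : ∀ {x y} → I y → x ⊑ y → M x ⊑ M y ⊎ x ⊑ M y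
    pull {x} {y} = go (rk y) y ≤-refl
      where
      go : ∀ n y → rk y ≤ n → I y → x ⊑ y → M x ⊑ M y ⊎ x ⊑ M y
      go n y b Iy le with x ≟X y
      go n y b Iy le | yes refl = inj₁ ⊑-refl
      go n y b Iy le | no ne with cover-above le ne
      go zero y b Iy le | no ne | z , l , c = ⊥-elim (1+n≰n (≤-trans (s≤s z≤n) (≤-trans (≤-reflexive (sym (proj₂ c))) b)))
      go (suc n) y b Iy le | no ne | z , l , c with M z ≟X y
      ... | yes q = inj₂ (subst (x ⊑_) (sym (flip (lower Iy (proj₁ c)) q)) l)
      ... | no q with go n z (s≤s⁻¹ (≤-trans (≤-reflexive (sym (proj₂ c))) b)) (lower Iy (proj₁ c)) l
      ...   | inj₁ r = inj₁ (⊑-trans r (compat (lower Iy (proj₁ c)) Iy c q))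
      ...   | inj₂ r = inj₂ (⊑-trans r (compat (lower Iy (proj₁ c)) Iy c q))

    preserves : ∀ {x w} → I w → M w ⊑ w → x ⊑ w → M x ⊑ w
    preserves Iw q le with push Iw le
    ... | inj₁ r = ⊑-trans r q
    ... | inj₂ r = r

    restrict : ∀ {w} → I w → M w ⊑ w → Matching (_⊑ w) M
    restrict Iw q = record
      { lower  = λ l l′ → ⊑-trans l′ l
      ; closed = preserves Iw q
      ; invol  = λ l → invol (lower Iw l)
      ; local  = λ l → local (lower Iw l)
      ; compat = λ l l′ → compat (lower Iw l) (lower Iw l′)
      }

    -- `M` sends any coatom of `M u` other than `u` down to a coatom of `u`. Hence the values of `M`
    -- below `u` determine the coatoms of `M u`, which is what the inductions on rank use.
    coatom : ∀ {u c} → I u → u ⋖ M u → c ⋖ M u → c ≡ u ⊎ ∃ λ z → z ⋖ u × z ⋖ M z × M z ≡ c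
    coatom {u} {c} Iu uMu cMu with c ≟X u
    ... | yes p = inj₁ p
    ... | no p = inj₂ (M c , z⋖u , z⋖c , invol Ic)
      where
      Ic : I c
      Ic = lower (closed Iu) (proj₁ cMu)
      rc : rk c ≡ rk u
      rc = suc-injective (trans (sym (proj₂ cMu)) (proj₂ uMu))
      Mc⊑u : M c ⊑ u
      Mc⊑u = subst (M c ⊑_) (invol Iu) (compat Ic (closed Iu) cMu (λ q → p (inj Ic Iu q)))
      Mc⋖c : M c ⋖ c
      Mc⋖c with local Ic
      ... | down q = q
      ... | fix q = ⊥-elim (p (rank-eq (subst (_⊑ u) q Mc⊑u) rc))
      ... | rise q = ⊥-elim (1+n≰n (subst (_≤ rk c) (proj₂ q) (subst (rk (M c) ≤_) (sym rc) (rk-mono Mc⊑u))))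
      z⋖u : M c ⋖ u
      z⋖u = Mc⊑u , trans (sym rc) (proj₂ Mc⋖c)
      z⋖c : M c ⋖ M (M c)
      z⋖c = subst (M c ⋖_) (sym (invol Ic)) Mc⋖c

  open Matching

  act-matching : ∀ k → Matching (λ _ → ⊤) (act k)
  act-matching k = record
    { lower = λ _ _ → tt ; closed = λ _ → tt ; invol = λ {x} _ → act-invol k x
    ; local = λ {x} _ → loc (stat k x) ; compat = λ _ _ → act-compat }
    where
    loc : ∀ {x} → Stat k x → Local (act k) x
    loc (dn d) = down (Desc-⋖ d)
    loc (fx f) = fix f
    loc (up d) = rise (up-⋖ d)

  act-matching-below : ∀ {k w} → act k w ⊑ w → Matching (_⊑ w) (act k)
  act-matching-below {k} = restrict (act-matching k) tt

  -- Rigidity and commutation of matchings.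

  ¬⋖-≡ : ∀ {x y} → x ⋖ y → y ≢ x
  ¬⋖-≡ p refl = 1+n≢n (sym (proj₂ p))

  -- By induction, if both matchings raise `u`, the images have the same coatoms; if only one does,
  -- its image has `u` as its only coatom. Both images have rank at least three.
  agree : ∀ {I J M N} → Matching I M → Matching J N → (∀ {x} → I x → J x) →
          (∀ {x} → I x → rk x ≤ 1 → M x ≡ N x) → ∀ {x} → I x → M x ≡ N x
  agree {I} {J} {M} {N} μ ν I⊆J base {x} = go (suc (rk x)) x (n<1+n _)
    where
    go : ∀ n x → rk x < n → I x → M x ≡ N x
    go (suc n) u b Iu with rk u in ru
    ... | zero = base Iu (subst (_≤ 1) (sym ru) z≤n)
    ... | suc zero = base Iu (subst (_≤ 1) (sym ru) ≤-refl)
    ... | suc (suc r) = main (local μ Iu) (local ν Ju)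
      where
      Ju = I⊆J Iu
      IH : ∀ {v} → v ⋖ u → M v ≡ N v
      IH {v} c = go n v (<-≤-trans (≤-reflexive (trans (sym (proj₂ c)) ru)) (s≤s⁻¹ b)) (lower μ Iu (proj₁ c))
      main : Local M u → Local N u → M u ≡ N u
      main (down p) _ = sym (flip ν (I⊆J (closed μ Iu)) (trans (sym (IH p)) (invol μ Iu)))
      main _ (down p) = flip μ (lower μ Iu (proj₁ p)) (trans (IH p) (invol ν Ju))
      main (fix p) (fix q) = trans p (sym q)
      main (rise p) (fix q) = ⊥-elim (¬unique-coatom (trans (proj₂ p) (cong suc ru)) unique)
        where
        unique : ∀ {c} → c ⋖ M u → c ≡ u
        unique c⋖ with coatom μ Iu p c⋖
        ... | inj₁ eq = eq
        ... | inj₂ (z , z⋖u , z⋖Mz , eq) = trans (sym eq) (trans (IH z⋖u)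
              (rank-eq (subst (N z ⊑_) q (compat ν (lower ν Ju (proj₁ z⋖u)) Ju z⋖u
                (λ r → ¬⋖-≡ z⋖u (sym (trans (sym (flip ν (lower ν Ju (proj₁ z⋖u)) r)) q)))))
                (trans (cong rk (sym (IH z⋖u))) (trans (proj₂ z⋖Mz) (sym (proj₂ z⋖u))))))
      main (fix p) (rise q) = ⊥-elim (¬unique-coatom (trans (proj₂ q) (cong suc ru)) unique)
        where
        unique : ∀ {c} → c ⋖ N u → c ≡ u
        unique c⋖ with coatom ν Ju q c⋖
        ... | inj₁ eq = eq
        ... | inj₂ (z , z⋖u , z⋖Nz , eq) = trans (sym eq) (trans (sym (IH z⋖u))
              (rank-eq (subst (M z ⊑_) p (compat μ (lower μ Iu (proj₁ z⋖u)) Iu z⋖u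
                (λ r → ¬⋖-≡ z⋖u (sym (trans (sym (flip μ (lower μ Iu (proj₁ z⋖u)) r)) p)))))
                (trans (cong rk (IH z⋖u)) (trans (proj₂ z⋖Nz) (sym (proj₂ z⋖u))))))
      main (rise p) (rise q) = coatoms-determine (sameCo (trans (proj₂ p) (sym (proj₂ q))) M⇒N N⇒M) (trans (proj₂ p) (cong suc ru))
        where
        M⇒N : ∀ {c} → c ⋖ M u → c ⊑ N u
        M⇒N c⋖ with coatom μ Iu p c⋖
        ... | inj₁ refl = proj₁ q
        ... | inj₂ (z , z⋖u , _ , eq) with push ν Ju (proj₁ z⋖u)
        ...   | inj₁ l = subst (_⊑ N u) (trans (sym (IH z⋖u)) eq) l
        ...   | inj₂ l = subst (_⊑ N u) (trans (sym (IH z⋖u)) eq) (⊑-trans l (proj₁ q))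
        N⇒M : ∀ {c} → c ⋖ N u → c ⊑ M u
        N⇒M c⋖ with coatom ν Ju q c⋖
        ... | inj₁ refl = proj₁ p
        ... | inj₂ (z , z⋖u , _ , eq) with push μ Iu (proj₁ z⋖u)
        ...   | inj₁ l = subst (_⊑ M u) (trans (IH z⋖u) eq) l
        ...   | inj₂ l = subst (_⊑ M u) (trans (IH z⋖u) eq) (⊑-trans l (proj₁ p))

  module _ {I : X → Set} where
    private
      Commutes : (M N : X → X) → X → Set
      Commutes M N u = M (N u) ≡ N (M u)

      -- If `M` raised `N u`, a coatom of `M (N u)` other than `N u` would be `M y` with `y` a
      -- coatom of `N u`. Commutation at `N y`, which lies strictly below `u`, bounds the rank of
      -- `M y` by that of `u`, one too small; so `N u` would be the only coatom.
      fixed-rise : ∀ {M N u r} → Matching I M → Matching I N → I u → rk u ≡ suc r →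
                   (∀ {v} → I v → rk v < rk u → Commutes M N v) → M u ≡ u → u ⋖ N u → M (N u) ≡ N u
      fixed-rise {M} {N} {u} {r} μ ν Iu ru IH f q = main (local μ INu)
        where
        INu = closed ν Iu
        module _ {y} (y⋖ : y ⋖ N u) (y≢u : y ≢ u) where
          Iy : I y
          Iy = lower μ INu (proj₁ y⋖)
          z⊑u : N y ⊑ u
          z⊑u = subst (N y ⊑_) (invol ν Iu) (compat ν Iy INu y⋖ (λ s → y≢u (inj ν Iy Iu s)))
          z≢u : N y ≢ u
          z≢u s = ¬⋖-≡ y⋖ (trans (cong N (sym s)) (invol ν Iy))
          Iz : I (N y)
          Iz = closed ν Iy
          My≡ : M y ≡ N (M (N y))
          My≡ = trans (cong M (sym (invol ν Iy))) (IH Iz (≢⇒rk< z⊑u z≢u))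
        main : Local M (N u) → M (N u) ≡ N u
        main (fix p) = p
        main (down p) = ⊥-elim (z≢u p y≢u (trans (sym (invol μ (Iz p y≢u)))
            (trans (cong M (inj ν (closed μ (Iz p y≢u)) Iu (trans (sym (My≡ p y≢u)) (invol μ INu)))) f)))
          where
          y≢u : M (N u) ≢ u
          y≢u s = ¬⋖-≡ q (trans (sym (flip μ INu s)) f)
        main (rise p) = ⊥-elim (¬unique-coatom (trans (proj₂ p) (cong suc (trans (proj₂ q) (cong suc ru)))) unique)
          where
          unique : ∀ {c} → c ⋖ M (N u) → c ≡ N u
          unique c⋖ with coatom μ INu p c⋖
          ... | inj₁ eq = eq
          ... | inj₂ (y , y⋖ , y⋖My , eq) with y ≟X u
          ...   | yes refl = ⊥-elim (¬⋖-≡ y⋖My f)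
          ...   | no y≢u = ⊥-elim (<⇒≱ small (≤-reflexive (sym (trans (proj₂ y⋖My) (trans (sym (proj₂ y⋖)) (proj₂ q))))))
            where
            Mz⊑u : M (N y) ⊑ u
            Mz⊑u = preserves μ Iu (subst (_⊑ u) (sym f) ⊑-refl) (z⊑u y⋖ y≢u)
            Mz<u : rk (M (N y)) < rk u
            Mz<u = ≢⇒rk< Mz⊑u (λ s → z≢u y⋖ y≢u (trans (sym (flip μ (Iz y⋖ y≢u) s)) f))
            small : rk (M y) < suc (rk u)
            small = s≤s (≤-trans (subst (λ a → rk a ≤ suc (rk (M (N y)))) (sym (My≡ y⋖ y≢u)) (rk-N (closed μ (Iz y⋖ y≢u)))) Mz<u)
              where
              rk-N : ∀ {a} → I a → rk (N a) ≤ suc (rk a)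
              rk-N Ia with local ν Ia
              ... | down s = ≤-trans (n≤1+n _) (≤-trans (≤-reflexive (sym (proj₂ s))) (n≤1+n _))
              ... | fix s = ≤-trans (≤-reflexive (cong rk s)) (n≤1+n _)
              ... | rise s = ≤-reflexive (proj₂ s)

      rise-rise : ∀ {M N u} → Matching I M → Matching I N → I u → u ⋖ M u → u ⋖ N u → M u ≢ N u → M u ⋖ N (M u)
      rise-rise {M} {N} {u} μ ν Iu p q ne = main (local ν (closed μ Iu))
        where
        le : N u ⊑ N (M u)
        le = compat ν Iu (closed μ Iu) p (λ s → ne (sym s))
        main : Local N (M u) → M u ⋖ N (M u)
        main (rise s) = s
        main (fix s) = ⊥-elim (ne (sym (rank-eq (subst (N u ⊑_) s le) (trans (proj₂ q) (sym (proj₂ p))))))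
        main (down s) = ⊥-elim (1+n≰n (≤-trans (≤-reflexive (trans (sym (proj₂ s)) (trans (proj₂ p) (sym (proj₂ q))))) (rk-mono le)))

      -- A coatom of `N (M u)` other than `M u` is `N y` with `y` a coatom of `M u`. For `y ≢ u`,
      -- commutation at `M y`, which lies below `u`, rewrites it as `M (N (M y))`.
      half : ∀ {M N u c} → Matching I M → Matching I N → I u →
             (∀ {v} → I v → rk v < rk u → Commutes M N v) → u ⋖ M u → u ⋖ N u → M u ≢ N u →
             c ⋖ N (M u) → c ⊑ M (N u)
      half {M} {N} {u} {c} μ ν Iu IH p q ne c⋖ with coatom ν (closed μ Iu) (rise-rise μ ν Iu p q ne) c⋖
      ... | inj₁ refl = compat μ Iu (closed ν Iu) q ne
      ... | inj₂ (y , y⋖ , _ , eq) with y ≟X u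
      ...   | yes refl = subst (_⊑ M (N u)) eq (proj₁ (rise-rise ν μ Iu q p (λ s → ne (sym s))))
      ...   | no y≢u = subst (_⊑ M (N u)) (trans (IH Iz (≢⇒rk< z⊑u z≢u)) (trans (cong N (invol μ Iy)) eq)) MNz⊑
        where
        Iy : I y
        Iy = lower ν (closed μ Iu) (proj₁ y⋖)
        z⊑u : M y ⊑ u
        z⊑u = subst (M y ⊑_) (invol μ Iu) (compat μ Iy (closed μ Iu) y⋖ (λ s → y≢u (inj μ Iy Iu s)))
        z≢u : M y ≢ u
        z≢u s = ¬⋖-≡ y⋖ (trans (cong M (sym s)) (invol μ Iy))
        Iz : I (M y)
        Iz = closed μ Iy
        Nz⊑Nu : N (M y) ⊑ N u
        Nz⊑Nu with push ν Iu z⊑u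
        ... | inj₁ s = s
        ... | inj₂ s = ⊑-trans s (proj₁ q)
        MNz⊑ : M (N (M y)) ⊑ M (N u)
        MNz⊑ with push μ (closed ν Iu) Nz⊑Nu
        ... | inj₁ s = s
        ... | inj₂ s = ⊑-trans s (proj₁ (rise-rise ν μ Iu q p (λ t → ne (sym t))))

    -- If both matchings raise `u` to different elements, the two composites have rank `rk u + 2`.
    -- From rank one on their coatoms determine them, so only `ê` needs a hypothesis.
    commute : ∀ {M N} → Matching I M → Matching I N → M (N ê) ≡ N (M ê) → ∀ {u} → I u → M (N u) ≡ N (M u)
    commute {M} {N} μ ν base {u} = go (suc (rk u)) u (n<1+n _)
      where
      go : ∀ n u → rk u < n → I u → M (N u) ≡ N (M u)
      go (suc n) u b Iu with rk u in ru
      ... | zero = subst (λ v → M (N v) ≡ N (M v)) (sym (rk0 ru)) base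
      ... | suc r = main (local μ Iu) (local ν Iu)
        where
        IH : ∀ {v} → I v → rk v < rk u → M (N v) ≡ N (M v)
        IH {v} Iv l = go n v (<-≤-trans l (subst (_≤ n) (sym ru) (s≤s⁻¹ b))) Iv
        main : Local M u → Local N u → M (N u) ≡ N (M u)
        main (down p) _ = trans (cong M (sym (trans (IH (closed μ Iu) (≤-reflexive (sym (proj₂ p)))) (cong N (invol μ Iu)))))
                            (invol μ (closed ν (closed μ Iu)))
        main _ (down p) = sym (trans (cong N (trans (cong M (sym (invol ν Iu))) (IH (closed ν Iu) (≤-reflexive (sym (proj₂ p))))))
                            (invol ν (closed μ (closed ν Iu))))
        main (fix p) (fix q) = trans (cong M q) (trans p (sym (trans (cong N p) q)))
        main (fix p) (rise q) = trans (fixed-rise μ ν Iu ru IH p q) (cong N (sym p))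
        main (rise p) (fix q) = trans (cong M q) (sym (fixed-rise ν μ Iu ru (λ Iv l → sym (IH Iv l)) q p))
        main (rise p) (rise q) with M u ≟X N u
        ... | yes s = trans (flip μ Iu s) (sym (flip ν Iu (sym s)))
        ... | no s = sym (coatoms-determine (sameCo
                (trans (proj₂ p₁) (trans (cong suc (trans (proj₂ p) (sym (proj₂ q)))) (sym (proj₂ p₂))))
                (half μ ν Iu IH p q s) (half ν μ Iu (λ Iv l → sym (IH Iv l)) q p (λ t → s (sym t))))
                (trans (proj₂ p₁) (cong suc (trans (proj₂ p) (cong suc ru)))))
          where
          p₁ = rise-rise μ ν Iu p q s
          p₂ = rise-rise ν μ Iu q p (λ t → s (sym t))

  -- Atoms and mirror pairs of generators.

  atom : ℕ → X
  atom k = act k ê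

  -- The evenness of `m` enters here, in the form that `F ê` has no fixed point.
  ¬Mir-adj : ∀ {k} → ¬ Mir k (suc k)
  ¬Mir-adj {k} (mk p) = F-fpf ê 1+k<m (+-cancelˡ-≡ (suc k) _ _ (suc-injective (trans (F-e 1+k<m) (sym p))))
    where
    1+k<m : suc k < m
    1+k<m = subst (suc (suc k) ≤_) p (s≤s (s≤s (m≤m+n k (suc k))))

  Fe-l : ∀ {k k′} → Mir k k′ → F ê k ≡ suc k′
  Fe-l {k} {k′} p = +-cancelˡ-≡ k _ _ (suc-injective (trans (F-e (<-trans (n<1+n k) (Mir-< p)))
    (trans (sym (Mir.sum≡ p)) (cong suc (sym (+-suc k k′))))))

  Fe-r : ∀ {k k′} → Mir k k′ → F ê (suc k) ≡ k′
  Fe-r {k} p = +-cancelˡ-≡ (suc k) _ _ (suc-injective (trans (F-e (Mir-< p)) (sym (Mir.sum≡ p))))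

  -- `F ê` intertwines `sw k` and `sw k′`, so the atoms of `k` and `k′` are `F ê` followed by
  -- `sw k′` and `sw k` in one order or the other, and these two transpositions are equal or
  -- commute.
  mir-atom : ∀ k → mir (atom k) ≡ atom k
  mir-atom k with suc k <? m
  ... | no p = trans (cong mir (act-out ê p)) (trans mir-e (sym (act-out ê p)))
  ... | yes p with mirror p
  ...   | k′ , q = trans (mir-act ê q) (trans (cong (act k′) mir-e) (sym (F-ext λ j j<m →
            trans (F-act ê p j) (trans (cong (sw k) (conj q j<m)) (trans (swap (rel k k′)) (sym
              (trans (F-act ê (Mir-< (Mir-sym q)) j) (cong (sw k′) (conj (Mir-sym q) j<m)))))))))
    where
    conj : ∀ {k k′ j} → Mir k k′ → j < m → F ê (sw k j) ≡ sw k′ (F ê j)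
    conj {k} {k′} {j} q j<m = +-cancelˡ-≡ (sw k j) _ _ (suc-injective (trans
      (F-e (sw-bound k j (Mir-< q) j<m))
      (trans (sym (sw-mir {i = F ê j} {j = j} q (trans (cong suc (+-comm (F ê j) j)) (F-e j<m))))
        (cong suc (+-comm (sw k′ (F ê j)) (sw k j))))))
    swap : ∀ {a} → Rel k k′ → sw k (sw k′ a) ≡ sw k′ (sw k a)
    swap (same refl) = refl
    swap (adj (inj₁ refl)) = ⊥-elim (¬Mir-adj q)
    swap (adj (inj₂ refl)) = ⊥-elim (¬Mir-adj (Mir-sym q))
    swap (far (inj₁ r)) = sw-comm k k′ _ r
    swap (far (inj₂ r)) = sym (sw-comm k′ k _ r)

  atom-mirror : ∀ {k k′} → Mir k k′ → atom k ≡ atom k′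
  atom-mirror {k} {k′} p = trans (sym (mir-atom k)) (trans (mir-act ê p) (cong (act k′) mir-e))

  center : ∀ {k} → suc k < m → atom k ≡ ê → Mir k k
  center {k} p f with mirror p
  ... | k′ , q = subst (Mir k) (suc-injective (trans (sym (Fe-l q)) (fx-inv p f))) q

  -- Normal form for atoms: one index of each mirror pair. The central generator, which is its own
  -- mirror image and fixes `ê`, is left out.
  record Small (k k′ : ℕ) : Set where
    constructor small
    field
      mirr : Mir k k′
      k<k′ : k < k′

  open Small

  small-≢ : ∀ {k k′} → Small k k′ → atom k ≢ ê
  small-≢ {k} (small p q) f = <⇒≢ q (Mir-func (center (Mir-< p) f) p)

  atom-Desc : ∀ {k} → suc k < m → atom k ≢ ê → Desc (atom k) k
  atom-Desc {k} p ne with stat k ê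
  ... | dn d = ⊥-elim (Desc-e k d)
  ... | fx f = ⊥-elim (ne f)
  ... | up d = d

  small-Desc : ∀ {k k′} → Small k k′ → Desc (atom k) k
  small-Desc s = atom-Desc (Mir-< (mirr s)) (small-≢ s)

  small-Desc′ : ∀ {k k′} → Small k k′ → Desc (atom k) k′
  small-Desc′ {k} {k′} s = subst (λ x → Desc x k′) (sym (atom-mirror (mirr s)))
    (atom-Desc (Mir-< (Mir-sym (mirr s))) (λ f → small-≢ s (trans (atom-mirror (mirr s)) f)))

  atom-rk : ∀ {k} → Desc (atom k) k → rk (atom k) ≡ 1
  atom-rk d = trans (up-rk d) (cong suc rk-e)

  small-rk : ∀ {k k′} → Small k k′ → rk (atom k) ≡ 1
  small-rk s = atom-rk (small-Desc s)

  small-func : ∀ {j j′ k k′} → Small j j′ → Small k k′ → j ≢ k → suc j < k′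
  small-func {j} {j′} {k} {k′} (small p q) (small r s) ne with suc j <? k′
  ... | yes t = t
  ... | no t = ⊥-elim (ne (sym (≤-antisym k≤j (+-cancelʳ-≤ k′ j k
         (≤-trans (+-monoʳ-≤ j (≤-trans k′≤ q)) (≤-reflexive (suc-injective (suc-injective (trans (Mir.sum≡ p) (sym (Mir.sum≡ r)))))))))))
    where
    k′≤ : k′ ≤ suc j
    k′≤ = ≮⇒≥ t
    k≤j : k ≤ j
    k≤j = s≤s⁻¹ (≤-trans s k′≤)

  small-far : ∀ {k k′} → Small k k′ → suc k < k′
  small-far (small p q) = ≤∧≢⇒< q λ { refl → ¬Mir-adj p }

  -- Compare the values at position `i`. There `atom i` has `i′`, one less than `ê`; if `j` does not
  -- move the position `i`, this forces `sw j` to take `suc i′` to `i′`. If `i ≡ suc j`, the value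
  -- would have to drop by two, more than one transposition can do.
  atom-inj : ∀ {i j} → suc i < m → suc j < m → atom i ≢ ê → atom i ≡ atom j → i ≡ j ⊎ Mir i j
  atom-inj {i} {j} p q ne eq with mirror p
  ... | i′ , r with i ≟ j | i ≟ suc j
  ...   | yes s | _ = inj₁ s
  ...   | no a | no b = inj₂ (subst (Mir i) (sw-pred (trans (cong (sw j) (sym (Fe-l r))) (trans (sym (F-o ê q a b)) at-i))) r)
    where
    at-i : F (atom j) i ≡ i′
    at-i = trans (cong (λ x → F x i) (sym eq)) (trans (F-l ê p) (trans (cong (sw i) (Fe-r r))
      (sw-o i i′ (λ { refl → ne (fixed (Fe-l r)) }) (λ { refl → ¬Mir-adj r }))))
    sw-pred : ∀ {a} → sw j (suc a) ≡ a → a ≡ j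
    sw-pred {a} s with suc a ≟ j | suc a ≟ suc j
    ... | _ | yes t = suc-injective t
    ... | yes refl | no _ = ⊥-elim (m≢1+m+n a {1} (trans (sym s) (trans (sw-l (suc a)) (cong suc (+-comm 1 a)))))
    ... | no t | no u = ⊥-elim (1+n≢n (trans (sym (sw-o j _ t u)) s))
  ...   | no _ | yes refl = ⊥-elim (1+n≰n (≤-trans (≤-reflexive (trans (sym (sw-invol j _)) (cong (sw j) at-i))) (sw-≤ j i′)))
    where
    at-i : sw j (suc (suc i′)) ≡ i′
    at-i = trans (cong (sw j) (sym (Fe-l (Mir-suc r)))) (trans (sym (F-r ê q)) (trans (cong (λ x → F x i) (sym eq))
      (trans (F-l ê p) (trans (cong (sw i) (Fe-r r))
      (sw-o i i′ (λ { refl → ne (fixed (Fe-l r)) }) (λ { refl → ¬Mir-adj r }))))))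

  rk1 : ∀ {x} → rk x ≡ 1 → ∃ λ k → Desc x k × x ≡ atom k
  rk1 {x} r with rk-pos r
  ... | k , d = k , d , trans (sym (act-invol k x)) (cong (act k) (rk0 (suc-injective (trans (sym (Desc-rk d)) r))))

  small-atom : ∀ {x} → rk x ≡ 1 → ∃ λ k → ∃ λ k′ → Small k k′ × x ≡ atom k
  small-atom {x} r with rk1 r
  ... | k , d , eq with mirror (proj₁ d)
  ...   | k′ , p with <-cmp k k′
  ...     | tri< q _ _ = k , k′ , small p q , eq
  ...     | tri> _ _ q = k′ , k , small (Mir-sym p) q , trans eq (atom-mirror p)
  ...     | tri≈ _ refl _ = ⊥-elim (1+n≢n (trans (sym (Desc-rk d)) (cong rk (trans (fixed-x eq) refl))))
    where
    fixed-x : x ≡ atom k → x ≡ act k x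
    fixed-x refl = trans (fixed (Fe-l p)) (sym (act-invol k ê))

  e⋖ : ∀ {x} → rk x ≡ 1 → ê ⋖ x
  e⋖ r = e-min _ , trans r (cong suc (sym rk-e))

  ⋖atom : ∀ {x z} → rk x ≡ 1 → z ⋖ x → z ≡ ê
  ⋖atom r p = rk0 (suc-injective (trans (sym (proj₂ p)) r))

  atom-¬Desc : ∀ {x k} → rk x ≡ 1 → x ≢ atom k → ¬ Desc x k
  atom-¬Desc {x} {k} r ne d = ne (trans (sym (act-invol k x))
    (cong (act k) (rk0 (suc-injective (trans (sym (Desc-rk d)) r)))))

  atom⊑ : ∀ {x k} → Desc x k → atom k ⊑ x
  atom⊑ {x} d = L₁ d (e-min x)

  rk-⋖ : ∀ {x y n} → x ⊑ y → rk x ≡ n → rk y ≡ suc n → x ⋖ y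
  rk-⋖ p q r = p , trans r (cong suc (sym q))

  -- Matchings compared on atoms.

  module Below {w M} (μ : Matching (_⊑ w) M) where

    e⊑w : ê ⊑ w
    e⊑w = e-min w

    -- The index i of a descent of M b is determined by the atom act i e, which must be one of the
    -- two coatoms of M b.
    atom-value : ∀ {l l′ j j′} → Small l l′ → Small j j′ → M ê ≡ atom l → j ≢ l → atom j ⊑ w →
                 M (atom j) ≡ act l (atom j) ⊎ M (atom j) ≡ act l′ (atom j)
    atom-value {l} {l′} {j} {j′} sl sj Me j≢l b⊑w = main (local μ b⊑w)
      where
      a = atom l
      b = atom j
      ra : rk a ≡ 1
      ra = small-rk sl
      rb : rk b ≡ 1
      rb = small-rk sj
      a≢b : a ≢ b
      a≢b p with atom-inj (Mir-< (mirr sl)) (Mir-< (mirr sj)) (small-≢ sl) p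
      ... | inj₁ q = j≢l (sym q)
      ... | inj₂ q = <-asym (k<k′ sl) (subst₂ _<_ (Mir-func q (mirr sl)) (sym (Mir-func (Mir-sym q) (mirr sj))) (k<k′ sj))
      a⊑Mb : a ⊑ M b
      a⊑Mb = subst (_⊑ M b) Me (compat μ e⊑w b⊑w (e⋖ rb) (λ p → a≢b (trans (sym Me) p)))
      main : Local M b → M b ≡ act l b ⊎ M b ≡ act l′ b
      main (down p) = ⊥-elim (a≢b (trans (sym Me) (flip μ b⊑w (⋖atom rb p))))
      main (fix p) = ⊥-elim (a≢b (rank-eq (subst (a ⊑_) p a⊑Mb) (trans ra (sym rb))))
      main (rise p) = pick (rk-pos rMb)
        where
        rMb : rk (M b) ≡ 2
        rMb = trans (proj₂ p) (cong suc rb)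
        coat : ∀ {c} → c ⋖ M b → c ≡ b ⊎ c ≡ a
        coat q with coatom μ b⊑w p q
        ... | inj₁ r = inj₁ r
        ... | inj₂ (z , z⋖b , _ , r) = inj₂ (trans (sym r) (trans (cong M (⋖atom rb z⋖b)) Me))
        back : ∀ {i c} → act i (M b) ≡ c → M b ≡ act i c
        back {i} q = trans (sym (act-invol i _)) (cong (act i) q)
        not-e : ∀ {i} → M b ≡ act i (atom i) → ⊥
        not-e {i} q = rk>0 rMb (trans q (act-invol i ê))
        atom-i : ∀ {i} → Desc (M b) i → atom i ≢ ê → atom i ≡ b ⊎ atom i ≡ a
        atom-i d ne = coat (rk-⋖ (atom⊑ d) (atom-rk (atom-Desc (proj₁ d) ne)) rMb)
        ¬center : ∀ {i c c′} → Desc (M b) i → atom i ≡ ê → rk c ≡ 1 → c ≢ c′ → rk c′ ≡ 1 → c ⊑ M b → act i (M b) ≡ c′ → ⊥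
        ¬center {i} d f rc ne rc′ le q = ne (rank-eq (subst (_ ⊑_) q
          (L₂ d (atom-¬Desc rc (λ r → rk>0 rc (trans r f))) le)) (trans rc (sym rc′)))
        index : ∀ {i k k′} → Small k k′ → Desc (M b) i → atom i ≢ ê → atom i ≡ atom k → i ≡ k ⊎ i ≡ k′
        index sk d ne q with atom-inj (proj₁ d) (Mir-< (mirr sk)) ne q
        ... | inj₁ r = inj₁ r
        ... | inj₂ r = inj₂ (Mir-func (Mir-sym r) (mirr sk))
        via-a : ∀ {i} → M b ≡ act i a → i ≡ j ⊎ i ≡ j′ → M b ≡ act l b ⊎ M b ≡ act l′ b
        via-a q (inj₁ refl) = inj₂ (trans q (trans (cong (act j) (atom-mirror (mirr sl))) (act-comm ê (inj₁ (small-func sj sl j≢l)))))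
        via-a q (inj₂ refl) = inj₁ (trans q (trans (act-comm ê (inj₂ (small-func sl sj (λ r → j≢l (sym r)))))
          (cong (act l) (sym (atom-mirror (mirr sj))))))
        pick : ∃ (Desc (M b)) → M b ≡ act l b ⊎ M b ≡ act l′ b
        pick (i , d) with coat (Desc-⋖ d) | atom i ≟X ê
        ... | inj₁ q | yes f = ⊥-elim (¬center d f ra a≢b rb a⊑Mb q)
        ... | inj₂ q | yes f = ⊥-elim (¬center d f rb (λ r → a≢b (sym r)) ra (proj₁ p) q)
        ... | inj₁ q | no f with atom-i d f
        ...   | inj₁ r = ⊥-elim (not-e (trans (back q) (cong (act i) (sym r))))
        ...   | inj₂ r with index sl d f r
        ...     | inj₁ refl = inj₁ (back q)
        ...     | inj₂ refl = inj₂ (back q)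
        pick (i , d) | inj₂ q | no f with atom-i d f
        ...   | inj₁ r = via-a (back q) (index sj d f r)
        ...   | inj₂ r = ⊥-elim (not-e (trans (back q) (cong (act i) (sym r))))

    -- `l` and `l′` have the same atom, and a small index `j` far from `l` is far from `l′` too.
    far-value : ∀ {l l′ j j′} → Small l l′ → Small j j′ → Far j l → act l (atom j) ≡ act l′ (atom j)
    far-value {l} {l′} {j} sl sj f = trans (sym (act-comm ê f)) (trans (cong (act j) (atom-mirror (mirr sl)))
      (act-comm ê (inj₁ (small-func sj sl (λ p → Far-irr (subst (Far j) (sym p) f))))))
      where
      Far-irr : ∀ {a} → ¬ Far a a
      Far-irr (inj₁ q) = <⇒≱ q (n≤1+n _)
      Far-irr (inj₂ q) = <⇒≱ q (n≤1+n _)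

    -- If `M` raises `x`, then `x` is the only coatom of `M x`, because `M` fixes `ê`. A descent `i`
    -- of `M x` must then have `atom i ≡ ê`: otherwise `atom i` would be `x`, and `M x ≡ act i x`
    -- would be `ê`.
    fixed-value : ∀ {x} → rk x ≡ 1 → x ⊑ w → M ê ≡ ê →
                  M x ≡ x ⊎ ∃ λ i → Mir i i × M x ≡ act i x × M x ≢ x
    fixed-value {x} rx x⊑w Me with local μ x⊑w
    ... | fix p = inj₁ p
    ... | down p = ⊥-elim (rk>0 rx (trans (sym (flip μ x⊑w (⋖atom rx p))) Me))
    ... | rise p with rk-pos (trans (proj₂ p) (cong suc rx))
    ...   | i , d = inj₂ (i , center (proj₁ d) at-e , Mx , ¬⋖-≡ p)
      where
      unique : ∀ {c} → c ⋖ M x → c ≡ x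
      unique q with coatom μ x⊑w p q
      ... | inj₁ r = r
      ... | inj₂ (z , z⋖ , z⋖Mz , r) with ⋖atom rx z⋖
      ...   | refl = ⊥-elim (¬⋖-≡ z⋖Mz Me)
      Mx : M x ≡ act i x
      Mx = trans (sym (act-invol i _)) (cong (act i) (unique (Desc-⋖ d)))
      at-e : atom i ≡ ê
      at-e with atom i ≟X ê
      ... | yes q = q
      ... | no q = ⊥-elim (rk>0 (trans (proj₂ p) (cong suc rx)) (trans Mx (trans (cong (act i)
              (sym (unique (rk-⋖ (atom⊑ d) (atom-rk (atom-Desc (proj₁ d) q)) (trans (proj₂ p) (cong suc rx)))))) (act-invol i ê))))

    Is-act : Set
    Is-act = ∃ λ g → ∀ {u} → u ⊑ w → M u ≡ act g u

    by-atoms : ∀ g → M ê ≡ atom g → (∀ {k k′} → Small k k′ → atom k ⊑ w → M (atom k) ≡ act g (atom k)) → Is-act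
    by-atoms g Me h = g , agree μ (act-matching g) (λ _ → tt) base
      where
      base : ∀ {x} → x ⊑ w → rk x ≤ 1 → M x ≡ act g x
      base {x} le b with rk x in r
      ... | zero = subst (λ y → M y ≡ act g y) (sym (rk0 r)) Me
      ... | suc zero with small-atom r
      ...   | k , k′ , s , refl = h s le
      base {x} le (s≤s ()) | suc (suc _)

    center-act : ∀ {i j j′} → Mir i i → Small j j′ → act i (atom j) ≢ atom j → suc j ≡ i
    center-act {i} {j} {j′} c (small p q) ne with rel i j
    ... | same refl = ⊥-elim (<⇒≢ q (Mir-func c p))
    ... | far f = ⊥-elim (ne (trans (act-comm ê f) (cong (act j) (fixed (Fe-l c)))))
    ... | adj (inj₂ r) = sym r
    ... | adj (inj₁ refl) = ⊥-elim (<-asym (≤-reflexive (sym (Mir-func c (Mir-suc p)))) (<-trans (n<1+n i) q))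

    act-fixing-e : M ê ≡ ê → Is-act
    act-fixing-e Me with anyUpTo? (λ j → (atom j ⊑? w) ×-dec (rk (atom j) ≟ 1) ×-dec ¬? (M (atom j) ≟X atom j)) m
    -- No atom moves, so `M` is the identity, realised as `act m` with `m` out of range.
    ... | no h = by-atoms m (trans Me (sym out)) (λ {k} s le → trans (stay s le) (sym (act-out _ out-range)))
      where
      out-range : ¬ (suc m < m)
      out-range p = <⇒≱ p (n≤1+n m)
      out : atom m ≡ ê
      out = act-out ê out-range
      stay : ∀ {k k′} → Small k k′ → atom k ⊑ w → M (atom k) ≡ atom k
      stay {k} s le with M (atom k) ≟X atom k
      ... | yes p = p
      ... | no p = ⊥-elim (h (k , <-trans (n<1+n k) (Mir-< (mirr s)) , le , small-rk s , p))
    ... | yes (j₀ , _ , le₀ , r₀ , ne₀) with fixed-value r₀ le₀ Me | small-atom r₀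
    ...   | inj₁ p | _ = ⊥-elim (ne₀ p)
    ...   | inj₂ (i , c , eq , _) | j , j′ , s , q = by-atoms i (trans Me (sym (fixed (Fe-l c)))) moved
      where
      j+1 : suc j ≡ i
      j+1 = center-act c s (λ p → ne₀ (trans eq (subst (λ x → act i x ≡ x) (sym q) p)))
      moved : ∀ {k k′} → Small k k′ → atom k ⊑ w → M (atom k) ≡ act i (atom k)
      moved {k} t le with fixed-value (small-rk t) le Me
      ... | inj₂ (i₂ , c₂ , eq₂ , ne₂) = trans eq₂ (cong (λ h → act h (atom k)) (Mir-center c₂ c))
        where
        Mir-center : ∀ {a b} → Mir a a → Mir b b → a ≡ b
        Mir-center {a} {b} p r with <-cmp a b
        ... | tri≈ _ x _ = x
        ... | tri< x _ _ = ⊥-elim (<⇒≢ (+-mono-< x x) (suc-injective (suc-injective (trans (Mir.sum≡ p) (sym (Mir.sum≡ r))))))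
        ... | tri> _ _ x = ⊥-elim (<⇒≢ (+-mono-< x x) (suc-injective (suc-injective (trans (Mir.sum≡ r) (sym (Mir.sum≡ p))))))
      ... | inj₁ p with act i (atom k) ≟X atom k
      ...   | yes f = trans p (sym f)
      ...   | no f = subst (λ h → M (atom h) ≡ act i (atom h)) (suc-injective (trans j+1 (sym (center-act c t f))))
                (subst (λ x → M x ≡ act i x) q eq)

  -- M acts as conjugation by l = i + 1 on one neighbouring atom of atom l and as conjugation by the
  -- mirror image l′ = p + 1 on the other one.
  record Exotic (w : X) (M : X → X) : Set where
    field
      {i p}    : ℕ
      top      : Small (suc (suc i)) p
      M-e      : M ê ≡ atom (suc i)
      ⊑-left   : atom i ⊑ w
      ⊑-right  : atom (suc (suc i)) ⊑ w
      M-left   : M (atom i) ≡ act (suc i) (atom i)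
      M-right  : M (atom (suc (suc i))) ≡ act (suc p) (atom (suc (suc i)))
      ≢-left   : act (suc i) (atom i) ≢ act (suc p) (atom i)
      ≢-right  : act (suc i) (atom (suc (suc i))) ≢ act (suc p) (atom (suc (suc i)))

  mirrored : (X → X) → X → X
  mirrored M x = mir (M (mir x))

  mirrored-matching : ∀ {w M} → Matching (_⊑ w) M → Matching (_⊑ mir w) (mirrored M)
  mirrored-matching {w} {M} μ = record
    { lower  = λ l l′ → ⊑-trans l′ l
    ; closed = λ l → mir-⊑ (closed μ (un l))
    ; invol  = λ {x} l → trans (cong mir (trans (cong M (mir-invol _)) (invol μ (un l)))) (mir-invol x)
    ; local  = λ {x} l → loc (local μ (un l))
    ; compat = λ {x} {y} l l′ c ne → mir-⊑ (compat μ (un l) (un l′) (mir-⋖ c)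
        λ q → ne (trans (cong mir q) (mir-invol y)))
    }
    where
    un : ∀ {x} → x ⊑ mir w → mir x ⊑ w
    un {x} l = subst (mir x ⊑_) (mir-invol w) (mir-⊑ l)
    loc : ∀ {x} → Local M (mir x) → Local (mirrored M) x
    loc {x} (down q) = down (subst (mir (M (mir x)) ⋖_) (mir-invol x) (mir-⋖ q))
    loc {x} (fix q) = fix (trans (cong mir q) (mir-invol x))
    loc {x} (rise q) = rise (subst (_⋖ mir (M (mir x))) (mir-invol x) (mir-⋖ q))

  module Classify {w M} (μ : Matching (_⊑ w) M) where
    open Below μ

    Outcome : Set
    Outcome = Is-act ⊎ Exotic w M ⊎ Exotic (mir w) (mirrored M)

    private
      Good : ℕ → ℕ → Set
      Good g j = atom j ⊑ w → M (atom j) ≡ act g (atom j)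

      good? : ∀ g j → Dec (Good g j)
      good? g j with atom j ⊑? w
      ... | no q = yes λ l → ⊥-elim (q l)
      ... | yes l with M (atom j) ≟X act g (atom j)
      ...   | yes q = yes λ _ → q
      ...   | no q = no λ h → q (h l)

      bad-⊑ : ∀ {g j} → ¬ Good g j → atom j ⊑ w
      bad-⊑ {g} {j} h with atom j ⊑? w
      ... | yes l = l
      ... | no q = ⊥-elim (h λ l → ⊥-elim (q l))

      module _ {l l′} (sl : Small l l′) (Me : M ê ≡ atom l) where

        -- On atoms far from `l` the candidates `act l` and `act l′` agree, and both send `atom l`
        -- to `ê`; only the neighbours can tell them apart.
        by-neighbours : ∀ g → g ≡ l ⊎ g ≡ l′ → (∀ {j j′} → Small j j′ → Adj j l → Good g j) → Is-act
        by-neighbours g gl h = by-atoms g (trans Me (at gl)) val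
          where
          at : g ≡ l ⊎ g ≡ l′ → atom l ≡ atom g
          at (inj₁ refl) = refl
          at (inj₂ refl) = atom-mirror (mirr sl)
          pick : ∀ {k k′} → Small k k′ → Far k l → g ≡ l ⊎ g ≡ l′ →
                 M (atom k) ≡ act l (atom k) ⊎ M (atom k) ≡ act l′ (atom k) → M (atom k) ≡ act g (atom k)
          pick s f (inj₁ refl) (inj₁ q) = q
          pick s f (inj₂ refl) (inj₂ q) = q
          pick s f (inj₂ refl) (inj₁ q) = trans q (far-value sl s f)
          pick s f (inj₁ refl) (inj₂ q) = trans q (sym (far-value sl s f))
          val : ∀ {k k′} → Small k k′ → atom k ⊑ w → M (atom k) ≡ act g (atom k)
          val {k} s le with rel k l
          ... | adj a = h s a le
          ... | same refl = trans (flip μ e⊑w Me) (sym (trans (cong (act g) (at gl)) (act-invol g ê)))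
          ... | far f = pick s f gl (atom-value sl s Me (λ { refl → [ (λ q → <⇒≱ q (n≤1+n _)) , (λ q → <⇒≱ q (n≤1+n _)) ]′ f }) le)

        switch : ∀ {j j′} → Small j j′ → Adj j l → ¬ Good l j → Good l′ j
        switch s a h le with atom-value sl s Me (λ { refl → [ n≢1+n , n≢1+n ]′ a }) le
        ... | inj₁ q = ⊥-elim (h λ _ → q)
        ... | inj₂ q = q

      below-small : ∀ {l l′} → Small (suc l) l′ → Small l (suc l′)
      below-small (small q r) = small (Mir-suc q) (<-trans (n<1+n _) (m<n⇒m<1+n r))

      -- By `switch` each neighbour follows `l` or `l′`. Equal choices give a conjugation. The two
      -- mixed choices are exchanged by `mir`, so that a single kind of `Exotic` matching remains to
      -- be studied.
      two-sided : ∀ {i p} → Small (suc (suc i)) p → M ê ≡ atom (suc i) → Outcome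
      two-sided {i} {p} sr Me with good? l i | good? l (suc l) | good? l′ i | good? l′ (suc l)
        where
        l = suc i
        l′ = suc p
      ... | yes a | yes b | _ | _ = inj₁ (by-neighbours (below-small sr) Me (suc i) (inj₁ refl)
            λ { _ (inj₁ refl) → a ; _ (inj₂ refl) → b })
      ... | _ | _ | yes a | yes b = inj₁ (by-neighbours (below-small sr) Me (suc p) (inj₂ refl)
            λ { _ (inj₁ refl) → a ; _ (inj₂ refl) → b })
      ... | no a | _ | no b | _ = ⊥-elim (b (switch (below-small sr) Me (below-small (below-small sr)) (inj₁ refl) a))
      ... | _ | no a | _ | no b = ⊥-elim (b (switch (below-small sr) Me sr (inj₂ refl) a))
      ... | yes a | no b | no c | yes d = inj₂ (inj₁ record
            { top = sr ; M-e = Me ; ⊑-left = bad-⊑ c ; ⊑-right = bad-⊑ b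
            ; M-left = a (bad-⊑ c) ; M-right = d (bad-⊑ b)
            ; ≢-left = λ q → c λ le → trans (a le) q
            ; ≢-right = λ q → b λ le → trans (d le) (sym q) })
      ... | no a | yes b | yes c | no d = inj₂ (inj₂ record
            { top = sr
            ; M-e = at-e
            ; ⊑-left = low (bad-⊑ a) ; ⊑-right = low (bad-⊑ d)
            ; M-left = val (Mir-sym ml) (c (bad-⊑ a)) ; M-right = val ml (b (bad-⊑ d))
            ; ≢-left = λ q → a λ le → trans (c le) (sym q)
            ; ≢-right = λ q → d λ le → trans (b le) q })
        where
        l = suc i
        ml : Mir l (suc p)
        ml = mirr (below-small sr)
        at-e : mirrored M ê ≡ atom l
        at-e = trans (cong (λ x → mir (M x)) mir-e) (trans (cong mir Me) (mir-atom l))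
        low : ∀ {k} → atom k ⊑ w → atom k ⊑ mir w
        low {k} le = subst (_⊑ mir w) (mir-atom k) (mir-⊑ le)
        val : ∀ {k g g′} → Mir g g′ → M (atom k) ≡ act g (atom k) → mirrored M (atom k) ≡ act g′ (atom k)
        val {k} q r = trans (cong (λ x → mir (M x)) (mir-atom k)) (trans (cong mir r)
          (trans (mir-act _ q) (cong (act _) (mir-atom k))))

      -- At the border or next to the centre `l` has a single neighbour among the small indices, and
      -- there is nothing for its choice to disagree with.
      one-sided : ∀ {l l′} → Small l l′ → M ê ≡ atom l → ∀ j → (∀ {k k′} → Small k k′ → Adj k l → k ≡ j) → Outcome
      one-sided {l} {l′} sl Me j only with good? l j | good? l′ j
      ... | yes a | _ = inj₁ (by-neighbours sl Me l (inj₁ refl) λ s a′ → subst (Good l) (sym (only s a′)) a)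
      ... | _ | yes a = inj₁ (by-neighbours sl Me l′ (inj₂ refl) λ s a′ → subst (Good l′) (sym (only s a′)) a)
      ... | no a | no b = inj₁ (by-neighbours sl Me l (inj₁ refl) λ { s a′ le →
              ⊥-elim (b (subst (Good l′) (only s a′) (switch sl Me s a′ (subst (λ k → ¬ Good l k) (sym (only s a′)) a)))) })

      moving-e : ∀ {l l′} → Small l l′ → M ê ≡ atom l → Outcome
      moving-e {zero} sl Me = one-sided sl Me 1 λ { _ (inj₁ ()) ; _ (inj₂ r) → r }
      moving-e {suc i} {zero} (small _ ()) Me
      moving-e {suc i} {suc p} sl Me with suc (suc i) <? p
      ... | yes q = two-sided (small (mk (trans (cong (λ a → suc (suc a)) (sym (+-suc (suc i) p))) (Mir.sum≡ (mirr sl)))) q) Me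
      ... | no q = one-sided sl Me i λ { _ (inj₁ r) → sym (suc-injective r)
                                       ; (small r s) (inj₂ refl) → ⊥-elim (q (subst (_ <_) (suc-injective (Mir-func (Mir-suc r) (mirr sl))) s)) }

    classify : Outcome
    classify with local μ e⊑w
    ... | down q = ⊥-elim (case (trans (sym rk-e) (proj₂ q)))
      where
      case : ∀ {n} → 0 ≡ suc n → ⊥
      case ()
    ... | fix q = inj₁ (act-fixing-e q)
    ... | rise q with small-atom (trans (proj₂ q) (cong suc rk-e))
    ...   | l , l′ , s , r = moving-e s r

  -- Cascades.

  -- If `suc (k + (v + n)) ≡ m` and `k < v`, the cascade lowers the partner of `k` from
  -- `F ê k ≡ v + n` to `v`, and it is the least element with a value at most `v` among the
  -- positions up to `k`.
  cascade : ℕ → ℕ → X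
  cascade zero    v = ê
  cascade (suc n) v = act v (cascade n (suc v))

  Prefix : ℕ → ℕ → X → Set
  Prefix k v x = ∃ λ i → i ≤ k × F x i ≤ v

  -- Otherwise `F w` would decrease through all `suc d` positions from `a` on, with only `suc c`
  -- values available.
  ascent : ∀ {w} d a c → suc (a + d) ≡ m → F w a ≤ c → c < d → ∃ λ j → Desc w j × F w j ≤ c
  ascent {w} (suc d) a c eq le lt with F w a <? F w (suc a)
  ... | yes q = a , (1+a<m , q) , le
    where
    1+a<m : suc a < m
    1+a<m = subst (suc (suc a) ≤_) (trans (cong suc (sym (+-suc a d))) eq) (s≤s (s≤s (m≤m+n a d)))
  ... | no q with ≤-trans (≤∧≢⇒< (≮⇒≥ q) (λ r → 1+n≢n (F-inj w r))) le
  ...   | r with c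
  ...     | zero = ⊥-elim (n≮0 r)
  ...     | suc c′ with ascent {w} d (suc a) c′ (trans (cong suc (sym (+-suc a d))) eq) (s≤s⁻¹ r) (s≤s⁻¹ lt)
  ...       | j , dj , le′ = j , dj , ≤-trans le′ (n≤1+n c′)

  -- Induction on `rk w`. The value `i` sits at position `F w i`, and `ascent` from there finds a
  -- descent `j` with `F w j ≤ i`. For `j ≡ v` the outermost generator is split off. For `j > v`
  -- conjugation by `j` keeps the value at `i`; for `j < v` the position `F w j` acquires the value
  -- `suc j` and takes over.
  cascade-⊑ : ∀ {n v k w} → suc (k + (v + n)) ≡ m → k < v → Prefix k v w → cascade n v ⊑ w
  cascade-⊑ {n} {v} {k} {w} = go (suc (rk w)) n v w (n<1+n _)
    where
    go : ∀ f n v w → rk w < f → suc (k + (v + n)) ≡ m → k < v → Prefix k v w → cascade n v ⊑ w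
    go f zero v w b eq lt P = e-min w
    go (suc f) (suc n) v w b eq lt (i , i≤k , Fi≤v) = main found
      where
      a = F w i
      d = m ∸ suc a
      a<m : suc a ≤ m
      a<m = subst (suc a ≤_) eq (s≤s (≤-trans Fi≤v (≤-trans (m≤m+n v (suc n)) (m≤n+m _ k))))
      k<d : i < d
      k<d = ≤-trans (s≤s i≤k) (m+n≤o⇒m≤o∸n (suc k) (subst (suc k + suc a ≤_) eq
        (s≤s (≤-trans (+-monoʳ-≤ k (s≤s Fi≤v)) (+-monoʳ-≤ k (≤-trans (s≤s (m≤m+n v n)) (≤-reflexive (sym (+-suc v n)))))))))
      found : ∃ λ j → Desc w j × F w j ≤ i
      found = ascent d a i (m+[n∸m]≡n a<m) (≤-reflexive (F-invol w i)) k<d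
      step : ∀ {j} → Desc w j → Prefix k v (act j w) → cascade (suc n) v ⊑ w
      step dj P = ⊑-trans (go f (suc n) v _ (rk-dn dj b) eq lt P) (Desc-⊑ dj)
      main : (∃ λ j → Desc w j × F w j ≤ i) → cascade (suc n) v ⊑ w
      main (j , dj , le) with <-cmp j v
      ... | tri≈ _ refl _ = L₁ dj (⊑-trans (go f n (suc j) (act j w) (rk-dn dj b)
              (trans (cong (λ x → suc (k + x)) (sym (+-suc j n))) eq) (m<n⇒m<1+n lt)
              (i , i≤k , subst (_≤ suc j) (sym (trans (F-o w (proj₁ dj) (<⇒≢ i<j) (<⇒≢ (m<n⇒m<1+n i<j))) refl))
                (≤-trans (sw-≤ j a) (s≤s Fi≤v)))) (Desc-⊑ dj))
        where
        i<j : i < j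
        i<j = ≤-<-trans i≤k lt
      ... | tri> _ _ v<j = step dj (i , i≤k , subst (_≤ v) (sym (trans (F-o w (proj₁ dj) (<⇒≢ i<j) (<⇒≢ (m<n⇒m<1+n i<j)))
              (sw-low j a (≤-<-trans Fi≤v v<j)))) Fi≤v)
        where
        i<j : i < j
        i<j = <-trans (≤-<-trans i≤k lt) v<j
      ... | tri< j<v _ _ = step dj (k₁ , ≤-trans le i≤k , ≤-trans (≤-reflexive (trans (F-o w (proj₁ dj) k₁≢j k₁≢1+j)
              (trans (cong (sw j) (F-invol w j)) (sw-l j)))) j<v)
        where
        k₁ = F w j
        k₁≢j : k₁ ≢ j
        k₁≢j = F-fpf w (<-trans (n<1+n j) (proj₁ dj))
        k₁≢1+j : k₁ ≢ suc j
        k₁≢1+j q = <-asym (proj₂ dj) (subst₂ _<_ (sym (F-swap w q)) (sym q) (n<1+n j))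

  F-cascade : ∀ n {v k} → suc (k + (v + n)) ≡ m → k < v → F (cascade n v) k ≡ v
  F-cascade zero {v} {k} eq lt = +-cancelˡ-≡ k _ _ (suc-injective (trans (F-e k<m) (trans (sym eq) (cong (λ x → suc (k + x)) (+-identityʳ v)))))
    where
    k<m : k < m
    k<m = subst (k <_) eq (s≤s (m≤m+n k _))
  F-cascade (suc n) {v} {k} eq lt = trans (F-o _ 1+v<m (<⇒≢ lt) (<⇒≢ (m<n⇒m<1+n lt)))
    (trans (cong (sw v) (F-cascade n eq′ (m<n⇒m<1+n lt))) (sw-r v))
    where
    eq′ : suc (k + (suc v + n)) ≡ m
    eq′ = trans (cong (λ x → suc (k + x)) (sym (+-suc v n))) eq
    1+v<m : suc v < m
    1+v<m = subst (suc v <_) eq′ (s≤s (≤-trans (m≤m+n (suc v) n) (m≤n+m _ k)))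

  peel : ∀ {a v c} → a ⊑ act v c → a ⊑ c ⊎ Desc a v
  peel {a} {v} {c} le with stat v c
  ... | dn d = inj₁ (⊑-trans le (Desc-⊑ d))
  ... | fx f = inj₁ (subst (a ⊑_) f le)
  ... | up d with Desc? a v
  ...   | yes q = inj₂ q
  ...   | no q = inj₁ (subst (a ⊑_) (act-invol v c) (L₂ d q le))

  cascade-atom : ∀ n {v a} → rk a ≡ 1 → a ⊑ cascade n v → ∃ λ s → v ≤ s × s < v + n × a ≡ atom s
  cascade-atom zero r le = ⊥-elim (rk>0 r (⊑e le))
  cascade-atom (suc n) {v} {a} r le with a ≟X atom v
  ... | yes q = v , ≤-refl , subst (suc v ≤_) (sym (+-suc v n)) (s≤s (m≤m+n v n)) , q
  ... | no q with peel le
  ...   | inj₂ d = ⊥-elim (atom-¬Desc r q d)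
  ...   | inj₁ le′ with cascade-atom n r le′
  ...     | s , p₁ , p₂ , p₃ = s , <⇒≤ p₁ , subst (s <_) (sym (+-suc v n)) p₂ , p₃

  least : ∀ {Q : ℕ → Set} → (∀ k → Dec (Q k)) → ∀ {k} → ¬ Q k → ∃ λ k₀ → k₀ ≤ k × ¬ Q k₀ × (∀ {j} → j < k₀ → Q j)
  least {Q} Q? {k} nq = go (suc k) 0 (+-identityʳ (suc k)) (λ ())
    where
    go : ∀ n a → n + a ≡ suc k → (∀ {j} → j < a → Q j) → ∃ λ k₀ → k₀ ≤ k × ¬ Q k₀ × (∀ {j} → j < k₀ → Q j)
    go zero a refl h = ⊥-elim (nq (h ≤-refl))
    go (suc n) a eq h with Q? a
    ... | no q = a , subst (a ≤_) (suc-injective eq) (m≤n+m a n) , q , h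
    ... | yes q = go n (suc a) (trans (+-suc n a) eq) λ {j} l → [ h , (λ { refl → q }) ]′ (m≤n⇒m<n∨m≡n (s≤s⁻¹ l))

  -- The obstruction to mixed matchings.

  record Two (x a b : X) : Set where
    constructor two
    field
      rk≡2 : rk x ≡ 2
      has₁ : a ⊑ x
      has₂ : b ⊑ x
      only : ∀ {c} → rk c ≡ 1 → c ⊑ x → c ≡ a ⊎ c ≡ b

  open Two

  join : ∀ {k x a} → rk x ≡ 1 → Desc (atom k) k → atom k ≡ a → x ≢ a → Two (act k x) x a
  join {k} {x} rx dk refl ne = two (trans (up-rk d) (cong suc rx)) (proj₁ (up-⋖ d)) (atom⊑ d) λ rc le →
      only′ rc (coatom (act-matching k) tt (up-⋖ d) (rk-⋖ le rc (trans (up-rk d) (cong suc rx))))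
    where
    d : Desc (act k x) k
    d with stat k x
    ... | dn q = ⊥-elim (atom-¬Desc rx ne q)
    ... | fx q = ⊥-elim (ne (sym (rank-eq (lift-fixed q (e-min x)) (trans (atom-rk dk) (sym rx)))))
    ... | up q = q
    only′ : ∀ {c} → rk c ≡ 1 → c ≡ x ⊎ (∃ λ z → z ⋖ x × z ⋖ act k z × act k z ≡ c) → c ≡ x ⊎ c ≡ atom k
    only′ rc (inj₁ p) = inj₁ p
    only′ rc (inj₂ (z , z⋖x , _ , p)) = inj₂ (trans (sym p) (cong (act k) (⋖atom rx z⋖x)))

  small-≢′ : ∀ {j j′ k k′} → Small j j′ → Small k k′ → j ≢ k → atom j ≢ atom k
  small-≢′ sj sk j≢k p with atom-inj (Mir-< (mirr sj)) (Mir-< (mirr sk)) (small-≢ sj) p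
  ... | inj₁ q = j≢k q
  ... | inj₂ q = <-asym (k<k′ sj) (subst₂ _<_ (Mir-func q (mirr sj)) (sym (Mir-func (Mir-sym q) (mirr sk))) (k<k′ sk))

  index : ∀ {i k k′} → Small k k′ → suc i < m → atom i ≡ atom k → i ≡ k ⊎ i ≡ k′
  index sk p q with atom-inj p (Mir-< (mirr sk)) (λ r → small-≢ sk (trans (sym q) r)) q
  ... | inj₁ r = inj₁ r
  ... | inj₂ r = inj₂ (Mir-func (Mir-sym r) (mirr sk))

  -- One of the two atoms differs from `act k x` and would inherit the descent, but a generator
  -- fixing `ê` is a descent of no element of rank one.
  Two-¬center : ∀ {x a b k} → Two x a b → rk a ≡ 1 → rk b ≡ 1 → a ≢ b → atom k ≡ ê → ¬ Desc x k
  Two-¬center {x} {a} {b} {k} t ra rb a≢b f d with a ≟X act k x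
  ... | no q = atom-¬Desc ra (λ r → rk>0 ra (trans r f)) (coatom-desc d (rk-⋖ (has₁ t) ra (rk≡2 t)) q)
  ... | yes q = atom-¬Desc rb (λ r → rk>0 rb (trans r f)) (coatom-desc d (rk-⋖ (has₂ t) rb (rk≡2 t)) (λ r → a≢b (trans q (sym r))))

  coatom-join : ∀ {I M y a b c} → Matching I M → I y → y ⋖ M y → Two y a b → c ⋖ M y → c ≡ y ⊎ c ≡ M a ⊎ c ≡ M b
  coatom-join {M = M} {c = c} μ Iy y⋖ t c⋖ with coatom μ Iy y⋖ c⋖
  ... | inj₁ q = inj₁ q
  ... | inj₂ (z , z⋖y , _ , q) with only t (suc-injective (trans (sym (proj₂ z⋖y)) (rk≡2 t))) (proj₁ z⋖y)
  ...   | inj₁ refl = inj₂ (inj₁ (sym q))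
  ...   | inj₂ refl = inj₂ (inj₂ (sym q))

  -- `b` and `c₂₁` lie over `a₁`, `a₂`; `d` and `c₃₂` lie over `a₃`, `a₂`; `g` lies over `a₁`, `a₃`.
  -- The element `u` has rank three and coatoms `b`, `g`, `d`. The matching sends `a₁` to `c₂₁` and
  -- `a₃` to `c₃₂`, neither of which is below `u`.
  module Analysis {w M} (μ : Matching (_⊑ w) M) (x : Exotic w M) where
    open Exotic x public

    l r l′ t : ℕ
    l  = suc i
    r  = suc l
    l′ = suc p
    t  = suc l′

    s₃ : Small r p
    s₃ = top
    s₂ : Small l l′
    s₂ = small (Mir-suc (mirr s₃)) (<-trans (n<1+n _) (m<n⇒m<1+n (k<k′ s₃)))
    s₁ : Small i t
    s₁ = small (Mir-suc (mirr s₂)) (<-trans (n<1+n _) (m<n⇒m<1+n (k<k′ s₂)))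

    a₁ a₂ a₃ : X
    a₁ = atom i
    a₂ = atom l
    a₃ = atom r

    r₁ : rk a₁ ≡ 1
    r₁ = small-rk s₁
    r₂ : rk a₂ ≡ 1
    r₂ = small-rk s₂
    r₃ : rk a₃ ≡ 1
    r₃ = small-rk s₃

    a₁≢a₂ : a₁ ≢ a₂
    a₁≢a₂ = small-≢′ s₁ s₂ (λ ())
    a₁≢a₃ : a₁ ≢ a₃
    a₁≢a₃ = small-≢′ s₁ s₃ (λ ())
    a₂≢a₃ : a₂ ≢ a₃
    a₂≢a₃ = small-≢′ s₂ s₃ (λ ())

    r<p : suc r < p
    r<p = small-far s₃

    l<l′ : suc l < l′
    l<l′ = small-far s₂

    b c₂₁ d c₃₂ g u : X
    b   = act l′ a₁
    c₂₁ = act l a₁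
    d   = act l a₃
    c₃₂ = act l′ a₃
    g   = act p a₁
    u   = act p b

    tb : Two b a₁ a₂
    tb = join r₁ (subst (λ y → Desc y l′) (atom-mirror (mirr s₂)) (small-Desc′ s₂)) (sym (atom-mirror (mirr s₂))) a₁≢a₂
    t₂₁ : Two c₂₁ a₁ a₂
    t₂₁ = join r₁ (small-Desc s₂) refl a₁≢a₂
    td : Two d a₃ a₂
    td = join r₃ (small-Desc s₂) refl (λ q → a₂≢a₃ (sym q))
    t₃₂ : Two c₃₂ a₃ a₂
    t₃₂ = join r₃ (subst (λ y → Desc y l′) (atom-mirror (mirr s₂)) (small-Desc′ s₂)) (sym (atom-mirror (mirr s₂))) (λ q → a₂≢a₃ (sym q))
    tg : Two g a₁ a₃
    tg = join r₁ (subst (λ y → Desc y p) (atom-mirror (mirr s₃)) (small-Desc′ s₃)) (sym (atom-mirror (mirr s₃))) a₁≢a₃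

    b≡ : act i a₂ ≡ b
    b≡ = trans (cong (act i) (atom-mirror (mirr s₂))) (act-comm ê (inj₁ (<-trans (n<1+n _) l<l′)))
    c₂₁≡ : act t a₂ ≡ c₂₁
    c₂₁≡ = trans (act-comm ê (inj₂ (m<n⇒m<1+n l<l′))) (cong (act l) (sym (atom-mirror (mirr s₁))))
    d≡ : act p a₂ ≡ d
    d≡ = trans (act-comm ê (inj₂ (<-trans (n<1+n _) r<p))) (cong (act l) (sym (atom-mirror (mirr s₃))))
    c₃₂≡ : act r a₂ ≡ c₃₂
    c₃₂≡ = trans (cong (act r) (atom-mirror (mirr s₂))) (act-comm ê (inj₁ (m<n⇒m<1+n r<p)))

    ∉ : ∀ {x a b c} → rk c ≡ 1 → Two x a b → c ≢ a → c ≢ b → ¬ (c ⊑ x)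
    ∉ rc t p q le = [ p , q ]′ (only t rc le)

    via : ∀ {x y c} → ¬ (c ⊑ y) → c ⊑ x → x ≢ y
    via n le refl = n le

    du : Desc u p
    du with stat p b
    ... | dn q = ⊥-elim (∉ r₃ tb (λ s → a₁≢a₃ (sym s)) (λ s → a₂≢a₃ (sym s)) (subst (_⊑ b) (sym (atom-mirror (mirr s₃))) (atom⊑ q)))
    ... | fx q = ⊥-elim (∉ r₃ tb (λ s → a₁≢a₃ (sym s)) (λ s → a₂≢a₃ (sym s)) (subst (_⊑ b) (sym (atom-mirror (mirr s₃))) (lift-fixed q (e-min b))))
    ... | up q = q

    rk-u : rk u ≡ 3
    rk-u = trans (up-rk du) (cong suc (rk≡2 tb))

    b⊑u : b ⊑ u
    b⊑u = proj₁ (up-⋖ du)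
    g⊑u : g ⊑ u
    g⊑u = L₁ du (⊑-trans (has₁ tb) b⊑u)
    d⊑u : d ⊑ u
    d⊑u = subst (_⊑ u) d≡ (L₁ du (⊑-trans (has₂ tb) b⊑u))

    below-u : ∀ {c} → rk c ≡ 2 → c ⊑ u → c ≡ b ⊎ c ≡ g ⊎ c ≡ d
    below-u rc le = [ inj₁ , [ (λ q → inj₂ (inj₁ q)) , (λ q → inj₂ (inj₂ (trans q d≡))) ]′ ]′
      (coatom-join (act-matching p) tt (up-⋖ du) tb (rk-⋖ le rc rk-u))

    a₁∉d : ¬ (a₁ ⊑ d)
    a₁∉d = ∉ r₁ td a₁≢a₃ a₁≢a₂
    a₁∉c₃₂ : ¬ (a₁ ⊑ c₃₂)
    a₁∉c₃₂ = ∉ r₁ t₃₂ a₁≢a₃ a₁≢a₂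
    a₂∉g : ¬ (a₂ ⊑ g)
    a₂∉g = ∉ r₂ tg (λ q → a₁≢a₂ (sym q)) a₂≢a₃
    a₃∉b : ¬ (a₃ ⊑ b)
    a₃∉b = ∉ r₃ tb (λ q → a₁≢a₃ (sym q)) (λ q → a₂≢a₃ (sym q))
    a₃∉c₂₁ : ¬ (a₃ ⊑ c₂₁)
    a₃∉c₂₁ = ∉ r₃ t₂₁ (λ q → a₁≢a₃ (sym q)) (λ q → a₂≢a₃ (sym q))

    c₂₁∉u : ¬ (c₂₁ ⊑ u)
    c₂₁∉u le = [ ≢-left , [ via a₂∉g (has₂ t₂₁) , via a₁∉d (has₁ t₂₁) ]′ ]′ (below-u (rk≡2 t₂₁) le)

    c₃₂∉u : ¬ (c₃₂ ⊑ u)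
    c₃₂∉u le = [ via a₃∉b (has₁ t₃₂) , [ via a₂∉g (has₂ t₃₂) , (λ q → ≢-right (sym q)) ]′ ]′ (below-u (rk≡2 t₃₂) le)

    -- `M u` has rank four, with coatoms `u`, `A`, `G`, `B`. A descent of `M u` is inherited by
    -- three of them at least. But no generator is a descent of both `u` and `G`, and none is a
    -- descent of `A`, `B` and one of `u`, `G`.
    module Obstruction (u⊑w : u ⊑ w) where
      b⊑w : b ⊑ w
      b⊑w = ⊑-trans b⊑u u⊑w
      d⊑w : d ⊑ w
      d⊑w = ⊑-trans d⊑u u⊑w
      g⊑w : g ⊑ w
      g⊑w = ⊑-trans g⊑u u⊑w

      A B G : X
      A = M b
      B = M d
      G = M g

      -- y lies below z and M y is not below z, so M z covers z.
      rises : ∀ {y z n} → z ⊑ w → rk y ≡ n → rk z ≡ suc n → y ⊑ z → rk (M y) ≡ suc n → M y ≢ z → z ⋖ M z × M y ⊑ M z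
      rises {y} {z} z⊑w ry rz le rMy ne with compat μ (⊑-trans le z⊑w) z⊑w (rk-⋖ le ry rz) ne
      ... | q with local μ z⊑w
      ...   | rise s = s , q
      ...   | fix s = ⊥-elim (ne (rank-eq (subst (M y ⊑_) s q) (trans rMy (sym rz))))
      ...   | down s = ⊥-elim (1+n≰n (≤-trans (≤-reflexive (trans (sym (trans (sym rz) (proj₂ s))) (sym rMy))) (rk-mono q)))

      rM₁ : rk (M a₁) ≡ 2
      rM₁ = trans (cong rk M-left) (rk≡2 t₂₁)
      rM₃ : rk (M a₃) ≡ 2
      rM₃ = trans (cong rk M-right) (rk≡2 t₃₂)

      liftA : b ⋖ A × M a₁ ⊑ A
      liftA = rises b⊑w r₁ (rk≡2 tb) (has₁ tb) rM₁ (λ q → ≢-left (trans (sym M-left) q))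
      liftB : d ⋖ B × M a₃ ⊑ B
      liftB = rises d⊑w r₃ (rk≡2 td) (has₁ td) rM₃ (λ q → ≢-right (sym (trans (sym M-right) q)))
      liftG : g ⋖ G × M a₁ ⊑ G
      liftG = rises g⊑w r₁ (rk≡2 tg) (has₁ tg) rM₁ (λ q → via a₂∉g (has₂ t₂₁) (trans (sym M-left) q))
      liftG′ : g ⋖ G × M a₃ ⊑ G
      liftG′ = rises g⊑w r₃ (rk≡2 tg) (has₂ tg) rM₃ (λ q → via a₂∉g (has₂ t₃₂) (trans (sym M-right) q))

      c₂₁⊑A : c₂₁ ⊑ A
      c₂₁⊑A = subst (_⊑ A) M-left (proj₂ liftA)
      c₃₂⊑B : c₃₂ ⊑ B
      c₃₂⊑B = subst (_⊑ B) M-right (proj₂ liftB)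
      c₂₁⊑G : c₂₁ ⊑ G
      c₂₁⊑G = subst (_⊑ G) M-left (proj₂ liftG)
      c₃₂⊑G : c₃₂ ⊑ G
      c₃₂⊑G = subst (_⊑ G) M-right (proj₂ liftG′)

      rA : rk A ≡ 3
      rA = trans (proj₂ (proj₁ liftA)) (cong suc (rk≡2 tb))
      rB : rk B ≡ 3
      rB = trans (proj₂ (proj₁ liftB)) (cong suc (rk≡2 td))
      rG : rk G ≡ 3
      rG = trans (proj₂ (proj₁ liftG)) (cong suc (rk≡2 tg))

      Ma₂≡e : M a₂ ≡ ê
      Ma₂≡e = flip μ (e-min w) M-e

      below-A : ∀ {c} → rk c ≡ 2 → c ⊑ A → c ≡ b ⊎ c ≡ c₂₁
      below-A rc le = [ inj₁ , [ (λ q → inj₂ (trans q M-left)) , (λ q → ⊥-elim (rk>0 rc (trans q Ma₂≡e))) ]′ ]′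
        (coatom-join μ b⊑w (proj₁ liftA) tb (rk-⋖ le rc rA))

      below-B : ∀ {c} → rk c ≡ 2 → c ⊑ B → c ≡ d ⊎ c ≡ c₃₂
      below-B rc le = [ inj₁ , [ (λ q → inj₂ (trans q M-right)) , (λ q → ⊥-elim (rk>0 rc (trans q Ma₂≡e))) ]′ ]′
        (coatom-join μ d⊑w (proj₁ liftB) td (rk-⋖ le rc rB))

      below-G : ∀ {c} → rk c ≡ 2 → c ⊑ G → c ≡ g ⊎ c ≡ c₂₁ ⊎ c ≡ c₃₂
      below-G rc le = [ inj₁ , [ (λ q → inj₂ (inj₁ (trans q M-left))) , (λ q → inj₂ (inj₂ (trans q M-right))) ]′ ]′
        (coatom-join μ g⊑w (proj₁ liftG) tg (rk-⋖ le rc rG))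

      b∉G : ¬ (b ⊑ G)
      b∉G le = [ via a₂∉g (has₂ tb) , [ (λ q → ≢-left (sym q)) , via a₁∉c₃₂ (has₁ tb) ]′ ]′ (below-G (rk≡2 tb) le)

      d∉G : ¬ (d ⊑ G)
      d∉G le = [ via a₂∉g (has₂ td) , [ via a₃∉c₂₁ (has₁ td) , ≢-right ]′ ]′ (below-G (rk≡2 td) le)

      g∉A : ¬ (g ⊑ A)
      g∉A le = [ via a₃∉b (has₂ tg) , via a₃∉c₂₁ (has₂ tg) ]′ (below-A (rk≡2 tg) le)

      g∉B : ¬ (g ⊑ B)
      g∉B le = [ via a₁∉d (has₁ tg) , via a₁∉c₃₂ (has₁ tg) ]′ (below-B (rk≡2 tg) le)

      by-center : ∀ k → Dec (atom k ≡ ê) → {C : Set} → (atom k ≡ ê → C) → (atom k ≢ ê → C) → C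
      by-center k (yes f) y n = y f
      by-center k (no f) y n = n f

      ≢3 : ∀ {y z} → rk y ≡ 1 → rk z ≡ 3 → y ≢ z
      ≢3 p q refl = contr (trans (sym p) q)
        where
        contr : 1 ≡ 3 → ⊥
        contr ()

      above-1 : ∀ {y z} → rk y ≡ 1 → rk z ≡ 3 → y ⊑ z → ∃ λ c → rk c ≡ 2 × y ⊑ c × c ⊑ z
      above-1 ry rz le with cover-above le (≢3 ry rz)
      ... | c , le′ , c⋖ = c , suc-injective (trans (sym (proj₂ c⋖)) rz) , le′ , proj₁ c⋖

      shift : ∀ {y c c′} → y ⊑ c → c ≡ c′ → y ⊑ c′
      shift le refl = le

      rk-atom : ∀ {x k} → Desc x k → atom k ≢ ê → rk (atom k) ≡ 1
      rk-atom dx f = atom-rk (atom-Desc (proj₁ dx) f)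

      -- The atom of `k` lies below `A` and below `B`, whose only common atom is `a₂`. A central `k`
      -- is impossible since `b` or `c₂₁` would inherit the descent.
      at-a₂ : ∀ {k} → Desc A k → Desc B k → k ≡ l ⊎ k ≡ l′
      at-a₂ {k} dA dB = by-center k (atom k ≟X ê) (λ f → ⊥-elim (split f (b ≟X act k A))) λ f →
          index s₂ (proj₁ dA) (decide (in-A f) (in-B f))
        where
        split : atom k ≡ ê → Dec (b ≡ act k A) → ⊥
        split f (no q) = Two-¬center tb r₁ r₂ a₁≢a₂ f (coatom-desc dA (proj₁ liftA) q)
        split f (yes q) = Two-¬center t₂₁ r₁ r₂ a₁≢a₂ f (coatom-desc dA (rk-⋖ c₂₁⊑A (rk≡2 t₂₁) rA) (λ s → ≢-left (trans s (sym q))))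
        in-A : atom k ≢ ê → atom k ≡ a₁ ⊎ atom k ≡ a₂
        in-A f = let (c , rc , le , le′) = above-1 (rk-atom dA f) rA (atom⊑ dA) in
          [ (λ q → only tb (rk-atom dA f) (shift le q)) , (λ q → only t₂₁ (rk-atom dA f) (shift le q)) ]′ (below-A rc le′)
        in-B : atom k ≢ ê → atom k ≡ a₃ ⊎ atom k ≡ a₂
        in-B f = let (c , rc , le , le′) = above-1 (rk-atom dB f) rB (atom⊑ dB) in
          [ (λ q → only td (rk-atom dB f) (shift le q)) , (λ q → only t₃₂ (rk-atom dB f) (shift le q)) ]′ (below-B rc le′)
        decide : atom k ≡ a₁ ⊎ atom k ≡ a₂ → atom k ≡ a₃ ⊎ atom k ≡ a₂ → atom k ≡ a₂
        decide (inj₂ q) _ = q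
        decide _ (inj₂ q) = q
        decide (inj₁ q) (inj₁ s) = ⊥-elim (a₁≢a₃ (trans (sym q) s))

      a₁⊑u : a₁ ⊑ u
      a₁⊑u = ⊑-trans (has₁ tb) b⊑u
      a₂⊑u : a₂ ⊑ u
      a₂⊑u = ⊑-trans (has₂ tb) b⊑u
      a₃⊑u : a₃ ⊑ u
      a₃⊑u = ⊑-trans (has₁ td) d⊑u

      along : ∀ {k k′ y z} → Desc z k → k ≡ k′ → y ⊑ z → act k′ y ⊑ z
      along d refl le = L₁ d le

      ¬ABu : ∀ {k} → Desc A k → Desc B k → ¬ Desc u k
      ¬ABu dA dB dU = [ (λ q → c₂₁∉u (along dU q a₁⊑u)) , (λ q → c₃₂∉u (along dU q a₃⊑u)) ]′ (at-a₂ dA dB)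

      ¬ABG : ∀ {k} → Desc A k → Desc B k → ¬ Desc G k
      ¬ABG dA dB dG = [ (λ q → d∉G (along dG q (⊑-trans (has₁ t₃₂) c₃₂⊑G)))
                      , (λ q → b∉G (along dG q (⊑-trans (has₁ t₂₁) c₂₁⊑G))) ]′ (at-a₂ dA dB)

      -- The atom of `k` is one of the three atoms of `u`. For each index with such an atom, lifting
      -- an atom by `act k` puts `c₂₁` or `c₃₂` below `u`, or `b` or `d` below `G`.
      ¬uG : ∀ {k} → Desc u k → ¬ Desc G k
      ¬uG {k} dU dG = by-center k (atom k ≟X ê) (λ f → split f (b ≟X act k u)) λ f → by-index (in-u f)
        where
        split : atom k ≡ ê → Dec (b ≡ act k u) → ⊥
        split f (no q) = Two-¬center tb r₁ r₂ a₁≢a₂ f (coatom-desc dU (rk-⋖ b⊑u (rk≡2 tb) rk-u) q)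
        split f (yes q) = Two-¬center td r₃ r₂ (λ s → a₂≢a₃ (sym s)) f
          (coatom-desc dU (rk-⋖ d⊑u (rk≡2 td) rk-u) (λ s → via a₁∉d (has₁ tb) (trans q (sym s))))
        in-u : atom k ≢ ê → atom k ≡ a₁ ⊎ atom k ≡ a₂ ⊎ atom k ≡ a₃
        in-u f = let (c , rc , le , le′) = above-1 (rk-atom dU f) rk-u (atom⊑ dU) in
          [ (λ q → [ inj₁ , (λ s → inj₂ (inj₁ s)) ]′ (only tb (rk-atom dU f) (shift le q)))
          , [ (λ q → [ inj₁ , (λ s → inj₂ (inj₂ s)) ]′ (only tg (rk-atom dU f) (shift le q)))
            , (λ q → [ (λ s → inj₂ (inj₂ s)) , (λ s → inj₂ (inj₁ s)) ]′ (only td (rk-atom dU f) (shift le q))) ]′ ]′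
          (below-u rc le′)
        a₂⊑G : a₂ ⊑ G
        a₂⊑G = ⊑-trans (has₂ t₂₁) c₂₁⊑G
        by-index : atom k ≡ a₁ ⊎ atom k ≡ a₂ ⊎ atom k ≡ a₃ → ⊥
        by-index (inj₁ q) =
          [ (λ s → b∉G (subst (_⊑ G) b≡ (along dG s a₂⊑G)))
          , (λ s → c₂₁∉u (subst (_⊑ u) c₂₁≡ (along dU s a₂⊑u))) ]′ (index s₁ (proj₁ dU) q)
        by-index (inj₂ (inj₁ q)) =
          [ (λ s → c₂₁∉u (along dU s a₁⊑u)) , (λ s → c₃₂∉u (along dU s a₃⊑u)) ]′ (index s₂ (proj₁ dU) q)
        by-index (inj₂ (inj₂ q)) =
          [ (λ s → c₃₂∉u (subst (_⊑ u) c₃₂≡ (along dU s a₂⊑u)))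
          , (λ s → d∉G (subst (_⊑ G) d≡ (along dG s a₂⊑G))) ]′ (index s₃ (proj₁ dU) q)

      u-rises : u ⋖ M u
      u-rises = proj₁ (rises u⊑w (rk≡2 tb) rk-u b⊑u rA (λ q → c₂₁∉u (subst (c₂₁ ⊑_) q c₂₁⊑A)))

      below-P : ∀ {c} → c ⋖ M u → c ≡ u ⊎ c ≡ A ⊎ c ≡ G ⊎ c ≡ B
      below-P {c} c⋖ = [ inj₁ , (λ q → inj₂ (pick q)) ]′ (coatom μ u⊑w u-rises c⋖)
        where
        value : ∀ {z} → M z ≡ c → z ≡ b ⊎ z ≡ g ⊎ z ≡ d → c ≡ A ⊎ c ≡ G ⊎ c ≡ B
        value q (inj₁ s) = inj₁ (trans (sym q) (cong M s))
        value q (inj₂ (inj₁ s)) = inj₂ (inj₁ (trans (sym q) (cong M s)))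
        value q (inj₂ (inj₂ s)) = inj₂ (inj₂ (trans (sym q) (cong M s)))
        pick : (∃ λ z → z ⋖ u × z ⋖ M z × M z ≡ c) → c ≡ A ⊎ c ≡ G ⊎ c ≡ B
        pick (z , z⋖ , _ , q) = value q (below-u (suc-injective (trans (sym (proj₂ z⋖)) rk-u)) (proj₁ z⋖))

      rP : rk (M u) ≡ 4
      rP = trans (proj₂ u-rises) (cong suc rk-u)

      A⋖P : A ⋖ M u
      A⋖P = rk-⋖ (proj₂ (rises u⊑w (rk≡2 tb) rk-u b⊑u rA (λ q → c₂₁∉u (subst (c₂₁ ⊑_) q c₂₁⊑A)))) rA rP
      B⋖P : B ⋖ M u
      B⋖P = rk-⋖ (proj₂ (rises u⊑w (rk≡2 td) rk-u d⊑u rB (λ q → c₃₂∉u (subst (c₃₂ ⊑_) q c₃₂⊑B)))) rB rP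
      G⋖P : G ⋖ M u
      G⋖P = rk-⋖ (proj₂ (rises u⊑w (rk≡2 tg) rk-u g⊑u rG (λ q → c₂₁∉u (subst (c₂₁ ⊑_) q c₂₁⊑G)))) rG rP

      impossible : ⊥
      impossible = let (k , dP) = rk-pos rP in by-descent dP (below-P (Desc-⋖ dP))
        where
        by-descent : ∀ {k} → Desc (M u) k → act k (M u) ≡ u ⊎ act k (M u) ≡ A ⊎ act k (M u) ≡ G ⊎ act k (M u) ≡ B → ⊥
        by-descent {k} dP = [ (λ q → ¬ABG (oth q A⋖P (via c₂₁∉u c₂₁⊑A)) (oth q B⋖P (via c₃₂∉u c₃₂⊑B)) (oth q G⋖P (via c₂₁∉u c₂₁⊑G)))
          , [ (λ q → ¬uG (oth q u-rises (λ s → via c₂₁∉u c₂₁⊑A (sym s))) (oth q G⋖P (via g∉A (proj₁ (proj₁ liftG)))))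
          , [ (λ q → ¬ABu (oth q A⋖P (λ s → via g∉A (proj₁ (proj₁ liftG)) (sym s)))
                  (oth q B⋖P (λ s → via g∉B (proj₁ (proj₁ liftG)) (sym s))) (oth q u-rises (λ s → via c₂₁∉u c₂₁⊑G (sym s))))
            , (λ q → ¬uG (oth q u-rises (λ s → via c₃₂∉u c₃₂⊑B (sym s))) (oth q G⋖P (via g∉B (proj₁ (proj₁ liftG))))) ]′ ]′ ]′
          where
          oth : ∀ {c c′} → act k (M u) ≡ c′ → c ⋖ M u → c ≢ c′ → Desc c k
          oth q c⋖ ne = coatom-desc dP c⋖ (λ s → ne (trans s q))

  -- The companion of a mixed matching.

  Fe-anti : ∀ {a b} → a < b → b < m → F ê b < F ê a
  Fe-anti {a} {b} a<b b<m = ≰⇒> λ le → <⇒≢ (s≤s (+-mono-<-≤ a<b le)) (trans (F-e (<-trans a<b b<m)) (sym (F-e b<m)))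

  Fe-anti′ : ∀ {a b} → a ≤ b → b < m → F ê b ≤ F ê a
  Fe-anti′ a≤b b<m with m≤n⇒m<n∨m≡n a≤b
  ... | inj₁ q = <⇒≤ (Fe-anti q b<m)
  ... | inj₂ refl = ≤-refl

  record Companion (w : X) (M : X → X) : Set where
    constructor companion
    field
      {gen}    : ℕ
      desc-w   : Desc w gen
      commutes : ∀ {u} → u ⊑ w → M (act gen u) ≡ act gen (M u)
      differs  : M w ≢ act gen w

  module _ {w M} (μ : Matching (_⊑ w) M) (x : Exotic w M) where
    open Analysis μ x
    open Below μ using (atom-value; far-value)

    private
      sum₃ : suc (i + (p + 3)) ≡ m
      sum₃ = trans (arith i p) (Mir.sum≡ (mirr s₃))
        where
        arith : ∀ i p → suc (i + (p + 3)) ≡ suc (suc (suc (suc i) + p))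
        arith = solve-∀

      i<p : i < p
      i<p = <-trans (n<1+n i) (<-trans (n<1+n l) (k<k′ s₃))

      i<m : i < m
      i<m = <-trans (n<1+n i) (Mir-< (mirr s₁))

      -- Since `a₁` is also the atom of `t ≡ suc (suc p)`, the forbidden element `u` is the cascade
      -- of length three starting at `p`.
      ¬low : ¬ Prefix i p w
      ¬low P = Obstruction.impossible (subst (_⊑ w) (cong (λ y → act p (act l′ y)) (sym (atom-mirror (mirr s₁))))
        (cascade-⊑ {3} sum₃ i<p P))

      F-a₁ : F a₁ i ≡ t
      F-a₁ = trans (F-l ê (Mir-< (mirr s₁))) (trans (cong (sw i) (Fe-r (mirr s₁))) (sw-high i t (small-far s₁)))

      -- `a₁` has the value `t` at position `i`, so `F w` has a value at most `t` at some position
      -- up to `i`, where `F ê` is at least `suc t`.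
      deviates : ∃ λ k → k ≤ i × F w k ≢ F ê k
      deviates with prefix i<m ⊑-left (i , ≤-refl , ≤-reflexive F-a₁)
      ... | k , k≤i , le = k , k≤i , λ q → <⇒≱ (s≤s le) (≤-trans (≤-reflexive (sym (Fe-l (mirr s₁))))
              (≤-trans (Fe-anti′ k≤i i<m) (≤-reflexive (sym q))))

      -- At the first deviation `k₀`, all values smaller than `k₀` still sit at positions beyond
      -- `F ê k₀`. So the position after `j` has a value larger than `k₀ ≡ F w j`, and `j` is a
      -- descent of `w`.
      module Deviation {k₀ : ℕ} (k₀≤i : k₀ ≤ i) (dev : F w k₀ ≢ F ê k₀) (same-below : ∀ {q} → q < k₀ → F w q ≡ F ê q) where
        j : ℕ
        j = F w k₀
        k₀<m : k₀ < m
        k₀<m = ≤-<-trans k₀≤i i<m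
        j<m : j < m
        j<m = F-< w k₀<m
        j<Fe : j < F ê k₀
        j<Fe with <-cmp j (F ê k₀)
        ... | tri< q _ _ = q
        ... | tri≈ _ q _ = ⊥-elim (dev q)
        ... | tri> _ _ q = ⊥-elim (<⇒≢ low (F-inj w (trans (same-below low) (F-invol ê j))))
          where
          low : F ê j < k₀
          low = subst (F ê j <_) (F-invol ê k₀) (Fe-anti q j<m)

        Fj : F w j ≡ k₀
        Fj = F-invol w k₀

        dj : Desc w j
        dj = 1+j<m , subst (_< F w (suc j)) (sym Fj) (≤∧≢⇒< (≮⇒≥ ¬<) λ q → 1+n≢n (sym (F-swap w (sym q))))
          where
          1+j<m : suc j < m
          1+j<m = ≤-<-trans j<Fe (F-< ê k₀<m)
          ¬< : ¬ (F w (suc j) < k₀)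
          ¬< q = <⇒≱ (Fe-anti q k₀<m) (subst (_≤ F ê k₀) (trans (sym (F-invol w (suc j))) (same-below q)) j<Fe)

        l′≤j : l′ ≤ j
        l′≤j = ≰⇒> λ q → ¬low (k₀ , k₀≤i , q)

        sj : ∃ λ jm → Small jm j × jm ≤ l
        sj with mirror (proj₁ dj)
        ... | jm , q = jm , small (Mir-sym q) (≤-<-trans jm≤l (<-≤-trans (k<k′ s₂) l′≤j)) , jm≤l
          where
          jm≤l : jm ≤ l
          jm≤l = +-cancelʳ-≤ l′ jm l (≤-trans (+-monoʳ-≤ jm l′≤j)
            (≤-reflexive (trans (+-comm jm j) (suc-injective (suc-injective (trans (Mir.sum≡ q) (sym (Mir.sum≡ (mirr s₂)))))))))

        far-jl : Far j l
        far-jl = inj₂ (<-≤-trans l<l′ l′≤j)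

        -- By `¬low`, `j` is at least `l′`, hence far from `l`, and its mirror index is at most `l`.
        -- On the atom of that index `M` acts as `act l`: the neighbour where `M` follows only `l′`
        -- is `suc l`, on the other side.
        base : M (act j ê) ≡ act j (M ê)
        base = trans (value sj) (cong (act j) (sym M-e))
          where
          far-irr : ∀ {a} → ¬ Far a a
          far-irr (inj₁ q) = <⇒≱ q (n≤1+n _)
          far-irr (inj₂ q) = <⇒≱ q (n≤1+n _)
          l-atom : act l (atom j) ≡ act j (atom l)
          l-atom = act-comm ê (Far-sym far-jl)
          same-case : ∀ {jm} → jm ≡ l → atom jm ≡ atom j → M (atom jm) ≡ act j (atom l)
          same-case q r = trans (trans (cong (λ h → M (atom h)) q) (flip μ (e-min w) M-e))
            (sym (trans (cong (act j) (trans (cong atom (sym q)) r)) (act-invol j ê)))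
          left-case : ∀ {jm} → l ≡ suc jm → atom jm ≡ atom j → M (atom jm) ≡ act j (atom l)
          left-case q r = trans (cong (λ h → M (atom h)) (sym (suc-injective q)))
            (trans M-left (trans (cong (act l) (trans (cong atom (suc-injective q)) r)) l-atom))
          far-case : ∀ {jm} → Small jm j → Far jm l → M (atom jm) ≡ act j (atom l)
          far-case {jm} s f = trans
            ([ (λ q → q) , (λ q → trans q (sym (far-value s₂ s f))) ]′
              (atom-value s₂ s M-e (λ q → far-irr (subst (Far jm) (sym q) f))
                (subst (_⊑ w) (sym (atom-mirror (mirr s))) (atom⊑ dj))))
            (trans (cong (act l) (atom-mirror (mirr s))) l-atom)
          by-rel : ∀ {jm} → Small jm j → jm ≤ l → Rel jm l → M (atom jm) ≡ act j (atom l)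
          by-rel s le (same q) = same-case q (atom-mirror (mirr s))
          by-rel s le (adj (inj₁ q)) = left-case q (atom-mirror (mirr s))
          by-rel s le (adj (inj₂ q)) = ⊥-elim (<⇒≱ (≤-reflexive (sym q)) le)
          by-rel s le (far f) = far-case s f
          value : (∃ λ jm → Small jm j × jm ≤ l) → M (act j ê) ≡ act j (atom l)
          value (jm , s , le) = trans (cong M (sym (atom-mirror (mirr s)))) (by-rel s le (rel jm l))

        n : ℕ
        n = F ê k₀ ∸ j
        j+n : j + n ≡ F ê k₀
        j+n = m+[n∸m]≡n (<⇒≤ j<Fe)
        sumₙ : suc (k₀ + (j + n)) ≡ m
        sumₙ = trans (cong (λ y → suc (k₀ + y)) j+n) (F-e k₀<m)
        k₀<j : k₀ < j
        k₀<j = ≤-<-trans k₀≤i (<-≤-trans i<p (≤-trans (n≤1+n p) l′≤j))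

        -- The least element with a value at most `j` up to position `k₀`. It is below `w`, but not
        -- below `act j w`, where the value at `k₀` has become `suc j`.
        v : X
        v = cascade n j
        v⊑w : v ⊑ w
        v⊑w = cascade-⊑ sumₙ k₀<j (k₀ , ≤-refl , ≤-refl)
        F-v : F v k₀ ≡ j
        F-v = F-cascade n sumₙ k₀<j
        v⋢ : ¬ (v ⊑ act j w)
        v⋢ le = excluded (prefix k₀<m le (k₀ , ≤-refl , ≤-reflexive F-v))
          where
          beyond : ∀ {k} → k < k₀ ⊎ k ≡ k₀ → j < sw j (F w k)
          beyond (inj₂ q) = ≤-reflexive (sym (trans (cong (λ k → sw j (F w k)) q) (sw-l j)))
          beyond {k} (inj₁ r) = subst (j <_) (sym (sw-high j _ big)) (<-trans (n<1+n j) big)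
            where
            big : suc j < F w k
            big = subst (suc j <_) (sym (same-below r)) (≤-<-trans j<Fe (Fe-anti r k₀<m))
          excluded : ¬ Prefix k₀ j (act j w)
          excluded (k , k≤k₀ , q) = <⇒≱ (subst (j <_) (sym (F-o w (proj₁ dj) (<⇒≢ k<j) (<⇒≢ (m<n⇒m<1+n k<j)))) (beyond (m≤n⇒m<n∨m≡n k≤k₀))) q
            where
            k<j : k < j
            k<j = ≤-<-trans k≤k₀ k₀<j

        atom-of : ∀ n′ {j′} → j ≤ j′ → j′ + n′ ≡ F ê k₀ → a₂ ⊑ cascade n′ j′ → j′ ≤ l′
        atom-of n′ {j′} j≤ eq le = located (cascade-atom n′ r₂ le)
          where
          located : (∃ λ s → j′ ≤ s × s < j′ + n′ × a₂ ≡ atom s) → j′ ≤ l′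
          located (s , j′≤s , s< , q) =
            [ (λ s≡l → ⊥-elim (<⇒≱ (<-≤-trans (k<k′ s₂) (≤-trans l′≤j j≤)) (≤-trans j′≤s (≤-reflexive s≡l))))
            , (λ s≡l′ → ≤-trans j′≤s (≤-reflexive s≡l′)) ]′
            (index s₂ (≤-<-trans (subst (s <_) eq s<) (F-< ê k₀<m)) (sym q))

        -- If they were equal, `pull` would put `v` below `act j w` unless `M` lowers `v`. In that
        -- case `M` preserves the elements below `v`: `a₂ ≡ M ê` lies below `v`, which forces
        -- `j ≡ l′`, so `a₁` and then `c₂₁ ≡ M a₁` lie below `v`. But `c₂₁` neither has the descent
        -- `l′` nor lies below the rest of the cascade, which misses `a₂`.
        differ : M w ≢ act j w
        differ Mw = [ (λ q → v⋢ (subst (v ⊑_) Mw (stays q))) , (λ q → v⋢ (subst (v ⊑_) Mw q)) ]′ (pull μ ⊑-refl v⊑w)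
          where
          contradiction : M v ⋖ v → ⊥
          contradiction Mv⋖v = finish (≤-antisym l′≤j (atom-of n ≤-refl j+n a₂⊑v))
            where
            keep : ∀ {y} → y ⊑ v → M y ⊑ v
            keep = preserves μ v⊑w (proj₁ Mv⋖v)
            a₂⊑v : a₂ ⊑ v
            a₂⊑v = subst (_⊑ v) M-e (keep (e-min v))
            sum₁ : suc (i + (t + 1)) ≡ m
            sum₁ = trans (arith i p) (Mir.sum≡ (mirr s₃))
              where
              arith : ∀ i p → suc (i + (suc (suc p) + 1)) ≡ suc (suc (suc (suc i) + p))
              arith = solve-∀
            a₁⊑v : l′ ≡ j → a₁ ⊑ v
            a₁⊑v q = subst (_⊑ v) (sym (atom-mirror (mirr s₁)))
              (cascade-⊑ {1} sum₁ (<-trans i<p (<-trans (n<1+n p) (n<1+n _)))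
                (k₀ , k₀≤i , ≤-trans (≤-reflexive (trans F-v (sym q))) (n≤1+n l′)))
            finish : l′ ≡ j → ⊥
            finish q = inside n refl
              where
              c⊑v : c₂₁ ⊑ v
              c⊑v = subst (_⊑ v) M-left (keep (a₁⊑v q))
              ¬Desc-c : ¬ Desc c₂₁ j
              ¬Desc-c d =
                [ (λ s → ≢-left (trans (sym (act-invol j c₂₁)) (trans (cong (act j) s) (cong (λ h → act h a₁) (sym q)))))
                , (λ s → rk>0 (Two.rk≡2 t₂₁) (trans (sym (act-invol j c₂₁))
                    (trans (cong (act j) (trans s (trans (atom-mirror (mirr s₂)) (cong atom q)))) (act-invol j ê)))) ]′
                (Two.only t₂₁ (suc-injective (trans (sym (Desc-rk d)) (Two.rk≡2 t₂₁))) (Desc-⊑ d))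
              inside : ∀ n′ → n ≡ n′ → ⊥
              inside zero eq = rk>0 (Two.rk≡2 t₂₁) (⊑e (subst (λ h → c₂₁ ⊑ cascade h j) eq c⊑v))
              inside (suc n′) eq =
                [ (λ le → 1+n≰n (≤-trans (atom-of n′ (n≤1+n j) (trans (sym (+-suc j n′)) (trans (cong (j +_) (sym eq)) j+n))
                    (⊑-trans (Two.has₂ t₂₁) le)) (≤-reflexive q)))
                , ¬Desc-c ]′ (peel (subst (λ h → c₂₁ ⊑ cascade h j) eq c⊑v))
          stays : M v ⊑ M w → v ⊑ M w
          stays le = by-local (local μ v⊑w)
            where
            by-local : Local M v → v ⊑ M w
            by-local (down q) = ⊥-elim (contradiction q)
            by-local (fix q) = subst (_⊑ M w) q le
            by-local (rise q) = ⊑-trans (proj₁ q) le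

        result : Companion w M
        result = companion dj (commute μ (act-matching-below (Desc-⊑ dj)) base) differ

    exotic-companion : Companion w M
    exotic-companion = let (_ , k≤i , dev) = deviates
                           (_ , k₀≤k , dev₀ , same-below) = least (λ k → F w k ≟ F ê k) dev
                       in Deviation.result (≤-trans k₀≤k k≤i) dev₀ same-below

  mirrored-companion : ∀ {w M} → Matching (_⊑ w) M → Companion (mir w) (mirrored M) → Companion w M
  mirrored-companion {w} {M} μ (companion {j} d c ne) with mirror (proj₁ d)
  ... | j′ , q = companion (mir-Desc⁻ q d)
      (λ {y} le → trans (sym (mir-invol _)) (trans (cong mir (trans (cong (λ z → mir (M z)) (sym (back y)))
         (trans (c (mir-⊑ le)) (cong (λ z → act j (mir (M z))) (mir-invol y)))))
         (trans (mir-act _ q) (cong (act j′) (mir-invol _)))))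
      (λ eq → ne (trans (cong (λ z → mir (M z)) (mir-invol w)) (trans (cong mir eq) (mir-act w (Mir-sym q)))))
    where
    back : ∀ y → mir (act j (mir y)) ≡ act j′ y
    back y = trans (mir-act (mir y) q) (cong (act j′) (mir-invol y))

  act-or-companion : ∀ {w M} → Matching (_⊑ w) M → (∃ λ g → ∀ {u} → u ⊑ w → M u ≡ act g u) ⊎ Companion w M
  act-or-companion {w} {M} μ with Classify.classify μ
  ... | inj₁ q = inj₁ q
  ... | inj₂ (inj₁ x) = inj₂ (exotic-companion μ x)
  ... | inj₂ (inj₂ x) = inj₂ (mirrored-companion μ (exotic-companion (mirrored-matching μ) x))

  -- Hecke operators of matchings.

  module Hecke (ξ : XPar) where

    data Kind : Set where
      isDown isFix isRise : Kind

    val : Kind → V → V → V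
    val isDown a b = b
    val isFix  a b = χ ξ a
    val isRise a b = U a b

    -- Decided by equality and rank instead of a proof of `Local`, so that `A` is defined for every
    -- map; on a matching the three kinds are the three clauses of the recursion.
    kind : X → X → Kind
    kind y u with y ≟X u
    ... | yes _ = isFix
    ... | no _ with rk y <? rk u
    ...   | yes _ = isDown
    ...   | no _  = isRise

    A : (X → X) → (X → V) → X → V
    A M f u = val (kind (M u) u) (f u) (f (M u))

    kind-down : ∀ {y u} → y ⋖ u → kind y u ≡ isDown
    kind-down {y} {u} p with y ≟X u
    ... | yes q = ⊥-elim (¬⋖-≡ p (sym q))
    ... | no _ with rk y <? rk u
    ...   | yes _ = refl
    ...   | no q = ⊥-elim (q (≤-reflexive (sym (proj₂ p))))

    kind-fix : ∀ {y u} → y ≡ u → kind y u ≡ isFix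
    kind-fix {y} {u} p with y ≟X u
    ... | yes _ = refl
    ... | no q = ⊥-elim (q p)

    kind-rise : ∀ {y u} → u ⋖ y → kind y u ≡ isRise
    kind-rise {y} {u} p with y ≟X u
    ... | yes q = ⊥-elim (¬⋖-≡ p q)
    ... | no _ with rk y <? rk u
    ...   | yes q = ⊥-elim (<-asym q (≤-reflexive (sym (proj₂ p))))
    ...   | no _ = refl

    A-down : ∀ {M f u} → M u ⋖ u → A M f u ≡ f (M u)
    A-down {M} {f} {u} p = cong (λ κ → val κ (f u) (f (M u))) (kind-down p)

    A-fix : ∀ {M f u} → M u ≡ u → A M f u ≡ χ ξ (f u)
    A-fix {M} {f} {u} p = cong (λ κ → val κ (f u) (f (M u))) (kind-fix p)

    A-rise : ∀ {M f u} → u ⋖ M u → A M f u ≡ U (f u) (f (M u))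
    A-rise {M} {f} {u} p = cong (λ κ → val κ (f u) (f (M u))) (kind-rise p)

    val-cong : ∀ κ {a a′ b b′} → a ≈ a′ → b ≈ b′ → val κ a b ≈ val κ a′ b′
    val-cong isDown p q = q
    val-cong isFix  p q = χ-cong ξ p
    val-cong isRise p q = U-cong p q

    val-0 : ∀ κ {a b} → a ≈ 0V → b ≈ 0V → val κ a b ≈ 0V
    val-0 isDown p q = q
    val-0 isFix  p q = χ-0 ξ p
    val-0 isRise p q = U-0 p q

    val-χ : ∀ κ a b → val κ (χ ξ a) (χ ξ b) ≈ χ ξ (val κ a b)
    val-χ isDown a b k = refl
    val-χ isFix  a b k = refl
    val-χ isRise a b   = U-χ ξ a b

    val-swap : ∀ κ λ′ a b c d → val κ (val λ′ a b) (val λ′ c d) ≈ val λ′ (val κ a c) (val κ b d)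
    val-swap isDown λ′     a b c d k = refl
    val-swap isFix  isDown a b c d k = refl
    val-swap isFix  isFix  a b c d k = refl
    val-swap isFix  isRise a b c d   = ≈-sym (U-χ ξ a b)
    val-swap isRise isDown a b c d k = refl
    val-swap isRise isFix  a b c d   = U-χ ξ a c
    val-swap isRise isRise a b c d   = UU a b c d

    A-cong : ∀ {I M f g} → Matching I M → (∀ {u} → I u → f u ≈ g u) → ∀ {u} → I u → A M f u ≈ A M g u
    A-cong {M = M} μ h {u} Iu = val-cong (kind (M u) u) (h Iu) (h (closed μ Iu))

    A-χ : ∀ M f u → A M (λ v → χ ξ (f v)) u ≈ χ ξ (A M f u)
    A-χ M f u = val-χ (kind (M u) u) (f u) (f (M u))

    A-≗ : ∀ {M N f u} → M u ≡ N u → A M f u ≡ A N f u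
    A-≗ {f = f} {u} p = cong (λ y → val (kind y u) (f u) (f y)) p

    module _ {I M N} (μ : Matching I M) (ν : Matching I N) (comm : ∀ {u} → I u → M (N u) ≡ N (M u)) where

      private
        Nu≢ : ∀ {u} → I u → M u ≢ u → M (N u) ≢ N u
        Nu≢ Iu ne p = ne (inj ν (closed μ Iu) Iu (trans (sym (comm Iu)) p))

      parallel-down : ∀ {u} → I u → M u ≢ N u → M u ⋖ u → M (N u) ⋖ N u
      parallel-down {u} Iu ne p = pick (local μ (closed ν Iu))
        where
        le : M (N u) ⊑ N u
        le = subst (_⊑ N u) (sym (comm Iu)) (compat ν (closed μ Iu) Iu p λ q → ne (sym (flip ν (closed μ Iu) q)))
        pick : Local M (N u) → M (N u) ⋖ N u
        pick (down q) = q
        pick (fix q)  = ⊥-elim (Nu≢ Iu (λ r → ¬⋖-≡ p (sym r)) q)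
        pick (rise q) = ⊥-elim (¬⋖-≡ q (⊑-antisym le (proj₁ q)))

      parallel-rise : ∀ {u} → I u → M u ≢ N u → u ⋖ M u → N u ⋖ M (N u)
      parallel-rise {u} Iu ne p = pick (local μ (closed ν Iu))
        where
        le : N u ⊑ M (N u)
        le = subst (N u ⊑_) (sym (comm Iu)) (compat ν Iu (closed μ Iu) p λ q → ne (sym q))
        pick : Local M (N u) → N u ⋖ M (N u)
        pick (rise q) = q
        pick (fix q)  = ⊥-elim (Nu≢ Iu (¬⋖-≡ p) q)
        pick (down q) = ⊥-elim (¬⋖-≡ q (⊑-antisym le (proj₁ q)))

      -- `N` carries the `M`-edge at `u` to the `M`-edge at `N u`, and `compat` keeps its direction
      -- as long as the two matchings do not share the edge.
      parallel : ∀ {u} → I u → M u ≢ N u → kind (M (N u)) (N u) ≡ kind (M u) u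
      parallel Iu ne with local μ Iu
      ... | down p = trans (kind-down (parallel-down Iu ne p)) (sym (kind-down p))
      ... | fix p  = trans (kind-fix (trans (comm Iu) (cong N p))) (sym (kind-fix p))
      ... | rise p = trans (kind-rise (parallel-rise Iu ne p)) (sym (kind-rise p))

    -- If `M u ≡ N u`, both operators agree on the common edge. Otherwise the kinds are constant
    -- along the orbit and `val-swap` applies.
    A-comm : ∀ {I M N} → Matching I M → Matching I N → (∀ {u} → I u → M (N u) ≡ N (M u)) →
             ∀ f {u} → I u → A M (A N f) u ≈ A N (A M f) u
    A-comm {I} {M} {N} μ ν comm f {u} Iu with M u ≟X N u
    ... | yes p = ≈-trans (val-cong (kind (M u) u) (≈-reflexive (sym (A-≗ {M} {N} {f} {u} p))) (≈-reflexive (sym (A-≗ {M} {N} {f} {M u} q))))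
                    (≈-reflexive (A-≗ {M} {N} {A M f} {u} p))
      where
      q : M (M u) ≡ N (M u)
      q = trans (invol μ Iu) (sym (flip ν Iu (sym p)))
    ... | no ne = ≈-trans (≈-reflexive (cong (val (kind (M u) u) _) (cong (λ κ → val κ (f (M u)) (f (N (M u)))) (parallel ν μ (λ Iv → sym (comm Iv)) Iu (λ p → ne (sym p))))))
        (≈-trans (val-swap (kind (M u) u) (kind (N u) u) (f u) (f (N u)) (f (M u)) (f (N (M u))))
          (≈-reflexive (cong (val (kind (N u) u) _) (trans (cong (λ y → val (kind (M u) u) (f (N u)) (f y)) (sym (comm Iu)))
            (cong (λ κ → val κ (f (N u)) (f (M (N u)))) (sym (parallel μ ν comm Iu ne)))))))

    private
      module _ (f : X → V) where
        dn-at : ∀ {k u v} → Desc u k → act k u ≡ v → A (act k) f u ≡ f v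
        dn-at {k} {u} d refl = A-down {act k} {f} {u} (Desc-⋖ d)
        up-at : ∀ {k u v} → Desc v k → act k u ≡ v → A (act k) f u ≡ U (f u) (f v)
        up-at {k} {u} d refl = A-rise {act k} {f} {u} (up-⋖ d)
        fx-at : ∀ {k u} → act k u ≡ u → A (act k) f u ≡ χ ξ (f u)
        fx-at {k} {u} = A-fix {act k} {f} {u}

    A³ : ℕ → ℕ → (X → V) → X → V
    A³ s t f = A (act s) (A (act t) (A (act s) f))

    record Hexagon (s t : ℕ) (z : X) : Set where
      field
        top≡ : act s (act t (act s z)) ≡ act t (act s (act t z))
        s₁   : Desc (act s z) s
        t₂   : Desc (act t (act s z)) t
        s₃   : Desc (act s (act t (act s z))) s
        t₁   : Desc (act t z) t
        s₂   : Desc (act s (act t z)) s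
        t₃   : Desc (act t (act s (act t z))) t

    Hexagon-sym : ∀ {s t z} → Hexagon s t z → Hexagon t s z
    Hexagon-sym h = record { top≡ = sym top≡ ; s₁ = t₁ ; t₂ = s₂ ; s₃ = t₃ ; t₁ = s₁ ; s₂ = t₂ ; t₃ = s₃ }
      where open Hexagon h

    module OnHexagon {s t z} (h : Hexagon s t z) (f : X → V) where
      open Hexagon h
      private
        r p T t′ p′ : X
        r  = act s z
        p  = act t r
        T  = act s p
        t′ = act t z
        p′ = act s t′
        tT : act t T ≡ p′
        tT = trans (cong (act t) top≡) (act-invol t _)
        dT : Desc T t
        dT = subst (λ y → Desc y t) (sym top≡) t₃
        As At : (X → V) → X → V
        As = A (act s)
        At = A (act t)

        AtAs-z : At (As f) z ≡ U (U (f z) (f r)) (U (f t′) (f p′))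
        AtAs-z = trans (up-at (As f) t₁ refl) (cong₂ U (up-at f s₁ refl) (up-at f s₂ refl))
        AtAs-r : At (As f) r ≡ U (f z) (U (f p) (f T))
        AtAs-r = trans (up-at (As f) t₂ refl) (cong₂ U (dn-at f s₁ (act-invol s z)) (up-at f s₃ refl))
        AtAs-p : At (As f) p ≡ f z
        AtAs-p = trans (dn-at (As f) t₂ (act-invol t r)) (dn-at f s₁ (act-invol s z))
        AtAs-T : At (As f) T ≡ f t′
        AtAs-T = trans (dn-at (As f) dT tT) (dn-at f s₂ (act-invol s t′))

        AsAt-z : As (At f) z ≡ U (U (f z) (f t′)) (U (f r) (f p))
        AsAt-z = trans (up-at (At f) s₁ refl) (cong₂ U (up-at f t₁ refl) (up-at f t₂ refl))
        AsAt-t : As (At f) t′ ≡ U (f z) (U (f p′) (f T))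
        AsAt-t = trans (up-at (At f) s₂ refl) (cong₂ U (dn-at f t₁ (act-invol t z)) (up-at f (subst (λ y → Desc y t) (sym top≡) t₃) (sym top≡)))
        AsAt-r : As (At f) r ≡ U (f z) (f t′)
        AsAt-r = trans (dn-at (At f) s₁ (act-invol s z)) (up-at f t₁ refl)
        AsAt-p : As (At f) p ≡ U (f r) (f p′)
        AsAt-p = trans (up-at (At f) s₃ refl) (cong₂ U (dn-at f t₂ (act-invol t r)) (dn-at f dT tT))
        AsAt-p′ : As (At f) p′ ≡ f z
        AsAt-p′ = trans (dn-at (At f) s₂ (act-invol s t′)) (dn-at f t₁ (act-invol t z))

      at-bottom : A³ s t f z ≈ A³ t s f z
      at-bottom = ≈-trans (≈-reflexive (trans (up-at (At (As f)) s₁ refl) (cong₂ U AtAs-z AtAs-r)))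
        (≈-trans (hexagon-identity (f z) (f r) (f t′) (f p) (f p′) (f T))
          (≈-reflexive (sym (trans (up-at (As (At f)) t₁ refl) (cong₂ U AsAt-z AsAt-t)))))

      at-one : A³ s t f r ≈ A³ t s f r
      at-one = ≈-trans (≈-reflexive (trans (dn-at (At (As f)) s₁ (act-invol s z)) AtAs-z))
        (≈-trans (UU (f z) (f r) (f t′) (f p′))
          (≈-reflexive (sym (trans (up-at (As (At f)) t₂ refl) (cong₂ U AsAt-r AsAt-p)))))

      at-two : A³ s t f p ≈ A³ t s f p
      at-two = ≈-reflexive (trans (trans (up-at (At (As f)) s₃ refl) (cong₂ U AtAs-p AtAs-T))
        (sym (trans (dn-at (As (At f)) t₂ (act-invol t r)) AsAt-r)))

      at-top : A³ s t f T ≈ A³ t s f T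
      at-top = ≈-reflexive (trans (trans (dn-at (At (As f)) s₃ (act-invol s p)) AtAs-p)
        (sym (trans (dn-at (As (At f)) dT tT) AsAt-p′)))

    record Chain (s t : ℕ) (z : X) : Set where
      field
        s-fix : act s z ≡ z
        t₁    : Desc (act t z) t
        s₂    : Desc (act s (act t z)) s
        t-fix : act t (act s (act t z)) ≡ act s (act t z)

    module OnChain {s t z} (h : Chain s t z) (f : X → V) where
      open Chain h
      private
        y x : X
        y = act t z
        x = act s y
        As At : (X → V) → X → V
        As = A (act s)
        At = A (act t)

      at-top : A³ s t f x ≈ A³ t s f x
      at-top = ≈-reflexive (trans
        (trans (dn-at (At (As f)) s₂ (act-invol s y)) (trans (dn-at (As f) t₁ (act-invol t z)) (fx-at f s-fix)))
        (sym (trans (fx-at (As (At f)) t-fix) (cong (χ ξ) (trans (dn-at (At f) s₂ (act-invol s y)) (dn-at f t₁ (act-invol t z)))))))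

      at-middle : A³ s t f y ≈ A³ t s f y
      at-middle = ≈-trans (≈-reflexive (trans (up-at (At (As f)) s₂ refl) (cong₂ U
            (trans (dn-at (As f) t₁ (act-invol t z)) (fx-at f s-fix))
            (trans (fx-at (As f) t-fix) (cong (χ ξ) (dn-at f s₂ (act-invol s y)))))))
        (≈-trans (U-χ ξ (f z) (f y))
          (≈-reflexive (sym (trans (dn-at (As (At f)) t₁ (act-invol t z)) (trans (fx-at (At f) s-fix) (cong (χ ξ) (up-at f t₁ refl)))))))

      at-bottom : A³ s t f z ≈ A³ t s f z
      at-bottom = ≈-trans (≈-reflexive (trans (fx-at (At (As f)) s-fix) (cong (χ ξ) (trans (up-at (As f) t₁ refl)
            (cong₂ U (fx-at f s-fix) (up-at f s₂ refl))))))
        (≈-trans (chain-identity ξ (f z) (f y) (f x))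
          (≈-reflexive (sym (trans (up-at (As (At f)) t₁ refl) (cong₂ U
            (trans (fx-at (At f) s-fix) (cong (χ ξ) (up-at f t₁ refl)))
            (trans (up-at (At f) s₂ refl) (cong₂ U (dn-at f t₁ (act-invol t z)) (fx-at f t-fix))))))))

    private
      module _ {k z} (uk : Desc (act k z) k) (ut : Desc (act (suc k) z) (suc k)) where
        private
          t = suc k
          Aᶻ B Cᶻ : ℕ
          Aᶻ = F z k
          B = F z t
          Cᶻ = F z (suc t)
          k<m : suc k < m
          k<m = proj₁ uk
          t<m : suc t < m
          t<m = proj₁ ut
          B<A : B < Aᶻ
          B<A = proj₁ (proj₂ (up-inv uk))
          C<B : Cᶻ < B
          C<B = proj₁ (proj₂ (up-inv ut))
          A≢t : Aᶻ ≢ t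
          A≢t = proj₂ (proj₂ (up-inv uk))
          B≢1+t : B ≢ suc t
          B≢1+t = proj₂ (proj₂ (up-inv ut))
          A≢k : Aᶻ ≢ k
          A≢k = F-fpf z (<-trans (n<1+n k) k<m)
          B≢t : B ≢ t
          B≢t = F-fpf z k<m
          B≢k : B ≢ k
          B≢k p = A≢t (F-swap z p)
          A≢1+t : Aᶻ ≢ suc t
          A≢1+t p = B≢t (≤-antisym (s≤s⁻¹ (subst (B <_) p B<A)) (subst (_< B) (F-swap z p) C<B))
          C≢1+t : Cᶻ ≢ suc t
          C≢1+t = F-fpf z t<m
          C≢t : Cᶻ ≢ t
          C≢t p = B≢1+t (F-swap z p)
          C≢k : Cᶻ ≢ k
          C≢k p = A≢1+t (F-swap z p)
          swk : ∀ {a} → a ≢ k → a ≢ t → sw k a ≡ a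
          swk = sw-o k _
          swt : ∀ {a} → a ≢ t → a ≢ suc t → sw t a ≡ a
          swt = sw-o t _
          s-k : F (act k z) k ≡ B
          s-k = trans (F-l z k<m) (swk B≢k B≢t)
          s-t : F (act k z) t ≡ Aᶻ
          s-t = trans (F-r z k<m) (swk A≢k A≢t)
          s-t′ : F (act k z) (suc t) ≡ Cᶻ
          s-t′ = trans (F-o z k<m (λ ()) (λ ())) (swk C≢k C≢t)
          t-k : F (act t z) k ≡ Aᶻ
          t-k = trans (F-o z t<m (λ ()) (λ ())) (swt A≢t A≢1+t)
          t-t : F (act t z) t ≡ Cᶻ
          t-t = trans (F-l z t<m) (swt C≢t C≢1+t)
          t-t′ : F (act t z) (suc t) ≡ B
          t-t′ = trans (F-r z t<m) (swt B≢t B≢1+t)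
          up₂ : ∀ {y h a b} → suc h < m → F y h ≡ a → F y (suc h) ≡ b → b < a → a ≢ suc h → Desc (act h y) h
          up₂ p refl refl lt ne = asc p lt ne

        -- Both generators raise `z`, so `F z` decreases on the three points, and this forces every
        -- partner of the three points to lie outside them. Conjugations then merely permute three
        -- distinct values.
        hexagon : Hexagon k t z
        hexagon = record
          { top≡ = act-braid′ k z t<m
          ; s₁ = uk
          ; t₂ = up₂ t<m s-t s-t′ (<-trans C<B B<A) A≢1+t
          ; s₃ = up₂ k<m (trans (F-o _ t<m (λ ()) (λ ())) (trans (cong (sw t) s-k) (swt B≢t B≢1+t)))
                         (trans (F-l _ t<m) (trans (cong (sw t) s-t′) (swt C≢t C≢1+t))) C<B B≢t
          ; t₁ = ut
          ; s₂ = up₂ k<m t-k t-t (<-trans C<B B<A) A≢t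
          ; t₃ = up₂ t<m (trans (F-r _ k<m) (trans (cong (sw k) t-k) (swk A≢k A≢t)))
                         (trans (F-o _ k<m (λ ()) (λ ())) (trans (cong (sw k) t-t′) (swk B≢k B≢t))) B<A A≢1+t
          }

      chain-t-fix : ∀ {s t z} → Adj s t → suc s < m → suc t < m → act s z ≡ z → act t (act s (act t z)) ≡ act s (act t z)
      chain-t-fix {s} {t} {z} a p q f = trans (sym (act-braid z a p q)) (cong (λ y → act s (act t y)) f)

      chain-low : ∀ {k z} → suc k < m → act k z ≡ z → Desc (act (suc k) z) (suc k) → Chain k (suc k) z
      chain-low {k} {z} p f ut = record { s-fix = f ; t₁ = ut ; t-fix = chain-t-fix (inj₁ refl) p t<m f
          ; s₂ = asc p (subst₂ _<_ (sym at-t) (sym at-k) (<-trans c<k (<-trans (n<1+n k) (n<1+n t)))) (λ q → 1+n≢n (trans (sym at-k) q)) }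
        where
        t = suc k
        t<m : suc t < m
        t<m = proj₁ ut
        fk : F z k ≡ t
        fk = fx-inv p f
        c<k : F z (suc t) < k
        c<k = subst (F z (suc t) <_) (F-swap z fk) (proj₁ (proj₂ (up-inv ut)))
        at-k : F (act t z) k ≡ suc t
        at-k = trans (F-o z t<m (λ ()) (λ ())) (trans (cong (sw t) fk) (sw-l t))
        at-t : F (act t z) t ≡ F z (suc t)
        at-t = trans (F-l z t<m) (sw-low t _ (<-trans c<k (n<1+n k)))

      chain-high : ∀ {k z} → suc (suc k) < m → act (suc k) z ≡ z → Desc (act k z) k → Chain (suc k) k z
      chain-high {k} {z} t<m f uk = record { s-fix = f ; t₁ = uk ; t-fix = chain-t-fix (inj₂ refl) t<m k<m f
          ; s₂ = asc t<m (subst₂ _<_ (sym at-t′) (sym at-t) (<-trans (n<1+n k) (<-trans (n<1+n t) t′<a)))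
                   (λ q → <⇒≢ t′<a (sym (trans (sym at-t) q))) }
        where
        t = suc k
        k<m : suc k < m
        k<m = proj₁ uk
        ft : F z t ≡ suc t
        ft = fx-inv t<m f
        t′<a : suc t < F z k
        t′<a = subst (_< F z k) ft (proj₁ (proj₂ (up-inv uk)))
        at-t : F (act k z) t ≡ F z k
        at-t = trans (F-r z k<m) (sw-high k _ (<-trans (n<1+n t) t′<a))
        at-t′ : F (act k z) (suc t) ≡ k
        at-t′ = trans (F-o z k<m (λ ()) (λ ())) (trans (cong (sw k) (F-swap z ft)) (sw-r k))

    Braids : ℕ → (X → V) → X → Set
    Braids k f u = A³ k (suc k) f u ≈ A³ (suc k) k f u

    -- The braid relation is checked on the orbit of an element z without descents at k and suc k;
    -- such an orbit is a hexagon or a chain of length two.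
    module _ {k} (k<m : suc (suc k) < m) (f : X → V) where
      private
        t : ℕ
        t = suc k

        record Orbit (z : X) : Set where
          field
            b₀ : Braids k f z
            b₁ : Braids k f (act k z)
            b₂ : Braids k f (act t z)
            b₃ : Braids k f (act t (act k z))
            b₄ : Braids k f (act k (act t z))
            b₅ : Braids k f (act k (act t (act k z)))

        at : ∀ {u v} → u ≡ v → Braids k f u → Braids k f v
        at refl b = b

        braid≡ : ∀ z → act k (act t (act k z)) ≡ act t (act k (act t z))
        braid≡ z = act-braid′ k z k<m

        orbit-hexagon : ∀ {z} → Hexagon k t z → Orbit z
        orbit-hexagon h = record
          { b₀ = H.at-bottom ; b₁ = H.at-one ; b₂ = ≈-sym H′.at-one
          ; b₃ = H.at-two ; b₄ = ≈-sym H′.at-two ; b₅ = H.at-top }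
          where
          module H = OnHexagon h f
          module H′ = OnHexagon (Hexagon-sym h) f

        orbit-low : ∀ {z} → Chain k t z → Orbit z
        orbit-low {z} c = record
          { b₀ = C′.at-bottom ; b₁ = at (sym s-fix) C′.at-bottom ; b₂ = C′.at-middle
          ; b₃ = at (cong (act t) (sym s-fix)) C′.at-middle ; b₄ = C′.at-top
          ; b₅ = at (cong (λ y → act k (act t y)) (sym s-fix)) C′.at-top }
          where
          open Chain c
          module C′ = OnChain c f

        orbit-high : ∀ {z} → Chain t k z → Orbit z
        orbit-high {z} c = record
          { b₀ = ≈-sym C′.at-bottom ; b₁ = ≈-sym C′.at-middle ; b₂ = at (sym s-fix) (≈-sym C′.at-bottom)
          ; b₃ = ≈-sym C′.at-top ; b₄ = at (cong (act k) (sym s-fix)) (≈-sym C′.at-middle)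
          ; b₅ = at (sym (trans (braid≡ z) (cong (λ y → act t (act k y)) s-fix))) (≈-sym C′.at-top) }
          where
          open Chain c
          module C′ = OnChain c f

        orbit : ∀ z → ¬ Desc z k → ¬ Desc z t → Orbit z
        orbit z nk nt with stat k z | stat t z
        ... | dn d | _ = ⊥-elim (nk d)
        ... | _ | dn d = ⊥-elim (nt d)
        ... | up a | up b = orbit-hexagon (hexagon a b)
        ... | fx a | up b = orbit-low (chain-low (<-trans (n<1+n _) k<m) a b)
        ... | up a | fx b = orbit-high (chain-high k<m b a)
        ... | fx a | fx b = ⊥-elim (contr (trans (sym (F-swap z (fx-inv (<-trans (n<1+n _) k<m) a))) (fx-inv k<m b)))
          where
          contr : k ≡ suc (suc k) → ⊥
          contr ()

      -- Descend from `u` by `k` and `t` until neither is a descent. Three steps suffice: after a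
      -- fourth, the braid relation would lead back to `u` in two steps, and each step changes the
      -- rank by at most one.
      braid : ∀ u → Braids k f u
      braid u with Desc? u k
      ... | no nk with Desc? u t
      ...   | no nt = Orbit.b₀ (orbit u nk nt)
      ...   | yes d₁ with Desc? (act t u) k
      ...     | no nk₁ = at (act-invol t u) (Orbit.b₂ (orbit (act t u) nk₁ (Desc-irr d₁)))
      ...     | yes d₂ with Desc? (act k (act t u)) t
      ...       | no nt₂ = at (trans (cong (act t) (act-invol k _)) (act-invol t u)) (Orbit.b₃ (orbit _ (Desc-irr d₂) nt₂))
      ...       | yes d₃ = ⊥-elim (nk (braid-Desc (inj₂ refl) d₁ d₂ d₃))
      braid u | yes d₁ with Desc? (act k u) t
      ... | no nt₁ = at (act-invol k u) (Orbit.b₁ (orbit (act k u) (Desc-irr d₁) nt₁))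
      ... | yes d₂ with Desc? (act t (act k u)) k
      ...   | no nk₂ = at (trans (cong (act k) (act-invol t _)) (act-invol k u)) (Orbit.b₄ (orbit _ nk₂ (Desc-irr d₂)))
      ...   | yes d₃ = at back (Orbit.b₅ (orbit z (Desc-irr d₃) nt₃))
        where
        z = act k (act t (act k u))
        back : act k (act t (act k z)) ≡ u
        back = trans (cong (λ y → act k (act t y)) (act-invol k _)) (trans (cong (act k) (act-invol t _)) (act-invol k u))
        nt₃ : ¬ Desc z t
        nt₃ d₄ = <⇒≱ (s≤s (s≤s (s≤s (n≤1+n _)))) (subst (_≤ suc (suc (rk (act t z)))) eq bound)
          where
          eq : rk u ≡ suc (suc (suc (suc (rk (act t z)))))
          eq = trans (Desc-rk d₁) (cong suc (trans (Desc-rk d₂) (cong suc (trans (Desc-rk d₃) (cong suc (Desc-rk d₄))))))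
          step : ∀ i y → rk y ≤ suc (rk (act i y))
          step i y = subst (λ v → rk v ≤ suc (rk (act i y))) (act-invol i y) (rk-act i (act i y))
          bound : rk u ≤ suc (suc (rk (act t z)))
          bound = subst (λ v → rk u ≤ suc (suc (rk v))) (sym (trans (cong (act t) (braid≡ u)) (act-invol t _)))
            (≤-trans (step t u) (s≤s (step k (act t u))))

    -- Invariance of the recursion under the choice of matching.

    -- `ρ w u` stands for the polynomial with indices u, w in this order; with `w` first, `ρ w` is
    -- the function of `u` on which the operators act.
    record Recursive (ρ : X → X → V) : Set where
      field
        vanish   : ∀ {u w} → ¬ (u ⊑ w) → ρ w u ≈ 0V
        choice   : X → X → X
        matching : ∀ {w} → w ≢ ê → Matching (_⊑ w) (choice w)
        special  : ∀ {w} → w ≢ ê → choice w w ⋖ w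
        recur    : ∀ {u w} → w ≢ ê → u ⊑ w → ρ w u ≈ A (choice w) (ρ (choice w w)) u

    module _ {ρ} (rec : Recursive ρ) where
      open Recursive rec

      record Compatible (w : X) (M : X → X) : Set where
        field
          on-down : M w ⋖ w → ∀ {u} → u ⊑ w → ρ w u ≈ A M (ρ (M w)) u
          on-fix  : M w ≡ w → ∀ {u} → u ⊑ w → A M (ρ w) u ≈ χ ξ (ρ w u)

      AllCompatible : X → Set
      AllCompatible w = ∀ {M} → Matching (_⊑ w) M → Compatible w M

      module _ {w v M} (μ : Matching (_⊑ w) M) (all : AllCompatible v) (v⊑w : v ⊑ w) where

        -- For `u` not below `v` both sides vanish, as `M` preserves the elements below `v`. So the
        -- equation at `v` may be substituted inside an operator on all elements below `w`.
        extend-down : M v ⋖ v → ∀ {u} → u ⊑ w → ρ v u ≈ A M (ρ (M v)) u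
        extend-down p {u} u⊑w with u ⊑? v
        ... | yes q = Compatible.on-down (all (restrict μ v⊑w (proj₁ p))) p q
        ... | no q = ≈-trans (vanish q) (≈-sym (val-0 (kind (M u) u) (vanish λ r → q (⊑-trans r (proj₁ p)))
                (vanish λ r → q (subst (_⊑ v) (invol μ u⊑w) (preserves μ v⊑w (proj₁ p) (⊑-trans r (proj₁ p)))))))

        extend-fix : M v ≡ v → ∀ {u} → u ⊑ w → A M (ρ v) u ≈ χ ξ (ρ v u)
        extend-fix p {u} u⊑w with u ⊑? v
        ... | yes q = Compatible.on-fix (all (restrict μ v⊑w (subst (_⊑ v) (sym p) ⊑-refl))) p q
        ... | no q = ≈-trans (val-0 (kind (M u) u) (vanish q) (vanish λ r → q
                (subst (_⊑ v) (invol μ u⊑w) (preserves μ v⊑w (subst (_⊑ v) (sym p) ⊑-refl) r))))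
                (≈-sym (χ-0 ξ (vanish q)))

      module Step (w : X) (IH : ∀ {v} → rk v < rk w → AllCompatible v) where

        below : ∀ {v} → v ⋖ w → AllCompatible v
        below p = IH (≤-reflexive (sym (proj₂ p)))

        below₂ : ∀ {v v′} → v′ ⋖ v → v ⋖ w → AllCompatible v′
        below₂ p q = IH (<-trans (≤-reflexive (sym (proj₂ p))) (≤-reflexive (sym (proj₂ q))))

        Works : (X → X) → Set
        Works M = ∀ {u} → u ⊑ w → ρ w u ≈ A M (ρ (M w)) u

        Fixes : (X → X) → Set
        Fixes M = ∀ {u} → u ⊑ w → A M (ρ w) u ≈ χ ξ (ρ w u)

        module _ {M N} (μ : Matching (_⊑ w) M) (ν : Matching (_⊑ w) N) (comm : ∀ {u} → u ⊑ w → M (N u) ≡ N (M u)) where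

          -- Expand through `M` and then `N`, exchange the two operators, and contract again. Both
          -- uses of the induction hypothesis, at `M w` and at `N w`, need that these elements are
          -- lowered once more, which `M w ≢ N w` guarantees.
          transfer-comm : M w ⋖ w → N w ⋖ w → M w ≢ N w → Works M → Works N
          transfer-comm p q ne h {u} u⊑w =
            ≈-trans (h u⊑w)
            (≈-trans (A-cong μ (λ v⊑w → extend-down ν (below p) (proj₁ p) NMw v⊑w) u⊑w)
            (≈-trans (A-comm μ ν comm (ρ (N (M w))) u⊑w)
            (≈-sym (A-cong ν (λ {v} v⊑w → ≈-trans (extend-down μ (below q) (proj₁ q) MNw v⊑w)
                (≈-reflexive (cong (λ y → A M (ρ y) v) (comm ⊑-refl)))) u⊑w))))
            where
            NMw : N (M w) ⋖ M w
            NMw = parallel-down ν μ (λ l → sym (comm l)) ⊑-refl (λ r → ne (sym r)) q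
            MNw : M (N w) ⋖ N w
            MNw = parallel-down μ ν comm ⊑-refl ne p

          fix-comm : M w ≡ w → N w ⋖ w → Works N → Fixes M
          fix-comm p q h {u} u⊑w =
            ≈-trans (A-cong μ h u⊑w)
            (≈-trans (A-comm μ ν comm (ρ (N w)) u⊑w)
            (≈-trans (A-cong ν (λ v⊑w → extend-fix μ (below q) (proj₁ q) (trans (comm ⊑-refl) (cong N p)) v⊑w) u⊑w)
            (≈-trans (A-χ N (ρ (N w)) u) (χ-cong ξ (≈-sym (h u⊑w))))))

        works-≡ : ∀ {M N} → (∀ {u} → u ⊑ w → M u ≡ N u) → Works M → Works N
        works-≡ {M} {N} h k {u} u⊑w = ≈-trans (k u⊑w) (≈-reflexive (trans (A-≗ {M} {N} {ρ (M w)} {u} (h u⊑w))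
          (cong (λ y → A N (ρ y) u) (h ⊑-refl))))

        ⊑-act : ∀ {k} → Desc w k → Matching (_⊑ w) (act k)
        ⊑-act d = act-matching-below (Desc-⊑ d)

        braid-adj : ∀ {s t} → Adj s t → suc s < m → suc t < m → ∀ f u → A³ s t f u ≈ A³ t s f u
        braid-adj (inj₁ refl) p q f u = braid q f u
        braid-adj (inj₂ refl) p q f u = ≈-sym (braid p f u)

        chain-down : ∀ {s t} (μ : Matching (_⊑ w) (act s)) (ν : Matching (_⊑ w) (act t)) → Works (act s) →
                     (d₁ : Desc w s) (d₂ : Desc (act s w) t) → ∀ {u} → u ⊑ w →
                     ρ w u ≈ A (act s) (A (act t) (ρ (act t (act s w)))) u
        chain-down μ ν h d₁ d₂ u⊑w = ≈-trans (h u⊑w)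
          (A-cong μ (extend-down ν (below (Desc-⋖ d₁)) (Desc-⊑ d₁) (Desc-⋖ d₂)) u⊑w)

        -- The same argument with three operators: both sides expand over the bottom `z` of the
        -- hexagon under `w`, and the braid relation exchanges the expansions.
        transfer-adj : ∀ {s t} → Adj s t → Desc w s → Desc w t → Desc (act s w) t → Desc (act t (act s w)) s →
                       Desc (act t w) s → Desc (act s (act t w)) t → Works (act s) → Works (act t)
        transfer-adj {s} {t} a ds dt d₂ d₃ e₂ e₃ h {u} u⊑w =
          ≈-trans (chain-down μ ν h ds d₂ u⊑w)
          (≈-trans (A-cong μ (λ v⊑w → A-cong ν (extend-down μ (below₂ (Desc-⋖ d₂) (Desc-⋖ ds))
              (⊑-trans (Desc-⊑ d₂) (Desc-⊑ ds)) (Desc-⋖ d₃)) v⊑w) u⊑w)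
          (≈-trans (braid-adj a (proj₁ ds) (proj₁ dt) (ρ z) u)
          (≈-sym (A-cong ν (λ {v} v⊑w → ≈-trans (extend-down μ (below (Desc-⋖ dt)) (Desc-⊑ dt) (Desc-⋖ e₂) v⊑w)
              (A-cong μ (λ {y} y⊑w → ≈-trans (extend-down ν (below₂ (Desc-⋖ e₂) (Desc-⋖ dt))
                (⊑-trans (Desc-⊑ e₂) (Desc-⊑ dt)) (Desc-⋖ e₃) y⊑w)
                (≈-reflexive (cong (λ x → A (act t) (ρ x) y) z≡))) v⊑w)) u⊑w))))
          where
          μ = ⊑-act ds
          ν = ⊑-act dt
          z = act s (act t (act s w))
          z≡ : act t (act s (act t w)) ≡ z
          z≡ = sym (act-braid w a (proj₁ ds) (proj₁ dt))

        -- Two adjacent descents mean that `F w` increases on three consecutive points. The top of a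
        -- chain-like orbit has only one of the two descents, so `w` is the top of a hexagon.
        top-hexagon : ∀ {k} → Desc w k → Desc w (suc k) →
          (Desc (act k w) (suc k) × Desc (act (suc k) (act k w)) k) ×
          (Desc (act (suc k) w) k × Desc (act k (act (suc k) w)) (suc k))
        top-hexagon {k} (k<m , a<b) (t<m , b<c) =
          ((t<m , subst₂ _<_ (sym s-t) (sym s-t′) (sw-mono k (<-trans a<b b<c) λ q _ → F-fpf w k′<m q))
          , (k<m , subst₂ _<_ (sym (trans (F-o _ t<m (λ ()) (λ ())) (cong (sw t) s-k))) (sym (trans (F-l _ t<m) (cong (sw t) s-t′)))
              (sw-mono t (sw-mono k b<c λ q _ → <⇒≱ (subst₂ _<_ (F-swap w q) q a<b) (n≤1+n k))
                λ q _ → b≢k (sw-inj k (trans q (sym (sw-l k)))))))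
          , ((k<m , subst₂ _<_ (sym t-k) (sym t-t) (sw-mono t (<-trans a<b b<c) λ _ q → F-fpf w t<m q))
          , (t<m , subst₂ _<_ (sym (trans (F-r _ k<m) (cong (sw k) t-k))) (sym (trans (F-o _ k<m (λ ()) (λ ())) (cong (sw k) t-t′)))
              (sw-mono k (sw-mono t a<b λ q r → <⇒≱ (subst₂ _<_ r (F-swap w r) b<c) (n≤1+n t))
                λ q _ → a≢k (sw-inj t (trans q (sym (sw-low t k (n<1+n k))))))))
          where
          t = suc k
          k′<m : k < m
          k′<m = <-trans (n<1+n k) k<m
          a≢k : F w k ≢ k
          a≢k = F-fpf w k′<m
          b≢k : F w t ≢ k
          b≢k q = <⇒≱ (subst₂ _<_ (F-swap w q) q a<b) (n≤1+n k)
          s-k : F (act k w) k ≡ sw k (F w t)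
          s-k = F-l w k<m
          s-t : F (act k w) t ≡ sw k (F w k)
          s-t = F-r w k<m
          s-t′ : F (act k w) (suc t) ≡ sw k (F w (suc t))
          s-t′ = F-o w k<m (λ ()) (λ ())
          t-k : F (act t w) k ≡ sw t (F w k)
          t-k = F-o w t<m (λ ()) (λ ())
          t-t : F (act t w) t ≡ sw t (F w (suc t))
          t-t = F-l w t<m
          t-t′ : F (act t w) (suc t) ≡ sw t (F w t)
          t-t′ = F-r w t<m

        transfer : ∀ {s t} → Desc w s → Desc w t → act s w ≢ act t w → Works (act s) → Works (act t)
        transfer {s} {t} ds dt ne h with rel s t
        ... | same refl = ⊥-elim (ne refl)
        ... | far f = transfer-comm (⊑-act ds) (⊑-act dt) (λ {u} _ → act-comm u f) (Desc-⋖ ds) (Desc-⋖ dt) ne h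
        ... | adj (inj₁ refl) = let ((p , q) , (r , v)) = top-hexagon ds dt in transfer-adj (inj₁ refl) ds dt p q r v h
        ... | adj (inj₂ refl) = let ((p , q) , (r , v)) = top-hexagon dt ds in transfer-adj (inj₂ refl) ds dt r v p q h

        -- The recursion is given only for the chosen matching; its companion carries it over to a
        -- conjugation.
        some-act : w ≢ ê → ∃ λ s → Desc w s × Works (act s)
        some-act w≢e with act-or-companion (matching w≢e)
        ... | inj₁ (g , h) = g , rk-<-Desc (≤-reflexive (sym (trans (proj₂ (special w≢e)) (cong (λ y → suc (rk y)) (h ⊑-refl))))) ,
                works-≡ h (recur w≢e)
        ... | inj₂ (companion d c ne) = _ , d ,
                transfer-comm (matching w≢e) (⊑-act d) c (special w≢e) (Desc-⋖ d) ne (recur w≢e)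

        -- `transfer` requires different images. If two descents have the same image `y`, a descent
        -- of `y` serves as a generator to pass through: it is a descent of `w` too, and its image
        -- is not `y`.
        common-image : ∀ {s t} → s ≢ t → Desc w s → Desc w t → act s w ≡ act t w →
                       (∃ λ r → Desc w r × act r w ≢ act s w) ⊎ act s w ≡ ê
        common-image {s} {t} s≢t ds dt eq with y ≟X ê
          where
          y = act s w
        ... | yes q = inj₂ q
        ... | no q with desc q
        ...   | r , dr = inj₁ (r , dw (rel r s) (rel r t) , λ p →
                  Desc-irr (dw (rel r s) (rel r t)) (subst (λ v → Desc v r) (sym p) dr))
          where
          y = act s w
          ns : ¬ Desc y s
          ns = Desc-irr ds
          nt : ¬ Desc y t
          nt d = Desc-irr dt (subst (λ v → Desc v t) eq d)
          sy : act s y ≡ w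
          sy = act-invol s w
          ty : act t y ≡ w
          ty = trans (cong (act t) eq) (act-invol t w)
          -- Equal images make `F y (suc k)` the image of `F y k` under the transposition at
          -- `k + 2`. As it is smaller, the two values are `k + 2` and `k + 3`; then `F y` takes
          -- `k + 2` to `k + 1`, which contradicts the descent at `suc k`.
          between : ∀ {k} → Desc y (suc k) → Desc (act k y) k → act k y ≢ act (suc (suc k)) y
          between {k} (p , lt) dk img = ⊥-elim (cases (F y k ≟ suc (suc (suc k))) (F y k ≟ suc (suc k)))
            where
            t′ = suc (suc k)
            k<m : suc k < m
            k<m = proj₁ dk
            t<m : suc t′ < m
            t<m with suc t′ <? m
            ... | yes z = z
            ... | no z = ⊥-elim (¬⋖-≡ (up-⋖ dk) (trans img (act-out y z)))
            α>β : F y (suc k) < F y k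
            α>β = proj₁ (proj₂ (up-inv dk))
            α≢ : F y k ≢ suc k
            α≢ = proj₂ (proj₂ (up-inv dk))
            β≢k : F y (suc k) ≢ k
            β≢k z = α≢ (F-swap y z)
            β≢ : F y (suc k) ≢ suc k
            β≢ = F-fpf y k<m
            img-k : F y (suc k) ≡ sw t′ (F y k)
            img-k = trans (sym (trans (F-l y k<m) (sw-o k _ β≢k β≢)))
              (trans (cong (λ v → F v k) img) (F-o y t<m (λ ()) (λ ())))
            cases : Dec (F y k ≡ suc t′) → Dec (F y k ≡ t′) → ⊥
            cases (yes a) _ = <-asym lt (subst₂ _<_ (sym γ≡) (sym β≡) (n<1+n (suc k)))
              where
              β≡ : F y (suc k) ≡ t′
              β≡ = trans img-k (trans (cong (sw t′) a) (sw-r t′))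
              γ≡ : F y t′ ≡ suc k
              γ≡ = F-swap y β≡
            cases (no _) (yes a) = <⇒≱ α>β (subst₂ _≤_ (sym a) (sym (trans img-k (trans (cong (sw t′) a) (sw-l t′)))) (n≤1+n t′))
            cases (no a) (no b) = <⇒≢ α>β (trans img-k (sw-o t′ _ b a))
          dw : Rel r s → Rel r t → Desc w r
          dw (far f) _ = subst (λ v → Desc v r) sy (Desc-far f dr ns)
          dw _ (far f) = subst (λ v → Desc v r) ty (Desc-far f dr nt)
          dw (same refl) _ = ⊥-elim (ns dr)
          dw _ (same refl) = ⊥-elim (nt dr)
          dw (adj (inj₁ refl)) (adj (inj₁ refl)) = ⊥-elim (s≢t refl)
          dw (adj (inj₂ refl)) (adj (inj₂ p)) = ⊥-elim (s≢t (suc-injective p))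
          dw (adj (inj₂ refl)) (adj (inj₁ refl)) = ⊥-elim (between dr (subst (λ v → Desc v s) (sym sy) ds) (trans sy (sym ty)))
          dw (adj (inj₁ refl)) (adj (inj₂ refl)) = ⊥-elim (between dr (subst (λ v → Desc v t) (sym ty) dt) (trans ty (sym sy)))

        all-acts : w ≢ ê → ∀ {t} → Desc w t → Works (act t)
        all-acts w≢e {t} dt with some-act w≢e
        ... | s , ds , h with act s w ≟X act t w
        ...   | no ne = transfer ds dt ne h
        ...   | yes eq with s ≟ t
        ...     | yes refl = h
        ...     | no s≢t with common-image s≢t ds dt eq
        ...       | inj₁ (r , dr , ne) = transfer dr dt (λ p → ne (trans p (sym eq))) (transfer ds dr (λ p → ne (sym p)) h)
        -- Now `w` is an atom, and the two conjugations agree on `ê` and `w`, the only elements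
        -- below it.
        ...       | inj₂ q = works-≡ (λ {u} → same-on u) h
          where
          rw : rk w ≡ 1
          rw = trans (Desc-rk ds) (cong suc (trans (cong rk q) rk-e))
          w≡ : ∀ {k} → act k w ≡ ê → w ≡ act k ê
          w≡ {k} p = trans (sym (act-invol k w)) (cong (act k) p)
          same-on : ∀ u → u ⊑ w → act s u ≡ act t u
          same-on u le with u ≟X w
          ... | yes refl = eq
          ... | no ne = subst (λ v → act s v ≡ act t v) (sym (rk0 (n<1⇒n≡0 (subst (rk u <_) rw (≢⇒rk< le ne)))))
                  (trans (sym (w≡ q)) (w≡ (trans (sym eq) q)))

        -- For a descent `s` adjacent to `t`, `ρ w` is obtained from `ρ z` by the operators of `t`
        -- and then `s`, where `z` is fixed by `s`. Applying the operator of `t` once more, the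
        -- braid relation brings the operator of `s` next to `ρ z`, where it becomes a scalar and
        -- moves out.
        all-fixing : ∀ {t} → act t w ≡ w → Fixes (act t)
        all-fixing {t} f {u} u⊑w with w ≟X ê
        ... | yes refl = subst (λ v → A (act t) (ρ ê) v ≈ χ ξ (ρ ê v)) (sym (⊑e u⊑w)) (≈-reflexive (A-fix {act t} {ρ ê} {ê} f))
        ... | no w≢e with desc w≢e
        ...   | s , ds with suc t <? m
        ...     | no out = ≈-reflexive (A-fix {act t} {ρ w} {u} (act-out u out))
        ...     | yes t<m with rel t s
        ...       | same refl = ⊥-elim (Desc-fx ds f)
        ...       | far g = fix-comm (act-matching-below (subst (_⊑ w) (sym f) ⊑-refl)) (⊑-act ds) (λ {u} _ → act-comm u g) f (Desc-⋖ ds) (all-acts w≢e ds) u⊑w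
        ...       | adj a =
            ≈-trans (A-cong μ expand u⊑w)
            (≈-trans (braid-adj a t<m (proj₁ ds) (ρ z) u)
            (≈-trans (A-cong ν (λ v⊑w → A-cong μ (λ y⊑w → extend-fix ν (below₂ (Desc-⋖ d₂) (Desc-⋖ ds)) (⊑-trans (Desc-⊑ d₂) (Desc-⊑ ds)) sz y⊑w) v⊑w) u⊑w)
            (≈-trans (A-cong ν (λ {v} _ → A-χ (act t) (ρ z) v) u⊑w)
            (≈-trans (A-χ (act s) (A (act t) (ρ z)) u) (χ-cong ξ (≈-sym (expand u⊑w)))))))
          where
          μ : Matching (_⊑ w) (act t)
          μ = act-matching-below (subst (_⊑ w) (sym f) ⊑-refl)
          ν = ⊑-act ds
          d₂ : Desc (act s w) t
          d₂ = fixed-desc a t<m f ds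
          z = act t (act s w)
          sz : act s z ≡ z
          sz = trans (sym (act-braid w a t<m (proj₁ ds))) (cong (λ y → act t (act s y)) f)
          expand : ∀ {u} → u ⊑ w → ρ w u ≈ A (act s) (A (act t) (ρ z)) u
          expand = chain-down ν μ (all-acts w≢e ds) ds d₂

        compatible : AllCompatible w
        compatible {M} μ = main (act-or-companion μ)
          where
          main : (∃ λ g → ∀ {u} → u ⊑ w → M u ≡ act g u) ⊎ Companion w M → Compatible w M
          main (inj₁ (g , h)) = record
            { on-down = λ p → works-≡ (λ le → sym (h le)) (all-acts (λ q → contr q p)
                  (rk-<-Desc (≤-reflexive (sym (trans (proj₂ p) (cong (λ y → suc (rk y)) (h ⊑-refl)))))))
            ; on-fix = λ p {u} u⊑w → ≈-trans (≈-reflexive (A-≗ {M} {act g} {ρ w} {u} (h u⊑w))) (all-fixing (trans (sym (h ⊑-refl)) p) u⊑w)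
            }
            where
            contr : w ≡ ê → ¬ (M w ⋖ w)
            contr refl (_ , r) = rk>0 r refl
          main (inj₂ (companion {k} d c ne)) = record
            { on-down = λ p → transfer-comm (⊑-act d) μ (λ le → sym (c le)) (Desc-⋖ d) p (λ q → ne (sym q)) (all-acts w≢e d)
            ; on-fix = λ p → fix-comm μ (⊑-act d) c p (Desc-⋖ d) (all-acts w≢e d)
            }
            where
            w≢e : w ≢ ê
            w≢e refl = Desc-e k d

      all-compatible : ∀ w → AllCompatible w
      all-compatible w = go (suc (rk w)) w (n<1+n _)
        where
        go : ∀ n w → rk w < n → AllCompatible w
        go (suc n) w b = Step.compatible w λ {v} l → go n v (<-≤-trans l (s≤s⁻¹ b))

-- Words, transpositions and inversions.

word-ext : ∀ {m} {u w : Word m} → (∀ a → lookup u a ≡ lookup w a) → u ≡ w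
word-ext {u = u} {w} h = trans (sym (tabulate∘lookup u)) (trans (tabulate-cong h) (tabulate∘lookup w))

swapF-l : ∀ {m} (i j : Fin m) → swapF i j i ≡ j
swapF-l i j with i F.≟ i
... | yes _ = refl
... | no p = ⊥-elim (p refl)

swapF-r : ∀ {m} (i j : Fin m) → swapF i j j ≡ i
swapF-r i j with j F.≟ i
... | yes p = p
... | no _ with j F.≟ j
...   | yes _ = refl
...   | no q = ⊥-elim (q refl)

swapF-o : ∀ {m} (i j k : Fin m) → k ≢ i → k ≢ j → swapF i j k ≡ k
swapF-o i j k p q with k F.≟ i
... | yes r = ⊥-elim (p r)
... | no _ with k F.≟ j
...   | yes r = ⊥-elim (q r)
...   | no _ = refl

data Cases {m} (i j k : Fin m) : Set where
  is-l : k ≡ i → Cases i j k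
  is-r : k ≡ j → Cases i j k
  is-o : k ≢ i → k ≢ j → Cases i j k

cases : ∀ {m} (i j k : Fin m) → Cases i j k
cases i j k with k F.≟ i | k F.≟ j
... | yes p | _ = is-l p
... | _ | yes q = is-r q
... | no p | no q = is-o p q

swapF-invol : ∀ {m} (i j k : Fin m) → swapF i j (swapF i j k) ≡ k
swapF-invol i j k with cases i j k
... | is-l refl = trans (cong (swapF k j) (swapF-l k j)) (swapF-r k j)
... | is-r refl = trans (cong (swapF i k) (swapF-r i k)) (swapF-l i k)
... | is-o p q = trans (cong (swapF i j) (swapF-o i j k p q)) (swapF-o i j k p q)

swapF-inj : ∀ {m} (i j : Fin m) {a b} → swapF i j a ≡ swapF i j b → a ≡ b
swapF-inj i j {a} {b} p = trans (sym (swapF-invol i j a)) (trans (cong (swapF i j) p) (swapF-invol i j b))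

swapF-conj : ∀ {m} (f : Fin m → Fin m) → (∀ {a b} → f a ≡ f b → a ≡ b) → ∀ i j k →
             f (swapF i j k) ≡ swapF (f i) (f j) (f k)
swapF-conj f inj i j k with cases i j k
... | is-l refl = trans (cong f (swapF-l k j)) (sym (swapF-l (f k) (f j)))
... | is-r refl = trans (cong f (swapF-r i k)) (sym (swapF-r (f i) (f k)))
... | is-o p q = trans (cong f (swapF-o i j k p q)) (sym (swapF-o (f i) (f j) (f k) (λ r → p (inj r)) (λ r → q (inj r))))

toℕ-swapF : ∀ {m} {i j : Fin m} → toℕ j ≡ suc (toℕ i) → ∀ k → toℕ (swapF i j k) ≡ sw (toℕ i) (toℕ k)
toℕ-swapF {i = i} {j} e k with cases i j k
... | is-l refl = trans (cong toℕ (swapF-l k j)) (trans e (sym (sw-l (toℕ k))))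
... | is-r refl = trans (cong toℕ (swapF-r i k)) (sym (trans (cong (sw (toℕ i)) e) (sw-r (toℕ i))))
... | is-o p q = trans (cong toℕ (swapF-o i j k p q)) (sym (sw-o (toℕ i) (toℕ k) (λ r → p (toℕ-injective r))
    (λ r → q (toℕ-injective (trans r (sym e))))))

private
  T : ∀ {m} → Fin m → Fin m → Fin m → Fin m → ℕ
  T a b x y = if ⌊ a F.<? b ⌋ ∧ ⌊ y F.<? x ⌋ then 1 else 0

  yes≡ : ∀ {m} {a b : Fin m} → a F.< b → ⌊ a F.<? b ⌋ ≡ true
  yes≡ {a = a} {b} p with a F.<? b
  ... | yes _ = refl
  ... | no q = ⊥-elim (q p)

  no≡ : ∀ {m} {a b : Fin m} → ¬ (a F.< b) → ⌊ a F.<? b ⌋ ≡ false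
  no≡ {a = a} {b} p with a F.<? b
  ... | yes q = ⊥-elim (p q)
  ... | no _ = refl

  iff≡ : ∀ {m} {a b c d : Fin m} → (a F.< b → c F.< d) → (c F.< d → a F.< b) → ⌊ a F.<? b ⌋ ≡ ⌊ c F.<? d ⌋
  iff≡ {a = a} {b} f g with a F.<? b
  ... | yes p = sym (yes≡ (f p))
  ... | no p = sym (no≡ (λ q → p (g q)))

  T₁ : ∀ {m} {a b x y : Fin m} → a F.< b → y F.< x → T a b x y ≡ 1
  T₁ p q rewrite yes≡ p | yes≡ q = refl

  T₀ : ∀ {m} {a b x y : Fin m} → ¬ (a F.< b) → T a b x y ≡ 0
  T₀ p rewrite no≡ p = refl

  T₀′ : ∀ {m} {a b x y : Fin m} → ¬ (y F.< x) → T a b x y ≡ 0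
  T₀′ {a = a} {b} p rewrite no≡ p with ⌊ a F.<? b ⌋
  ... | true = refl
  ... | false = refl

  inv : ∀ {m} → (Fin m → Fin m) → ℕ
  inv f = sum λ a → sum λ b → T a b (f a) (f b)

  sum-tabulate : ∀ {m} (f : Fin m → ℕ) → sumᴸ (List.tabulate f) ≡ sum f
  sum-tabulate {zero} f = refl
  sum-tabulate {suc m} f = cong (f F.zero +_) (sum-tabulate (λ i → f (F.suc i)))

  sum-concat : ∀ {A B : Set} (f : B → ℕ) (g : A → List B) xs →
               sumᴸ (map f (concatMap g xs)) ≡ sumᴸ (map (λ x → sumᴸ (map f (g x))) xs)
  sum-concat f g [] = refl
  sum-concat f g (x ∷ xs) = trans (cong sumᴸ (map-++ f (g x) (concatMap g xs)))
    (trans (sum-++ (map f (g x)) _) (cong (sumᴸ (map f (g x)) +_) (sum-concat f g xs)))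

  sum-point : ∀ {m} {f g : Fin m → ℕ} p → (∀ i → i ≢ p → f i ≡ g i) → f p ≡ suc (g p) → sum f ≡ suc (sum g)
  sum-point F.zero h e = cong₂ _+_ e (sum-cong-≗ (λ i → h (F.suc i) (λ ())))
  sum-point {f = f} {g} (F.suc p) h e = trans (cong₂ _+_ (h F.zero (λ ()))
    (sum-point {g = λ i → g (F.suc i)} p (λ i q → h (F.suc i) (λ { refl → q refl })) e)) (+-suc (g F.zero) _)

  sum-point₂ : ∀ {m} {f g : Fin m → Fin m → ℕ} p q → (∀ a b → a ≢ p ⊎ b ≢ q → f a b ≡ g a b) →
               f p q ≡ suc (g p q) → sum (λ a → sum (f a)) ≡ suc (sum (λ a → sum (g a)))
  sum-point₂ p q h e = sum-point p (λ a r → sum-cong-≗ (λ b → h a b (inj₁ r)))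
    (sum-point q (λ b r → h p b (inj₂ r)) e)

  sum-pairs : ∀ {m} (g : Fin m × Fin m → ℕ) → sumᴸ (map g (allPairs m)) ≡ sum λ a → sum λ b → g (a , b)
  sum-pairs {m} g = trans (sum-concat g row (allFin m))
      (trans (cong sumᴸ (map-tabulate (λ i → i) (λ a → sumᴸ (map g (row a)))))
        (trans (sum-tabulate (λ a → sumᴸ (map g (row a)))) (sum-cong-≗ row-sum)))
    where
    row : Fin m → List (Fin m × Fin m)
    row a = map (λ b → (a , b)) (allFin m)
    row-sum : ∀ a → sumᴸ (map g (row a)) ≡ sum λ b → g (a , b)
    row-sum a = trans (cong sumᴸ (sym (map-∘ {g = g} {f = λ b → (a , b)} (allFin m))))
      (trans (cong sumᴸ (map-tabulate (λ i → i) (λ b → g (a , b)))) (sum-tabulate (λ b → g (a , b))))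

  len-inv : ∀ {m} (w : Word m) → len w ≡ inv (lookup w)
  len-inv {m} w = sum-pairs (λ p → T (proj₁ p) (proj₂ p) (lookup w (proj₁ p)) (lookup w (proj₂ p)))

  inv-cong : ∀ {m} {f g : Fin m → Fin m} → (∀ a → f a ≡ g a) → inv f ≡ inv g
  inv-cong h = sum-cong-≗ λ a → sum-cong-≗ λ b → cong₂ (T a b) (h a) (h b)

  module _ {m} {i j : Fin m} (e : toℕ j ≡ suc (toℕ i)) where
    private
      σ = swapF i j

      i<j : i F.< j
      i<j = ≤-reflexive (sym e)

      σ-mono : ∀ {a b} → a F.< b → (a ≡ i → b ≢ j) → σ a F.< σ b
      σ-mono {a} {b} p h = subst₂ _<_ (sym (toℕ-swapF e a)) (sym (toℕ-swapF e b))
        (sw-mono (toℕ i) p λ q r → h (toℕ-injective q) (toℕ-injective (trans r (sym e))))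

      σ-mono⁻ : ∀ {a b} → σ a F.< σ b → (a ≡ j → b ≢ i) → a F.< b
      σ-mono⁻ {a} {b} p h = subst₂ F._<_ (swapF-invol i j a) (swapF-invol i j b)
        (σ-mono p λ q r → h (swapF-inj i j (trans q (sym (swapF-r i j)))) (swapF-inj i j (trans r (sym (swapF-l i j)))))

      π : Permutation m m
      π = permutation σ σ (swapF-invol i j) (swapF-invol i j)

    -- After reindexing by `σ` only the pair `(j , i)` counts differently; at `(i , j)` both terms
    -- vanish because `f i` is below `f j`.
    inv-swap : ∀ {f : Fin m → Fin m} → f i F.< f j → inv (λ a → f (σ a)) ≡ suc (inv f)
    inv-swap {f} lt = trans reindex (sum-point₂ j i agrees (trans at-ji (cong suc (sym at-ji′))))
      where
      reindex : inv (λ a → f (σ a)) ≡ sum (λ a → sum (λ b → T (σ a) (σ b) (f a) (f b)))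
      reindex = trans (sum-permute _ π) (sum-cong-≗ λ a → trans (sum-permute _ π) (sum-cong-≗ λ b →
        cong₂ (λ x y → T (σ a) (σ b) (f x) (f y)) (swapF-invol i j a) (swapF-invol i j b)))
      at-ji : T (σ j) (σ i) (f j) (f i) ≡ 1
      at-ji = T₁ (subst₂ F._<_ (sym (swapF-r i j)) (sym (swapF-l i j)) i<j) lt
      at-ji′ : T j i (f j) (f i) ≡ 0
      at-ji′ = T₀ (<-asym i<j)
      agrees : ∀ a b → a ≢ j ⊎ b ≢ i → T (σ a) (σ b) (f a) (f b) ≡ T a b (f a) (f b)
      agrees a b h = by (a F.≟ i) (b F.≟ j)
        where
        by : Dec (a ≡ i) → Dec (b ≡ j) → T (σ a) (σ b) (f a) (f b) ≡ T a b (f a) (f b)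
        by (yes refl) (yes refl) = trans (T₀′ (<-asym lt)) (sym (T₀′ (<-asym lt)))
        by (no p) _ = cong (λ z → if z ∧ ⌊ f b F.<? f a ⌋ then 1 else 0)
            (iff≡ (λ q → σ-mono⁻ q (λ r s → [ (λ n → n r) , (λ n → n s) ]′ h)) (λ q → σ-mono q (λ r → ⊥-elim (p r))))
        by _ (no p) = cong (λ z → if z ∧ ⌊ f b F.<? f a ⌋ then 1 else 0)
            (iff≡ (λ q → σ-mono⁻ q (λ r s → [ (λ n → n r) , (λ n → n s) ]′ h)) (λ q → σ-mono q (λ _ → p)))

    inv-values : ∀ {f : Fin m → Fin m} → (∀ {a b} → f a ≡ f b → a ≡ b) → ∀ {p q} → f p ≡ i → f q ≡ j → p F.< q →
                 inv (λ a → σ (f a)) ≡ suc (inv f)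
    inv-values {f} inj {p} {q} fp fq p<q = sum-point₂ p q agrees (trans at-pq (cong suc (sym at-pq′)))
      where
      at-pq : T p q (σ (f p)) (σ (f q)) ≡ 1
      at-pq = T₁ p<q (subst₂ F._<_ (sym (trans (cong σ fq) (swapF-r i j))) (sym (trans (cong σ fp) (swapF-l i j))) i<j)
      at-pq′ : T p q (f p) (f q) ≡ 0
      at-pq′ = T₀′ (λ lt → <-asym i<j (subst₂ F._<_ fq fp lt))
      agrees : ∀ a b → a ≢ p ⊎ b ≢ q → T a b (σ (f a)) (σ (f b)) ≡ T a b (f a) (f b)
      agrees a b h = by (f a F.≟ i) (f b F.≟ j)
        where
        by : Dec (f a ≡ i) → Dec (f b ≡ j) → T a b (σ (f a)) (σ (f b)) ≡ T a b (f a) (f b)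
        by (yes r) (yes s) = ⊥-elim ([ (λ n → n (inj (trans r (sym fp)))) , (λ n → n (inj (trans s (sym fq)))) ]′ h)
        by (no r) _ = by′ (f a F.≟ j) (f b F.≟ i)
          where
          by′ : Dec (f a ≡ j) → Dec (f b ≡ i) → T a b (σ (f a)) (σ (f b)) ≡ T a b (f a) (f b)
          by′ (yes s) (yes t) = trans (T₀ no-ab) (sym (T₀ no-ab))
            where
            no-ab : ¬ (a F.< b)
            no-ab lt = <-asym p<q (subst₂ F._<_ (inj (trans s (sym fq))) (inj (trans t (sym fp))) lt)
          by′ (no s) _ = cong (λ z → if ⌊ a F.<? b ⌋ ∧ z then 1 else 0)
            (iff≡ (λ lt → σ-mono⁻ lt (λ _ → r)) (λ lt → σ-mono lt (λ _ → s)))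
          by′ _ (no s) = cong (λ z → if ⌊ a F.<? b ⌋ ∧ z then 1 else 0)
            (iff≡ (λ lt → σ-mono⁻ lt (λ _ → r)) (λ lt → σ-mono lt (λ t → ⊥-elim (s t))))
        by _ (no r) = by′ (f a F.≟ j) (f b F.≟ i)
          where
          by′ : Dec (f a ≡ j) → Dec (f b ≡ i) → T a b (σ (f a)) (σ (f b)) ≡ T a b (f a) (f b)
          by′ (yes s) (yes t) = trans (T₀ no-ab) (sym (T₀ no-ab))
            where
            no-ab : ¬ (a F.< b)
            no-ab lt = <-asym p<q (subst₂ F._<_ (inj (trans s (sym fq))) (inj (trans t (sym fp))) lt)
          by′ (no s) _ = cong (λ z → if ⌊ a F.<? b ⌋ ∧ z then 1 else 0)
            (iff≡ (λ lt → σ-mono⁻ lt (λ t → ⊥-elim (r t))) (λ lt → σ-mono lt (λ _ → s)))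
          by′ _ (no s) = cong (λ z → if ⌊ a F.<? b ⌋ ∧ z then 1 else 0)
            (iff≡ (λ lt → σ-mono⁻ lt (λ t → ⊥-elim (r t))) (λ lt → σ-mono lt (λ t → ⊥-elim (s t))))

len-id : ∀ m → len (idW m) ≡ 0
len-id m = trans (len-inv (idW m)) (trans (inv-cong {f = lookup (idW m)} {λ a → a} (λ a → lookup∘tabulate (λ k → k) a)) (sum-0 λ a → sum-0 λ b → diagonal a b))
  where
  sum-0 : ∀ {l} {f : Fin l → ℕ} → (∀ a → f a ≡ 0) → sum f ≡ 0
  sum-0 {zero} h = refl
  sum-0 {suc l} h = cong₂ _+_ (h F.zero) (sum-0 (λ a → h (F.suc a)))
  diagonal : ∀ (a b : Fin m) → T a b a b ≡ 0
  diagonal a b with <-cmp (toℕ a) (toℕ b)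
  ... | tri< p _ _ = T₀′ (<-asym p)
  ... | tri≈ p _ _ = T₀ p
  ... | tri> p _ _ = T₀ p

lookup-· : ∀ {m} (w : Word m) i j a → lookup (w ·⟨ i , j ⟩) a ≡ lookup w (swapF i j a)
lookup-· w i j a = lookup∘tabulate _ a

valswap : ∀ {m} → Fin m → Fin m → Word m → Word m
valswap i j w = tabulate (λ a → swapF i j (lookup w a))

lookup-valswap : ∀ {m} (i j : Fin m) w a → lookup (valswap i j w) a ≡ swapF i j (lookup w a)
lookup-valswap i j w a = lookup∘tabulate _ a

Inj : ∀ {m} → Word m → Set
Inj w = ∀ {a b} → lookup w a ≡ lookup w b → a ≡ b

Inj-· : ∀ {m} {w : Word m} i j → Inj w → Inj (w ·⟨ i , j ⟩)
Inj-· {w = w} i j inj {a} {b} p = swapF-inj i j (inj (trans (sym (lookup-· w i j a)) (trans p (lookup-· w i j b))))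

·-invol : ∀ {m} (w : Word m) i j → (w ·⟨ i , j ⟩) ·⟨ i , j ⟩ ≡ w
·-invol w i j = word-ext λ a → trans (lookup-· (w ·⟨ i , j ⟩) i j a) (trans (lookup-· w i j _) (cong (lookup w) (swapF-invol i j a)))

valswap-invol : ∀ {m} (i j : Fin m) w → valswap i j (valswap i j w) ≡ w
valswap-invol i j w = word-ext λ a → trans (lookup-valswap i j (valswap i j w) a)
  (trans (cong (swapF i j) (lookup-valswap i j w a)) (swapF-invol i j (lookup w a)))

len-· : ∀ {m} {w : Word m} {i j} → toℕ j ≡ suc (toℕ i) → lookup w i F.< lookup w j → len (w ·⟨ i , j ⟩) ≡ suc (len w)
len-· {w = w} {i} {j} e lt = trans (len-inv (w ·⟨ i , j ⟩)) (trans (inv-cong (lookup-· w i j)) (trans (inv-swap e {lookup w} lt) (cong suc (sym (len-inv w)))))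

len-valswap : ∀ {m} {w : Word m} {i j p q} → toℕ j ≡ suc (toℕ i) → Inj w → lookup w p ≡ i → lookup w q ≡ j → p F.< q →
              len (valswap i j w) ≡ suc (len w)
len-valswap {w = w} {i} {j} e inj wp wq lt = trans (len-inv (valswap i j w)) (trans (inv-cong (lookup-valswap i j w))
  (trans (inv-values e {lookup w} inj wp wq lt) (cong suc (sym (len-inv w)))))

-- Induction on the distance through (i j) = (i i′)(i′ j)(i i′) with `i′` next to `i`. If the first
-- factor adds one to the length, the last loses at most one; if the first loses one, the last adds
-- one.
len-·-grows : ∀ {m} {w : Word m} {i j} → Inj w → i F.< j → lookup w i F.< lookup w j → len w < len (w ·⟨ i , j ⟩)
len-·-grows {m} {w} {i} {j} inj i<j lt with m≤n⇒∃[o]m+o≡n i<j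
... | d , e = go d w i j inj (trans (sym e) (cong suc (+-comm (toℕ i) d))) lt
  where
  go : ∀ d (w : Word m) i j → Inj w → toℕ j ≡ suc (d + toℕ i) → lookup w i F.< lookup w j → len w < len (w ·⟨ i , j ⟩)
  go zero w i j inj e lt = ≤-reflexive (sym (len-· {w = w} e lt))
  go (suc d) w i j inj e lt = main
    where
    1+i<m : suc (toℕ i) < m
    1+i<m = ≤-trans (s≤s (s≤s (m≤n+m (toℕ i) d))) (≤-trans (≤-reflexive (sym e)) (<⇒≤ (toℕ<n j)))
    i′ : Fin m
    i′ = fromℕ< 1+i<m
    i′≡ : toℕ i′ ≡ suc (toℕ i)
    i′≡ = toℕ-fromℕ< 1+i<m
    i≢i′ : i ≢ i′
    i≢i′ p = 1+n≢n (sym (trans (cong toℕ p) i′≡))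
    j≢i : j ≢ i
    j≢i p = m≢1+n+m (toℕ i) {suc d} (trans (sym (cong toℕ p)) e)
    j≢i′ : j ≢ i′
    j≢i′ p = m≢1+n+m (toℕ i) {d} (suc-injective (trans (sym i′≡) (trans (sym (cong toℕ p)) e)))
    w₁ w₂ w₃ : Word m
    w₁ = w ·⟨ i , i′ ⟩
    w₂ = w₁ ·⟨ i′ , j ⟩
    w₃ = w₂ ·⟨ i , i′ ⟩
    w₃≡ : w₃ ≡ w ·⟨ i , j ⟩
    w₃≡ = word-ext λ a → trans (lookup-· w₂ i i′ a) (trans (lookup-· w₁ i′ j (swapF i i′ a)) (trans (lookup-· w i i′ (swapF i′ j (swapF i i′ a)))
      (trans (cong (lookup w) (trans (swapF-conj (swapF i i′) (swapF-inj i i′) i′ j (swapF i i′ a))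
        (trans (cong₂ (λ x y → swapF x y (swapF i i′ (swapF i i′ a))) (swapF-r i i′) (swapF-o i i′ j j≢i j≢i′))
          (cong (swapF i j) (swapF-invol i i′ a))))) (sym (lookup-· w i j a)))))
    w₁-i′ : lookup w₁ i′ ≡ lookup w i
    w₁-i′ = trans (lookup-· w i i′ i′) (cong (lookup w) (swapF-r i i′))
    w₁-j : lookup w₁ j ≡ lookup w j
    w₁-j = trans (lookup-· w i i′ j) (cong (lookup w) (swapF-o i i′ j j≢i j≢i′))
    w₂-i : lookup w₂ i ≡ lookup w i′
    w₂-i = trans (lookup-· w₁ i′ j i) (trans (cong (lookup w₁) (swapF-o i′ j i i≢i′ (λ p → j≢i (sym p))))
      (trans (lookup-· w i i′ i) (cong (lookup w) (swapF-l i i′))))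
    w₂-i′ : lookup w₂ i′ ≡ lookup w j
    w₂-i′ = trans (lookup-· w₁ i′ j i′) (trans (cong (lookup w₁) (swapF-l i′ j)) w₁-j)
    inner : len w₁ < len w₂
    inner = go d w₁ i′ j (Inj-· {w = w} i i′ inj) (trans e (cong suc (trans (sym (+-suc d _)) (cong (d +_) (sym i′≡)))))
      (subst₂ F._<_ (sym w₁-i′) (sym w₁-j) lt)
    len₂≤ : len w₂ ≤ suc (len w₃)
    len₂≤ with <-cmp (toℕ (lookup w₂ i)) (toℕ (lookup w₂ i′))
    ... | tri< p _ _ = ≤-trans (n≤1+n _) (≤-trans (≤-reflexive (sym (len-· {w = w₂} i′≡ p))) (n≤1+n _))
    ... | tri≈ _ p _ = ⊥-elim (j≢i′ (sym (inj (toℕ-injective (trans (cong toℕ (sym w₂-i)) (trans p (cong toℕ w₂-i′)))))))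
    ... | tri> _ _ p = ≤-reflexive (trans (cong len (sym (·-invol w₂ i i′))) (len-· {w = w₃} i′≡
        (subst₂ F._<_ (sym (trans (lookup-· w₂ i i′ i) (cong (lookup w₂) (swapF-l i i′))))
                      (sym (trans (lookup-· w₂ i i′ i′) (cong (lookup w₂) (swapF-r i i′)))) p)))
    main : len w < len (w ·⟨ i , j ⟩)
    main with <-cmp (toℕ (lookup w i)) (toℕ (lookup w i′))
    ... | tri< p _ _ = s≤s⁻¹ (≤-trans (s≤s (≤-reflexive (sym (len-· {w = w} i′≡ p)))) (≤-trans inner
          (≤-trans len₂≤ (≤-reflexive (cong (λ v → suc (len v)) w₃≡)))))
    ... | tri≈ _ p _ = ⊥-elim (i≢i′ (inj (toℕ-injective p)))
    ... | tri> _ _ p = ≤-trans (≤-reflexive (cong suc lenw)) (≤-trans (s≤s inner)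
          (≤-reflexive (trans (sym (len-· {w = w₂} i′≡ (subst₂ F._<_ (sym w₂-i) (sym w₂-i′) (<-trans p lt)))) (cong len w₃≡))))
      where
      lenw : len w ≡ suc (len w₁)
      lenw = trans (cong len (sym (·-invol w i i′))) (len-· {w = w₁} i′≡
        (subst₂ F._<_ (sym (trans (lookup-· w i i′ i) (cong (lookup w) (swapF-l i i′)))) (sym w₁-i′) p))

·-undo : ∀ {m} {u w : Word m} {i j} → u ≡ w ·⟨ i , j ⟩ → w ≡ u ·⟨ i , j ⟩
·-undo {w = w} {i} {j} refl = sym (·-invol w i j)

step : ∀ {m} {w : Word m} {i j} → Inj w → i F.< j → lookup w j F.< lookup w i → BruhatStep (w ·⟨ i , j ⟩) w
step {w = w} {i} {j} inj i<j lt = i , j , i<j , refl ,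
  subst (λ v → len (w ·⟨ i , j ⟩) < len v) (·-invol w i j)
    (len-·-grows {w = w ·⟨ i , j ⟩} (Inj-· {w = w} i j inj) i<j
      (subst₂ F._<_ (sym (trans (lookup-· w i j i) (cong (lookup w) (swapF-l i j))))
                    (sym (trans (lookup-· w i j j) (cong (lookup w) (swapF-r i j)))) lt))

step-inv : ∀ {m} {u w : Word m} → Inj w → BruhatStep u w →
           ∃₂ λ i j → i F.< j × lookup w j F.< lookup w i × u ≡ w ·⟨ i , j ⟩
step-inv {w = w} inj (i , j , i<j , refl , lt) with <-cmp (toℕ (lookup w i)) (toℕ (lookup w j))
... | tri< p _ _ = ⊥-elim (<-asym lt (len-·-grows {w = w} inj i<j p))
... | tri≈ _ p _ = ⊥-elim (<⇒≢ i<j (cong toℕ (inj (toℕ-injective p))))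
... | tri> _ _ p = i , j , i<j , p , refl

step-Inj : ∀ {m} {u w : Word m} → Inj u → BruhatStep u w → Inj w
step-Inj {u = u} {w} inj (i , j , _ , eq , _) {a} {b} p =
  Inj-· {w = u} i j inj {a} {b} (subst (λ v → lookup v a ≡ lookup v b) (·-undo {u = u} {w} eq) p)

-- The lifting property in the symmetric group.

-- Common form of left and right multiplication by a simple transposition: a Bruhat step is carried
-- to a Bruhat step unless it is the step made by `g` itself. Along a chain of steps this gives both
-- bounds, with no hypothesis on descents.
record Reflects {m} (g : Word m → Word m) : Set where
  field
    g-invol : ∀ w → g (g w) ≡ w
    g-step  : ∀ {u w} → Inj w → BruhatStep u w → g u ≡ w ⊎ BruhatStep (g u) (g w)

  max-bound : ∀ {u w} → Inj u → u ≤B w → g u ≤B g w ⊎ g u ≤B w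
  max-bound inj ε = inj₁ ε
  max-bound {u} {w} inj (_◅_ {j = v} s r) with step-Inj {u = u} {v} inj s
  ... | inj′ with g-step {u} {v} inj′ s | max-bound {v} inj′ r
  ...   | inj₁ p | _      = inj₂ (subst (_≤B w) (sym p) r)
  ...   | inj₂ t | inj₁ q = inj₁ (t ◅ q)
  ...   | inj₂ t | inj₂ q = inj₂ (t ◅ q)

  min-bound : ∀ {u w} → Inj u → u ≤B w → g u ≤B g w ⊎ u ≤B g w
  min-bound inj ε = inj₁ ε
  min-bound {u} {w} inj (_◅_ {j = v} s r) with step-Inj {u = u} {v} inj s
  ... | inj′ with g-step {u} {v} inj′ s | min-bound {v} inj′ r
  ...   | _      | inj₂ q = inj₂ (s ◅ q)
  ...   | inj₁ p | inj₁ q = inj₂ (subst (_≤B g w) (trans (cong g (sym p)) (g-invol u)) q)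
  ...   | inj₂ t | inj₁ q = inj₁ (t ◅ q)

module Adjacent {m} {i j : Fin m} (e : toℕ j ≡ suc (toℕ i)) where

  i<j : i F.< j
  i<j = ≤-reflexive (sym e)

  swap-mono : ∀ {a b} → a F.< b → (a ≡ i → b ≢ j) → swapF i j a F.< swapF i j b
  swap-mono {a} {b} p h = subst₂ _<_ (sym (toℕ-swapF e a)) (sym (toℕ-swapF e b))
    (sw-mono (toℕ i) p λ q r → h (toℕ-injective q) (toℕ-injective (trans r (sym e))))

  positions : Reflects (_·⟨ i , j ⟩)
  positions = record { g-invol = λ w → ·-invol w i j ; g-step = g-step }
    where
    g-step : ∀ {u w} → Inj w → BruhatStep u w → u ·⟨ i , j ⟩ ≡ w ⊎ BruhatStep (u ·⟨ i , j ⟩) (w ·⟨ i , j ⟩)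
    g-step {u} {w} inj s with step-inv {u = u} {w} inj s
    ... | a , b , a<b , lt , eq = by (a F.≟ i) (b F.≟ j)
      where
      moved : (a ≡ i → b ≢ j) → BruhatStep (u ·⟨ i , j ⟩) (w ·⟨ i , j ⟩)
      moved h = subst (λ v → BruhatStep v (w ·⟨ i , j ⟩)) (sym (trans (cong (_·⟨ i , j ⟩) eq) (word-ext pointwise)))
        (step {w = w ·⟨ i , j ⟩} (Inj-· {w = w} i j inj) (swap-mono a<b h)
          (subst₂ F._<_ (sym (at b)) (sym (at a)) lt))
        where
        at : ∀ c → lookup (w ·⟨ i , j ⟩) (swapF i j c) ≡ lookup w c
        at c = trans (lookup-· w i j (swapF i j c)) (cong (lookup w) (swapF-invol i j c))
        pointwise : ∀ c → lookup ((w ·⟨ a , b ⟩) ·⟨ i , j ⟩) c ≡ lookup ((w ·⟨ i , j ⟩) ·⟨ swapF i j a , swapF i j b ⟩) c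
        pointwise c = trans (lookup-· (w ·⟨ a , b ⟩) i j c) (trans (lookup-· w a b (swapF i j c))
          (trans (sym (at (swapF a b (swapF i j c)))) (trans (cong (lookup (w ·⟨ i , j ⟩))
            (trans (swapF-conj (swapF i j) (swapF-inj i j) a b (swapF i j c))
              (cong (swapF (swapF i j a) (swapF i j b)) (swapF-invol i j c))))
            (sym (lookup-· (w ·⟨ i , j ⟩) (swapF i j a) (swapF i j b) c)))))
      by : Dec (a ≡ i) → Dec (b ≡ j) → u ·⟨ i , j ⟩ ≡ w ⊎ BruhatStep (u ·⟨ i , j ⟩) (w ·⟨ i , j ⟩)
      by (yes p) (yes q) = inj₁ (sym (·-undo (trans eq (cong₂ (w ·⟨_,_⟩) p q))))
      by (no p) _ = inj₂ (moved (λ r _ → p r))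
      by _ (no q) = inj₂ (moved (λ _ r → q r))

  Inj-valswap : ∀ {w : Word m} → Inj w → Inj (valswap i j w)
  Inj-valswap {w} inj {a} {b} p = inj (swapF-inj i j (trans (sym (lookup-valswap i j w a)) (trans p (lookup-valswap i j w b))))

  valswap-· : ∀ {w : Word m} → Inj w → ∀ {p q} → lookup w p ≡ j → lookup w q ≡ i → valswap i j w ≡ w ·⟨ p , q ⟩
  valswap-· {w} inj {p} {q} wp wq = word-ext λ c → trans (lookup-valswap i j w c) (trans (sym (at c)) (sym (lookup-· w p q c)))
    where
    swap-sym : ∀ c → swapF j i c ≡ swapF i j c
    swap-sym c with cases i j c
    ... | is-l r = trans (cong (swapF j i) r) (trans (swapF-r j i) (sym (trans (cong (swapF i j) r) (swapF-l i j))))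
    ... | is-r r = trans (cong (swapF j i) r) (trans (swapF-l j i) (sym (trans (cong (swapF i j) r) (swapF-r i j))))
    ... | is-o r s = trans (swapF-o j i c s r) (sym (swapF-o i j c r s))
    at : ∀ c → lookup w (swapF p q c) ≡ swapF i j (lookup w c)
    at c = trans (swapF-conj (lookup w) inj p q c) (trans (cong₂ (λ x y → swapF x y (lookup w c)) wp wq) (swap-sym (lookup w c)))

  values : Reflects (valswap i j)
  values = record { g-invol = valswap-invol i j ; g-step = g-step }
    where
    g-step : ∀ {u w} → Inj w → BruhatStep u w → valswap i j u ≡ w ⊎ BruhatStep (valswap i j u) (valswap i j w)
    g-step {u} {w} inj s with step-inv {u = u} {w} inj s
    ... | a , b , a<b , lt , eq = by (lookup w b F.≟ i) (lookup w a F.≟ j)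
      where
      moved : (lookup w b ≡ i → lookup w a ≢ j) → BruhatStep (valswap i j u) (valswap i j w)
      moved h = subst (λ v → BruhatStep v (valswap i j w)) (sym (trans (cong (valswap i j) eq) (word-ext pointwise)))
        (step {w = valswap i j w} (Inj-valswap {w} inj) a<b
          (subst₂ F._<_ (sym (lookup-valswap i j w b)) (sym (lookup-valswap i j w a)) (swap-mono lt h)))
        where
        pointwise : ∀ c → lookup (valswap i j (w ·⟨ a , b ⟩)) c ≡ lookup (valswap i j w ·⟨ a , b ⟩) c
        pointwise c = trans (lookup-valswap i j (w ·⟨ a , b ⟩) c) (trans (cong (swapF i j) (lookup-· w a b c))
          (trans (sym (lookup-valswap i j w (swapF a b c))) (sym (lookup-· (valswap i j w) a b c))))
      by : Dec (lookup w b ≡ i) → Dec (lookup w a ≡ j) → valswap i j u ≡ w ⊎ BruhatStep (valswap i j u) (valswap i j w)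
      by (yes p) (yes q) = inj₁ (trans (cong (valswap i j) (trans eq (sym (valswap-· {w} inj q p)))) (valswap-invol i j w))
      by (no p) _ = inj₂ (moved (λ r _ → p r))
      by _ (no q) = inj₂ (moved (λ _ r → q r))

  positions-down : ∀ {w : Word m} → Inj w → lookup w j F.< lookup w i → BruhatStep (w ·⟨ i , j ⟩) w
  positions-down {w} inj lt = step {w = w} inj i<j lt

  values-down : ∀ {w : Word m} → Inj w → ∀ {p q} → lookup w p ≡ j → lookup w q ≡ i → p F.< q → BruhatStep (valswap i j w) w
  values-down {w} inj {p} {q} wp wq lt = subst (λ v → BruhatStep v w) (sym (valswap-· {w} inj wp wq))
    (step {w = w} inj lt (subst₂ F._<_ (sym wq) (sym wp) i<j))

  len-positions-down : ∀ {w : Word m} → lookup w j F.< lookup w i → len w ≡ suc (len (w ·⟨ i , j ⟩))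
  len-positions-down {w} lt = trans (cong len (sym (·-invol w i j))) (len-· {w = w ·⟨ i , j ⟩} e
    (subst₂ F._<_ (sym (trans (lookup-· w i j i) (cong (lookup w) (swapF-l i j))))
                  (sym (trans (lookup-· w i j j) (cong (lookup w) (swapF-r i j)))) lt))

  len-values-down : ∀ {w : Word m} → Inj w → ∀ {p q} → lookup w p ≡ j → lookup w q ≡ i → p F.< q →
                    len w ≡ suc (len (valswap i j w))
  len-values-down {w} inj {p} {q} wp wq lt = trans (cong len (sym (valswap-invol i j w)))
    (len-valswap {w = valswap i j w} e (Inj-valswap {w} inj)
      (trans (lookup-valswap i j w p) (trans (cong (swapF i j) wp) (swapF-r i j)))
      (trans (lookup-valswap i j w q) (trans (cong (swapF i j) wq) (swapF-l i j))) lt)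

≤B-len : ∀ {m} {u w : Word m} → u ≤B w → len u ≤ len w
≤B-len ε = ≤-refl
≤B-len ((_ , _ , _ , _ , lt) ◅ r) = ≤-trans (<⇒≤ lt) (≤B-len r)

Prefixed : ∀ {m} → ℕ → ℕ → Word m → Set
Prefixed {m} k v w = ∃ λ (a : Fin m) → toℕ a ≤ k × toℕ (opposite (lookup w a)) ≤ v

opposite-sum : ∀ {m} (a : Fin m) → suc (toℕ a + toℕ (opposite a)) ≡ m
opposite-sum {suc m} a = cong suc (trans (cong (toℕ a +_) (opposite-prop a)) (m+[n∸m]≡n (s≤s⁻¹ (toℕ<n a))))

opposite-anti : ∀ {m} {a b : Fin m} → a F.< b → opposite b F.< opposite a
opposite-anti {m} {a} {b} a<b = ≰⇒> λ le → <⇒≢ (s≤s (+-mono-<-≤ a<b le)) (trans (opposite-sum a) (sym (opposite-sum b)))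

-- A step up moves the larger of two values to the earlier position; after `opposite` it is the
-- smaller one that moves forward.
Prefixed-mono : ∀ {m k v} {u w : Word m} → Inj u → u ≤B w → Prefixed k v u → Prefixed k v w
Prefixed-mono inj ε P = P
Prefixed-mono {k = k} {v} {u} {w} inj (_◅_ {j = x} s r) P = Prefixed-mono {u = x} {w} inj′ r (one P)
  where
  inj′ : Inj x
  inj′ = step-Inj {u = u} {x} inj s
  one : Prefixed k v u → Prefixed k v x
  one (a , a≤k , le) with step-inv {u = u} {x} inj′ s
  ... | i , j , i<j , lt , eq with cases i j a
  ...   | is-l refl = a , a≤k , <⇒≤ (<-≤-trans (opposite-anti (subst (F._< lookup x a) (sym val) lt)) le)
    where
    val : lookup u a ≡ lookup x j
    val = trans (cong (λ z → lookup z a) eq) (trans (lookup-· x a j a) (cong (lookup x) (swapF-l a j)))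
  ...   | is-r refl = i , ≤-trans (<⇒≤ i<j) a≤k , subst (λ z → toℕ (opposite z) ≤ v) val le
    where
    val : lookup u a ≡ lookup x i
    val = trans (cong (λ z → lookup z a) eq) (trans (lookup-· x i a a) (cong (lookup x) (swapF-r i a)))
  ...   | is-o p q = a , a≤k , subst (λ z → toℕ (opposite z) ≤ v) val le
    where
    val : lookup u a ≡ lookup x a
    val = trans (cong (λ z → lookup z a) eq) (trans (lookup-· x i j a) (cong (lookup x) (swapF-o i j a p q)))

-- The involution w₀ x attached to a twisted identity x.
reflected : ∀ {m} → Word m → Fin m → Fin m
reflected w a = opposite (lookup w a)

record Matched {m} (w : Word m) : Set where
  field
    r-invol : ∀ a → reflected w (reflected w a) ≡ a
    r-fpf   : ∀ a → reflected w a ≢ a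

  r-inj : ∀ {a b} → reflected w a ≡ reflected w b → a ≡ b
  r-inj {a} {b} p = trans (sym (r-invol a)) (trans (cong (reflected w) p) (r-invol b))

  inj : Inj w
  inj p = r-inj (cong opposite p)

opposite-inj : ∀ {m} {a b : Fin m} → opposite a ≡ opposite b → a ≡ b
opposite-inj {a = a} {b} p = trans (sym (opposite-involutive a)) (trans (cong opposite p) (opposite-involutive b))

opposite-anti⁻ : ∀ {m} {a b : Fin m} → opposite b F.< opposite a → a F.< b
opposite-anti⁻ {a = a} {b} p = subst₂ F._<_ (opposite-involutive a) (opposite-involutive b) (opposite-anti p)

lookup-reflected : ∀ {m} (w : Word m) a → lookup w a ≡ opposite (reflected w a)
lookup-reflected w a = sym (opposite-involutive (lookup w a))

-- Twisted conjugation of words.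

-- Conjugating the involution `w₀ w` by a generator multiplies `w` by it on the right and by its
-- image under `θ` on the left; the latter exchanges the values `i′` and `j′`.
module Conj {m} (i j : Fin m) (e : toℕ j ≡ suc (toℕ i)) where

  i′ j′ : Fin m
  i′ = opposite j
  j′ = opposite i

  e′ : toℕ j′ ≡ suc (toℕ i′)
  e′ = +-cancelˡ-≡ (toℕ i) _ _ (suc-injective (trans (opposite-sum i) (trans (sym (opposite-sum j))
    (cong suc (trans (cong (_+ toℕ (opposite j)) e) (sym (+-suc (toℕ i) _)))))))

  module Pos = Adjacent {i = i} {j} e
  module Val = Adjacent {i = i′} {j′} e′
  open Reflects

  R L conj : Word m → Word m
  R w = w ·⟨ i , j ⟩
  L w = valswap i′ j′ w
  conj w = L (R w)

  reflected-R : ∀ w a → reflected (R w) a ≡ reflected w (swapF i j a)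
  reflected-R w a = cong opposite (lookup-· w i j a)

  swap-opposite : ∀ a → opposite (swapF i′ j′ a) ≡ swapF i j (opposite a)
  swap-opposite a = trans (swapF-conj opposite opposite-inj i′ j′ a)
    (trans (cong₂ (λ x y → swapF x y (opposite a)) (opposite-involutive j) (opposite-involutive i)) (swap-sym (opposite a)))
    where
    swap-sym : ∀ c → swapF j i c ≡ swapF i j c
    swap-sym c with cases i j c
    ... | is-l r = trans (cong (swapF j i) r) (trans (swapF-r j i) (sym (trans (cong (swapF i j) r) (swapF-l i j))))
    ... | is-r r = trans (cong (swapF j i) r) (trans (swapF-l j i) (sym (trans (cong (swapF i j) r) (swapF-r i j))))
    ... | is-o r s = trans (swapF-o j i c s r) (sym (swapF-o i j c r s))

  reflected-conj : ∀ w a → reflected (conj w) a ≡ swapF i j (reflected w (swapF i j a))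
  reflected-conj w a = trans (cong opposite (lookup-valswap i′ j′ (R w) a))
    (trans (swap-opposite (lookup (R w) a)) (cong (swapF i j) (reflected-R w a)))

  conj-matched : ∀ {w} → Matched w → Matched (conj w)
  conj-matched {w} μ = record
    { r-invol = λ a → trans (reflected-conj w _) (trans (cong (λ b → swapF i j (reflected w (swapF i j b))) (reflected-conj w a))
        (trans (cong (λ b → swapF i j (reflected w b)) (swapF-invol i j _)) (trans (cong (swapF i j) (r-invol _)) (swapF-invol i j a))))
    ; r-fpf = λ a p → r-fpf (swapF i j a) (swapF-inj i j (trans (sym (reflected-conj w a)) (trans p (sym (swapF-invol i j a)))))
    }
    where open Matched μ

  module _ {w : Word m} (μ : Matched w) where
    open Matched μ
    private
      v : Fin m → Fin m
      v = reflected w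

      val-i : lookup w (v i) ≡ j′
      val-i = trans (lookup-reflected w (v i)) (cong opposite (r-invol i))
      val-j : lookup w (v j) ≡ i′
      val-j = trans (lookup-reflected w (v j)) (cong opposite (r-invol j))

      inj-R : Inj (R w)
      inj-R = Inj-· {w = w} i j inj

      R-val-i : lookup (R w) (swapF i j (v i)) ≡ j′
      R-val-i = trans (lookup-· w i j _) (trans (cong (lookup w) (swapF-invol i j (v i))) val-i)
      R-val-j : lookup (R w) (swapF i j (v j)) ≡ i′
      R-val-j = trans (lookup-· w i j _) (trans (cong (lookup w) (swapF-invol i j (v j))) val-j)

    module _ (d : v i F.< v j) where

      private
        R-lt : swapF i j (v i) F.< swapF i j (v j)
        R-lt = Pos.swap-mono d (λ p → ⊥-elim (r-fpf i p))

      R⊑ : R w ≤B w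
      R⊑ = Pos.positions-down {w} inj (opposite-anti⁻ d) ◅ ε

      L⊑ : L w ≤B w
      L⊑ = Val.values-down {w} inj val-i val-j d ◅ ε

      LR⊑R : conj w ≤B R w
      LR⊑R = Val.values-down {R w} inj-R R-val-i R-val-j R-lt ◅ ε

      conj⊑ : conj w ≤B w
      conj⊑ = LR⊑R ◅◅ R⊑

      len-conj : len w ≡ suc (suc (len (conj w)))
      len-conj = trans (Pos.len-positions-down {w} (opposite-anti⁻ d))
        (cong suc (Val.len-values-down {R w} inj-R R-val-i R-val-j R-lt))

      -- Here and in the next two lemmas the bounds for one-sided multiplication are used twice, for
      -- positions and for values.
      conj-max : ∀ {u} → Matched u → u ≤B w → conj u ≤B w
      conj-max {u} ν le = [ (λ q → q ◅◅ L⊑) , (λ q → q) ]′ (max-bound Val.values {R u} (Inj-· {w = u} i j (Matched.inj ν)) Ru⊑)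
        where
        Ru⊑ : R u ≤B w
        Ru⊑ = [ (λ q → q ◅◅ R⊑) , (λ q → q) ]′ (max-bound Pos.positions {u} (Matched.inj ν) le)

      conj-mono : ∀ {u} → Matched u → u ≤B w → R u ≤B u → conj u ≤B R u → conj u ≤B conj w
      conj-mono {u} ν le Ru⊑u cu⊑ = [ (λ q → q) , (λ q → cu⊑ ◅◅ q) ]′ (min-bound Val.values {R u} (Inj-· {w = u} i j (Matched.inj ν)) Ru⊑)
        where
        Ru⊑ : R u ≤B R w
        Ru⊑ = [ (λ q → q) , (λ q → Ru⊑u ◅◅ q) ]′ (min-bound Pos.positions {u} (Matched.inj ν) le)

      min-conj : ∀ {u} → Matched u → u ≤B w → u ≤B R u → u ≤B L u → u ≤B conj w
      min-conj {u} ν le u⊑R u⊑L = [ (λ q → u⊑L ◅◅ q) , (λ q → q) ]′ (min-bound Val.values {u} (Matched.inj ν) u⊑)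
        where
        u⊑ : u ≤B R w
        u⊑ = [ (λ q → u⊑R ◅◅ q) , (λ q → q) ]′ (min-bound Pos.positions {u} (Matched.inj ν) le)

    module _ (d : v j F.< v i) where

      ⊑R : w ≤B R w
      ⊑R = subst (_≤B R w) (·-invol w i j) (Pos.positions-down {R w} inj-R
        (subst₂ F._<_ (sym (trans (lookup-· w i j j) (cong (lookup w) (swapF-r i j))))
                      (sym (trans (lookup-· w i j i) (cong (lookup w) (swapF-l i j)))) (opposite-anti⁻ d)) ◅ ε)

      ⊑L : w ≤B L w
      ⊑L = subst (_≤B L w) (valswap-invol i′ j′ w) (Val.values-down {L w} (Val.Inj-valswap {w} inj)
        (trans (lookup-valswap i′ j′ w (v j)) (trans (cong (swapF i′ j′) val-j) (swapF-l i′ j′)))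
        (trans (lookup-valswap i′ j′ w (v i)) (trans (cong (swapF i′ j′) val-i) (swapF-r i′ j′))) d ◅ ε)

-- The system of fixed-point-free involutions.

module Instance (n : ℕ) where

  m : ℕ
  m = 2 * n

  -- `matched` is irrelevant, so that elements with equal words are equal; `recover` rebuilds the
  -- proof from decidable equality of points.
  record Elem : Set where
    constructor elem
    field
      word     : W n
      .matched : Matched word

  open Elem public

  elem-≡ : ∀ {x y} → word x ≡ word y → x ≡ y
  elem-≡ {elem w _} {elem .w _} refl = refl

  recover : (x : Elem) → Matched (word x)
  recover (elem w μ) = record
    { r-invol = λ a → recompute (reflected w (reflected w a) F.≟ a) (Matched.r-invol μ a)
    ; r-fpf   = λ a p → irr (Matched.r-fpf μ a p) }
    where
    irr : .⊥ → ⊥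
    irr ()

  ¬self-opposite : ∀ (a : Fin m) → opposite a ≢ a
  ¬self-opposite a p = odd n (toℕ a) (trans (sym (opposite-sum a)) (cong (λ b → suc (toℕ a + b)) (cong toℕ p)))
    where
    odd : ∀ n k → 2 * n ≢ suc (k + k)
    odd zero k ()
    odd (suc n) zero q = contr (trans (sym (+-suc n (n + 0))) (suc-injective q))
      where
      contr : suc (n + (n + 0)) ≢ 0
      contr ()
    odd (suc n) (suc k) q = odd n k (suc-injective (trans (sym (+-suc n (n + 0))) (trans (suc-injective q) (cong suc (+-suc k k)))))

  e-elem : Elem
  e-elem = elem (e n) record
    { r-invol = λ a → trans (cong opposite (look _)) (trans (cong (λ b → opposite (opposite b)) (look a)) (opposite-involutive a))
    ; r-fpf   = λ a p → ¬self-opposite a (trans (cong opposite (sym (look a))) p) }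
    where
    look : ∀ a → lookup (e n) a ≡ a
    look a = lookup∘tabulate _ a

  Index : ℕ → Set
  Index k = ∃₂ λ (i j : Fin m) → toℕ i ≡ k × toℕ j ≡ suc (toℕ i)

  index? : ∀ k → Dec (Index k)
  index? k with suc k <? m
  ... | yes p = yes (fromℕ< (<-trans (n<1+n k) p) , fromℕ< p , toℕ-fromℕ< _ , trans (toℕ-fromℕ< p) (cong suc (sym (toℕ-fromℕ< _))))
  ... | no p = no λ { (i , j , q , r) → p (subst (_< m) (trans r (cong suc q)) (toℕ<n j)) }

  act-at : ∀ {k} → Index k → Elem → Elem
  act-at (i , j , _ , a) x = elem (Conj.conj i j a (word x)) (Conj.conj-matched i j a (recover x))

  act-by : ∀ {k} → Dec (Index k) → Elem → Elem
  act-by (yes ix) x = act-at ix x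
  act-by (no _)   x = x

  act-elem : ℕ → Elem → Elem
  act-elem k = act-by (index? k)

  at : ∀ {k} → suc k < m → Σ (Index k) λ ix → ∀ x → act-elem k x ≡ act-at ix x
  at {k} p with index? k
  ... | yes ix = ix , λ _ → refl
  ... | no q = ⊥-elim (q (fromℕ< (<-trans (n<1+n k) p) , fromℕ< p , toℕ-fromℕ< _ , trans (toℕ-fromℕ< p) (cong suc (sym (toℕ-fromℕ< _)))))

  -- The identity on points outside the range, which keeps `F-elem x` an involution of all natural
  -- numbers.
  F-elem : Elem → ℕ → ℕ
  F-elem x k with k <? m
  ... | yes p = toℕ (reflected (word x) (fromℕ< p))
  ... | no _  = k

  F-at : ∀ x {k} (a : Fin m) → toℕ a ≡ k → F-elem x k ≡ toℕ (reflected (word x) a)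
  F-at x {k} a refl with k <? m
  ... | yes p = cong (λ b → toℕ (reflected (word x) b)) (fromℕ<-toℕ a p)
  ... | no p = ⊥-elim (p (toℕ<n a))

  F-out : ∀ x {k} → ¬ (k < m) → F-elem x k ≡ k
  F-out x {k} p with k <? m
  ... | yes q = ⊥-elim (p q)
  ... | no _ = refl

  fin : ∀ {k} → k < m → ∃ λ (a : Fin m) → toℕ a ≡ k
  fin p = fromℕ< p , toℕ-fromℕ< p

  data Where (k : ℕ) : Set where
    inside  : (a : Fin m) → toℕ a ≡ k → Where k
    outside : ¬ (k < m) → Where k

  whereabouts : ∀ k → Where k
  whereabouts k with k <? m
  ... | yes p = inside (fromℕ< p) (toℕ-fromℕ< p)
  ... | no p = outside p

  -- Conjugation at a descent lowers the length by two and `e n` has length zero, so halving does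
  -- not round.
  rk-elem : Elem → ℕ
  rk-elem x = ⌊ len (word x) /2⌋

  mirror-word : W n → W n
  mirror-word w = tabulate (λ a → opposite (lookup w (opposite a)))

  reflected-mirror : ∀ w a → reflected (mirror-word w) a ≡ opposite (reflected w (opposite a))
  reflected-mirror w a = cong opposite (lookup∘tabulate (λ a → opposite (lookup w (opposite a))) a)

  mir-elem : Elem → Elem
  mir-elem x = elem (mirror-word (word x)) (go (recover x))
    where
    go : Matched (word x) → Matched (mirror-word (word x))
    go μ = record
      { r-invol = λ a → trans (reflected-mirror w _) (trans (cong (λ b → opposite (reflected w (opposite b))) (reflected-mirror w a))
          (trans (cong (λ b → opposite (reflected w b)) (opposite-involutive _)) (trans (cong opposite (r-invol _)) (opposite-involutive a))))
      ; r-fpf = λ a p → r-fpf (opposite a) (trans (sym (opposite-involutive _)) (cong opposite (trans (sym (reflected-mirror w a)) p))) }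
      where
      open Matched μ
      w = word x

  module Lt {k} (x : Elem) (ix : Index k) where
    i j : Fin m
    i = proj₁ ix
    j = proj₁ (proj₂ ix)
    i≡ : toℕ i ≡ k
    i≡ = proj₁ (proj₂ (proj₂ ix))
    j≡ : toℕ j ≡ suc k
    j≡ = trans (proj₂ (proj₂ (proj₂ ix))) (cong suc i≡)

    desc→ : F-elem x k < F-elem x (suc k) → reflected (word x) i F.< reflected (word x) j
    desc→ = subst₂ _<_ (F-at x i i≡) (F-at x j j≡)

    asc→ : F-elem x (suc k) < F-elem x k → reflected (word x) j F.< reflected (word x) i
    asc→ = subst₂ _<_ (F-at x j j≡) (F-at x i i≡)

  iota : System m
  iota = record
    { X = Elem
    ; _≟X_ = λ x y → map′ elem-≡ (cong word) (≡-dec F._≟_ (word x) (word y))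
    ; rk = rk-elem
    ; _⊑_ = λ x y → word x ≤B word y
    ; F = F-elem
    ; act = act-elem
    ; ê = e-elem
    ; mir = mir-elem
    ; F-< = F-<
    ; F-invol = F-invol
    ; F-fpf = F-fpf
    ; F-ext = F-ext
    ; F-act = F-act
    ; act-out = act-out
    ; F-e = F-e
    ; F-mir = F-mir
    ; rk-e = rk-e
    ; rk-desc = λ {x} p d → let ((i , j , q , a) , eq) = at p in
        trans (cong ⌊_/2⌋ (Conj.len-conj i j a (recover x) (Lt.desc→ x (i , j , q , a) d))) (cong (λ y → suc (rk-elem y)) (sym (eq x)))
    ; ⊑-refl = ε
    ; ⊑-trans = _◅◅_
    ; rk-mono = λ le → ⌊n/2⌋-mono (≤B-len le)
    ; desc-⊑ = λ {x} p d → let ((i , j , q , a) , eq) = at p in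
        subst (λ y → word y ≤B word x) (sym (eq x)) (Conj.conj⊑ i j a (recover x) (Lt.desc→ x (i , j , q , a) d))
    ; lift₁ = λ {x} {y} p d le → let ((i , j , q , a) , eq) = at p in
        subst (λ z → word z ≤B word y) (sym (eq x)) (Conj.conj-max i j a (recover y) (Lt.desc→ y (i , j , q , a) d) (recover x) le)
    ; lift₂ = λ {x} {y} p d c le → let ((i , j , q , a) , eq) = at p in
        subst (λ z → word x ≤B word z) (sym (eq y)) (Conj.min-conj i j a (recover y) (Lt.desc→ y (i , j , q , a) d) (recover x) le
          (Conj.⊑R i j a (recover x) (Lt.asc→ x (i , j , q , a) c)) (Conj.⊑L i j a (recover x) (Lt.asc→ x (i , j , q , a) c)))
    ; lift₃ = λ {x} {y} p d d′ le → let ((i , j , q , a) , eq) = at p in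
        subst₂ (λ z z′ → word z ≤B word z′) (sym (eq x)) (sym (eq y)) (Conj.conj-mono i j a (recover y) (Lt.desc→ y (i , j , q , a) d) (recover x) le
          (Conj.R⊑ i j a (recover x) (Lt.desc→ x (i , j , q , a) d′)) (Conj.LR⊑R i j a (recover x) (Lt.desc→ x (i , j , q , a) d′)))
    ; prefix = prefix
    }
    where
    F-< : ∀ x {k} → k < m → F-elem x k < m
    F-< x p = let (a , q) = fin p in subst (_< m) (sym (F-at x a q)) (toℕ<n _)
    F-invol : ∀ x k → F-elem x (F-elem x k) ≡ k
    F-invol x k with whereabouts k
    ... | inside a q = trans (F-at x (reflected (word x) a) (sym (F-at x a q))) (trans (cong toℕ (Matched.r-invol (recover x) a)) q)
    ... | outside p = trans (cong (F-elem x) (F-out x p)) (F-out x p)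
    F-fpf : ∀ x {k} → k < m → F-elem x k ≢ k
    F-fpf x p r = let (a , q) = fin p in Matched.r-fpf (recover x) a (toℕ-injective (trans (sym (F-at x a q)) (trans r (sym q))))
    F-ext : ∀ {x y} → (∀ k → k < m → F-elem x k ≡ F-elem y k) → x ≡ y
    F-ext {x} {y} h = elem-≡ (word-ext λ a → opposite-inj (toℕ-injective
      (trans (sym (F-at x a refl)) (trans (h (toℕ a) (toℕ<n a)) (F-at y a refl)))))
    F-act : ∀ x {k} → suc k < m → ∀ a → F-elem (act-elem k x) a ≡ sw k (F-elem x (sw k a))
    F-act x {k} p a with at p
    ... | (i , j , i≡ , nxt) , eq = trans (cong (λ y → F-elem y a) (eq x)) (by (whereabouts a))
      where
      swk : ∀ b → toℕ (swapF i j b) ≡ sw k (toℕ b)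
      swk b = trans (toℕ-swapF nxt b) (cong (λ h → sw h (toℕ b)) i≡)
      by : Where a → F-elem (act-at (i , j , i≡ , nxt) x) a ≡ sw k (F-elem x (sw k a))
      by (inside b q) = trans (F-at (act-at (i , j , i≡ , nxt) x) b q) (trans (cong toℕ (Conj.reflected-conj i j nxt (word x) b))
        (trans (swk _) (cong (sw k) (sym (F-at x (swapF i j b) (trans (swk b) (cong (sw k) q)))))))
      by (outside q) = trans (F-out (act-at (i , j , i≡ , nxt) x) q) (sym (trans (cong (λ h → sw k (F-elem x h)) fixed) (trans (cong (sw k) (F-out x q)) fixed)))
        where
        fixed : sw k a ≡ a
        fixed = sw-high k a (<-≤-trans p (≮⇒≥ q))
    act-out : ∀ x {k} → ¬ (suc k < m) → act-elem k x ≡ x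
    act-out x {k} p with index? k
    ... | yes (i , j , q , r) = ⊥-elim (p (subst (_< m) (trans r (cong suc q)) (toℕ<n j)))
    ... | no _ = refl
    look-e : ∀ a → reflected (e n) a ≡ opposite a
    look-e a = cong opposite (lookup∘tabulate (λ k → k) a)
    F-e : ∀ {j} → j < m → suc (j + F-elem e-elem j) ≡ m
    F-e {j} p = let (a , q) = fin p in
      trans (cong₂ (λ b c → suc (b + c)) (sym q) (trans (F-at e-elem a q) (cong toℕ (look-e a)))) (opposite-sum a)
    F-mir : ∀ x {i j} → suc (i + j) ≡ m → suc (F-elem (mir-elem x) i + F-elem x j) ≡ m
    F-mir x {i} {j} s = let (a , q) = fin (subst (i <_) s (s≤s (m≤m+n i j)))
                            j≡ = +-cancelˡ-≡ i _ _ (suc-injective (trans (cong (λ h → suc (h + toℕ (opposite a))) (sym q)) (trans (opposite-sum a) (sym s))))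
                        in
      trans (cong₂ (λ b c → suc (b + c)) (trans (F-at (mir-elem x) a q) (cong toℕ (reflected-mirror (word x) a))) (F-at x (opposite a) j≡))
        (trans (cong suc (+-comm _ (toℕ (reflected (word x) (opposite a))))) (opposite-sum (reflected (word x) (opposite a))))
    rk-e : rk-elem e-elem ≡ 0
    rk-e = cong ⌊_/2⌋ (len-id m)
    prefix : ∀ {x y k v} → k < m → word x ≤B word y → (∃ λ i → i ≤ k × F-elem x i ≤ v) → ∃ λ i → i ≤ k × F-elem y i ≤ v
    prefix {x} {y} {k} {v} k<m le (i , i≤k , b) =
      let (a , q) = fin (≤-<-trans i≤k k<m)
          (a′ , c , d) = Prefixed-mono {k = k} {v} {word x} {word y} (Matched.inj (recover x)) le
                           (a , subst (_≤ k) (sym q) i≤k , subst (_≤ v) (F-at x a q) b)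
      in toℕ a′ , c , subst (_≤ v) (sym (F-at y a′ refl)) d

-- If `f` missed `a`, then `f` together with `a` would inject `m + 1` points into `m`.
left-inverse⇒right-inverse : ∀ {m} {f g : Fin m → Fin m} → (∀ a → g (f a) ≡ a) → ∀ a → f (g a) ≡ a
left-inverse⇒right-inverse {m} {f} {g} h a with any? (λ b → f b F.≟ a)
... | yes (b , refl) = cong f (h b)
... | no q with pigeonhole (n<1+n m) extended
  where
  extended : Fin (suc m) → Fin m
  extended F.zero    = a
  extended (F.suc b) = f b
...   | F.zero  , F.suc j , _ , eq = ⊥-elim (q (j , sym eq))
...   | F.suc i , F.suc j , s≤s lt , eq = ⊥-elim (<⇒≢ lt (cong toℕ (trans (sym (h i)) (trans (cong g eq) (h j)))))

-- Twisted identities as fixed-point-free involutions.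

module Twist (n : ℕ) where
  open Instance n
  open Theory iota

  reflected-twisted : ∀ (u w : W n) a → reflected (θ u ∘W w) a ≡ lookup u (opposite (lookup w a))
  reflected-twisted u w a = trans (cong opposite (trans (lookup∘tabulate (λ k → lookup (θ u) (lookup w k)) a)
    (lookup∘tabulate (λ i → opposite (lookup u (opposite i))) (lookup w a)))) (opposite-involutive _)

  twisted-matched : ∀ {v} → Twisted n v → Matched v
  twisted-matched (w , u , uw , refl) = record
    { r-invol = λ a → trans (reflected-twisted u w _) (trans (cong (λ b → lookup u (opposite (lookup w b))) (reflected-twisted u w a))
        (trans (cong (λ b → lookup u (opposite b)) (wu _)) (trans (cong (lookup u) (opposite-involutive _)) (uw a))))
    ; r-fpf = λ a p → ¬self-opposite (lookup w a) (trans (sym (wu _)) (cong (lookup w) (trans (sym (reflected-twisted u w a)) p)))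
    }
    where
    wu : ∀ a → lookup w (lookup u a) ≡ a
    wu = left-inverse⇒right-inverse {f = lookup w} {lookup u} uw

  elem-of : ∀ {v} → Twisted n v → Elem
  elem-of {v} t = elem v (twisted-matched t)

  twisted-e : Twisted n (e n)
  twisted-e = idW m , idW m , (λ i → trans (cong (lookup (idW m)) (look i)) (look i)) , word-ext λ a → sym (trans
    (sym (opposite-involutive _)) (trans (cong opposite (trans (reflected-twisted (idW m) (idW m) a)
      (trans (look _) (cong opposite (look a))))) (trans (opposite-involutive a) (sym (look a)))))
    where
    look : ∀ a → lookup (idW m) a ≡ a
    look a = lookup∘tabulate (λ k → k) a

  -- Conjugation by a generator s replaces the witness w by the product w s.
  twisted-act : ∀ {k} (ix : Index k) x → Twisted n (word x) → Twisted n (word (act-at ix x))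
  twisted-act (i , j , _ , nxt) x (w , u , uw , eq) = w ·⟨ i , j ⟩ , valswap i j u , inverse , word-ext λ a → opposite-inj
      (trans (Conj.reflected-conj i j nxt (word x) a) (trans (cong (swapF i j) (trans (cong (λ y → reflected y (swapF i j a)) eq)
        (reflected-twisted u w (swapF i j a)))) (sym (trans (reflected-twisted (valswap i j u) (w ·⟨ i , j ⟩) a)
          (trans (lookup-valswap i j u _) (cong (λ b → swapF i j (lookup u (opposite b))) (lookup-· w i j a)))))))
    where
    inverse : ∀ a → lookup (valswap i j u) (lookup (w ·⟨ i , j ⟩) a) ≡ a
    inverse a = trans (lookup-valswap i j u _) (trans (cong (λ b → swapF i j (lookup u b)) (lookup-· w i j a))
      (trans (cong (swapF i j) (uw (swapF i j a))) (swapF-invol i j a)))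

  -- Descents lead from `x` down to the identity, and `twisted-act` leads back up.
  twisted : ∀ x → Twisted n (word x)
  twisted x = go (suc (rk x)) x (n<1+n _)
    where
    go : ∀ f x → rk x < f → Twisted n (word x)
    go (suc f) x b with x ≟X ê
    ... | yes refl = twisted-e
    ... | no ne with desc ne
    ...   | k , d with at (proj₁ d)
    ...     | ix , eq = subst (λ y → Twisted n (word y)) (trans (sym (eq (act k x))) (act-invol k x))
                (twisted-act ix (act k x) (go f (act k x) (rk-dn d b)))

  -- Gradedness supplies an element one rank above `x` and below `y`; it is a twisted identity, so
  -- the cover condition identifies it with `y`.
  cov⇒⋖ : ∀ {x y} → Cov n (word x) (word y) → x ⋖ y
  cov⇒⋖ {x} {y} ((le , ne) , tight) with cover-below {x} {y} le (λ p → ne (cong word p))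
  ... | z , c , l with tight (word z) (twisted z) (proj₁ c) l
  ...   | inj₁ p = ⊥-elim (¬⋖-≡ {x} {z} c (elem-≡ p))
  ...   | inj₂ p = subst (x ⋖_) (elem-≡ {z} {y} p) c

  module Lift {w : Elem} {M : W n → W n} (spm : QSPM n (word w) M) where
    open QSPM spm

    lift : Elem → Elem
    lift x with x ⊑? w
    ... | yes l = elem-of (proj₁ (closed (word x) (twisted x , l)))
    -- Default value outside the interval, where nothing is claimed about `lift`.
    ... | no _  = x

    lift-word : ∀ {x} → x ⊑ w → word (lift x) ≡ M (word x)
    lift-word {x} l with x ⊑? w
    ... | yes _ = refl
    ... | no q = ⊥-elim (q l)

    lift-closed : ∀ {x} → x ⊑ w → lift x ⊑ w
    lift-closed {x} l = subst (_≤B word w) (sym (lift-word l)) (proj₂ (closed (word x) (twisted x , l)))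

    lift-matching : Matching (_⊑ w) lift
    lift-matching = record
      { lower  = λ l l′ → l′ ◅◅ l
      ; closed = lift-closed
      ; invol  = λ {x} l → elem-≡ (trans (lift-word (lift-closed l)) (trans (cong M (lift-word l)) (invol (word x) (twisted x , l))))
      ; local  = λ {x} l → loc x l (local (word x) (twisted x , l))
      ; compat = λ {x} {y} l l′ c ne → subst₂ _≤B_ (sym (lift-word l)) (sym (lift-word l′))
          (proj₁ (compat (word x) (word y) (twisted x , l) (twisted y , l′) (⋖⇒cov {x} {y} c) λ p → ne (elem-≡ (trans (lift-word l) p))))
      }
      where
      ⋖⇒cov : ∀ {x y} → x ⋖ y → Cov n (word x) (word y)
      ⋖⇒cov {x} {y} c = (proj₁ c , λ p → ¬⋖-≡ {x} {y} c (sym (elem-≡ p))) , between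
        where
        between : ∀ z → Twisted n z → word x ≤B z → z ≤B word y → z ≡ word x ⊎ z ≡ word y
        between z t l l′ with elem-of t ≟X x
        ... | yes p = inj₁ (cong word p)
        ... | no q = inj₂ (cong word (rank-eq {elem-of t} {y} l′ (≤-antisym (rk-mono {elem-of t} {y} l′)
                (subst (_≤ rk (elem-of t)) (sym (proj₂ c)) (≢⇒rk< {x} {elem-of t} l (λ p → q (sym p)))))))
      loc : ∀ x → x ⊑ w → Cov n (M (word x)) (word x) ⊎ (M (word x) ≡ word x) ⊎ Cov n (word x) (M (word x)) → Local lift x
      loc x l (inj₁ c) = down (cov⇒⋖ {lift x} {x} (subst (λ z → Cov n z (word x)) (sym (lift-word l)) c))
      loc x l (inj₂ (inj₁ p)) = fix (elem-≡ (trans (lift-word l) p))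
      loc x l (inj₂ (inj₂ c)) = rise (cov⇒⋖ {x} {lift x} (subst (Cov n (word x)) (sym (lift-word l)) c))

    lift-down : ∀ {x} → x ⊑ w → Cov n (M (word x)) (word x) → lift x ⋖ x
    lift-down {x} l c = cov⇒⋖ {lift x} {x} (subst (λ z → Cov n z (word x)) (sym (lift-word l)) c)

    lift-rise : ∀ {x} → x ⊑ w → Cov n (word x) (M (word x)) → x ⋖ lift x
    lift-rise {x} l c = cov⇒⋖ {x} {lift x} (subst (Cov n (word x)) (sym (lift-word l)) c)

    lift-down⁻ : ∀ {x} → x ⊑ w → lift x ⋖ x → Cov n (M (word x)) (word x)
    lift-down⁻ {x} l c with local (word x) (twisted x , l)
    ... | inj₁ d = d
    ... | inj₂ (inj₁ p) = ⊥-elim (¬⋖-≡ {lift x} {x} c (sym (elem-≡ (trans (lift-word l) p))))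
    ... | inj₂ (inj₂ d) = ⊥-elim (¬⋖-≡ {lift x} {x} c (⊑-antisym {x} {lift x} (proj₁ (lift-rise {x} l d)) (proj₁ c)))

    lift-rise⁻ : ∀ {x} → x ⊑ w → x ⋖ lift x → Cov n (word x) (M (word x))
    lift-rise⁻ {x} l c with local (word x) (twisted x , l)
    ... | inj₁ d = ⊥-elim (¬⋖-≡ {x} {lift x} c (⊑-antisym {lift x} {x} (proj₁ (lift-down {x} l d)) (proj₁ c)))
    ... | inj₂ (inj₁ p) = ⊥-elim (¬⋖-≡ {x} {lift x} c (elem-≡ (trans (lift-word l) p)))
    ... | inj₂ (inj₂ d) = d

-- Polynomials as sequences.

-- Zero at negative indices, so that multiplication by q is the shift by `predᶻ` at the constant
-- term too.
coeffs : Poly → V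
coeffs p (pos k)    = coeff p k
coeffs p -[1+ _ ] = 0ℤ

coeff-⊕ : ∀ p r k → coeff (p ⊕ r) k ≡ coeff p k ℤ.+ coeff r k
coeff-⊕ []      r       k       = sym (ℤₚ.+-identityˡ _)
coeff-⊕ (a ∷ p) []      k       = sym (ℤₚ.+-identityʳ _)
coeff-⊕ (a ∷ p) (b ∷ r) zero    = refl
coeff-⊕ (a ∷ p) (b ∷ r) (suc k) = coeff-⊕ p r k

coeff-scale : ∀ a p k → coeff (scale a p) k ≡ a ℤ.* coeff p k
coeff-scale a []      k       = sym (ℤₚ.*-zeroʳ a)
coeff-scale a (b ∷ p) zero    = refl
coeff-scale a (b ∷ p) (suc k) = coeff-scale a p k

coeffs-⊕ : ∀ p r k → coeffs (p ⊕ r) k ≡ coeffs p k ℤ.+ coeffs r k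
coeffs-⊕ p r (pos k)    = coeff-⊕ p r k
coeffs-⊕ p r -[1+ k ] = refl

coeff-constant : ∀ b r k → coeff ((b ∷ []) ⊗ r) k ≡ b ℤ.* coeff r k
coeff-constant b r k = trans (coeff-⊕ (scale b r) (0ℤ ∷ []) k) (trans (cong₂ ℤ._+_ (coeff-scale b r k) (zeros k)) (ℤₚ.+-identityʳ _))
  where
  zeros : ∀ k → coeff (0ℤ ∷ []) k ≡ 0ℤ
  zeros zero    = refl
  zeros (suc k) = refl

coeffs-linear : ∀ a b r k → coeffs ((a ∷ b ∷ []) ⊗ r) k ≡ a ℤ.* coeffs r k ℤ.+ b ℤ.* coeffs r (predᶻ k)
coeffs-linear a b r (pos zero)  = trans (coeff-⊕ (scale a r) _ 0) (cong₂ ℤ._+_ (coeff-scale a r 0) (sym (ℤₚ.*-zeroʳ b)))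
coeffs-linear a b r (pos (suc k)) = trans (coeff-⊕ (scale a r) _ (suc k)) (cong₂ ℤ._+_ (coeff-scale a r (suc k)) (coeff-constant b r k))
coeffs-linear a b r -[1+ k ]  = sym (cong₂ ℤ._+_ (ℤₚ.*-zeroʳ a) (ℤₚ.*-zeroʳ b))

-1*+1* : ∀ a b → ℤ.- ℤ.1ℤ ℤ.* a ℤ.+ ℤ.1ℤ ℤ.* b ≡ b ℤ.- a
-1*+1* a b = trans (cong₂ ℤ._+_ (ℤₚ.-1*i≡-i a) (ℤₚ.*-identityˡ b)) (ℤₚ.+-comm (ℤ.- a) b)

coeffs-U : ∀ p r → coeffs ((qm1 ⊗ p) ⊕ (qP ⊗ r)) ≈ U (coeffs p) (coeffs r)
coeffs-U p r k = trans (coeffs-⊕ (qm1 ⊗ p) (qP ⊗ r) k) (cong₂ ℤ._+_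
  (trans (coeffs-linear (ℤ.- ℤ.1ℤ) ℤ.1ℤ p k) (-1*+1* (coeffs p k) (coeffs p (predᶻ k))))
  (trans (coeffs-linear 0ℤ ℤ.1ℤ r k) (trans (ℤₚ.+-identityˡ _) (ℤₚ.*-identityˡ _))))

coeffs-C : ∀ x p → coeffs (qm1mx x ⊗ p) ≈ χ x (coeffs p)
coeffs-C x=q  p k = trans (coeffs-linear (ℤ.- ℤ.1ℤ) 0ℤ p k) (trans (ℤₚ.+-identityʳ _) (ℤₚ.-1*i≡-i (coeffs p k)))
coeffs-C x=-1 p k = trans (coeffs-linear 0ℤ ℤ.1ℤ p k) (trans (ℤₚ.+-identityˡ _) (ℤₚ.*-identityˡ _))

coeffs-cong : ∀ {p r} → p ≈P r → coeffs p ≈ coeffs r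
coeffs-cong h (pos k)    = h k
coeffs-cong h -[1+ k ] = refl

-- The up-down symmetry.

module Main (n : ℕ) (x : XPar) (Mch : W n → W n → W n)
            (special : ∀ w → Twisted n w → w ≢ e n → SPM n w (Mch w))
            (R : W n → W n → Poly) (isR : IsRFamily n x Mch R) where
  open Instance n using (Elem; word; elem-≡; iota)
  open Twist n
  open Theory iota
  open Hecke x

  ρ : X → X → V
  ρ w u = coeffs (R (word u) (word w))

  special-at : ∀ {w} → w ≢ ê → SPM n (word w) (Mch (word w))
  special-at {w} ne = special (word w) (twisted w) (λ p → ne (elem-≡ p))

  -- The decision is a separate argument so that `choice≡` can analyse it; the identity at `ê` is a
  -- default value.
  choice-by : ∀ w → Dec (w ≡ ê) → X → X
  choice-by w (yes _)  = λ v → v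
  choice-by w (no ne) = Lift.lift {w} (SPM.qspm (special-at ne))

  choice : X → X → X
  choice w = choice-by w (w ≟X ê)

  -- The lift is built from the proof of `w ≢ ê` stored in the decision, which need not be the given
  -- one; hence the existential.
  choice≡ : ∀ {w} → w ≢ ê → Σ (w ≢ ê) λ ne → choice w ≡ Lift.lift {w} (SPM.qspm (special-at ne))
  choice≡ {w} ne = by (w ≟X ê)
    where
    by : (d : Dec (w ≡ ê)) → Σ (w ≢ ê) λ ne → choice-by w d ≡ Lift.lift {w} (SPM.qspm (special-at ne))
    by (yes p)  = ⊥-elim (ne p)
    by (no ne′) = ne′ , refl

  recur-lift : ∀ {u w} (ne : w ≢ ê) → u ⊑ w → let M = Lift.lift {w} (SPM.qspm (special-at ne)) in ρ w u ≈ A M (ρ (M w)) u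
  recur-lift {u} {w} ne u⊑w = by (Matching.local lift-matching u⊑w)
    where
    open Lift {w} (SPM.qspm (special-at ne))
    clauses = proj₂ (proj₂ isR) (word u) (word w) (twisted u) (twisted w) (λ p → ne (elem-≡ p)) u⊑w
    wu : word (lift u) ≡ Mch (word w) (word u)
    wu = lift-word u⊑w
    ww : word (lift w) ≡ Mch (word w) (word w)
    ww = lift-word {w} (⊑-refl {w})
    by : Local lift u → ρ w u ≈ A lift (ρ (lift w)) u
    by (down c) = ≈-trans (coeffs-cong (proj₁ clauses (lift-down⁻ u⊑w c)))
      (≈-reflexive (trans (cong₂ (λ a b → coeffs (R a b)) (sym wu) (sym ww)) (sym (A-down {lift} {ρ (lift w)} {u} c))))
    by (rise c) = ≈-trans (coeffs-cong (proj₁ (proj₂ clauses) (lift-rise⁻ u⊑w c))) (≈-trans (coeffs-U _ _)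
      (≈-reflexive (trans (cong₂ U (cong (λ b → coeffs (R (word u) b)) (sym ww)) (cong₂ (λ a b → coeffs (R a b)) (sym wu) (sym ww)))
        (sym (A-rise {lift} {ρ (lift w)} {u} c)))))
    by (fix p) = ≈-trans (coeffs-cong (proj₂ (proj₂ clauses) (trans (sym wu) (cong word p)))) (≈-trans (coeffs-C x _)
      (≈-reflexive (trans (cong (λ b → χ x (coeffs (R (word u) b))) (sym ww)) (sym (A-fix {lift} {ρ (lift w)} {u} p)))))

  recursive : Recursive ρ
  recursive = record
    { vanish   = λ {u} {w} q → coeffs-cong (proj₁ isR (word u) (word w) (twisted u) (twisted w) q) ∙ zero-coeffs
    ; choice   = choice
    ; matching = λ {w} ne → let (ne′ , eq) = choice≡ ne in subst (Matching (_⊑ w)) (sym eq) (Lift.lift-matching {w} (SPM.qspm (special-at ne′)))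
    ; special  = λ {w} ne → let (ne′ , eq) = choice≡ ne in subst (λ M → M w ⋖ w) (sym eq)
        (Lift.lift-down {w} (SPM.qspm (special-at ne′)) {w} (⊑-refl {w}) (SPM.top (special-at ne′)))
    ; recur    = λ {u} {w} ne u⊑w → let (ne′ , eq) = choice≡ ne in subst (λ M → ρ w u ≈ A M (ρ (M w)) u) (sym eq) (recur-lift ne′ u⊑w)
    }
    where
    _∙_ : ∀ {a b c : V} → a ≈ b → b ≈ c → a ≈ c
    _∙_ = ≈-trans
    zero-coeffs : coeffs 0P ≈ 0V
    zero-coeffs (pos k) = refl
    zero-coeffs -[1+ k ] = refl

  up-down : UpDown n x R
  up-down v M tv v≢e spm u w (tu , u≤v) (tw , w≤v) cu =
      (λ c k → rising c (pos k)) , (λ c k → falling c (pos k)) , (λ p k → fixing p (pos k))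
    where
    v′ u′ w′ : X
    v′ = elem-of tv
    u′ = elem-of tu
    w′ = elem-of tw
    open Lift {v′} (SPM.qspm spm)
    μ : Matching (_⊑ v′) lift
    μ = lift-matching
    u⊑v : u′ ⊑ v′
    u⊑v = u≤v
    w⊑v : w′ ⊑ v′
    w⊑v = w≤v
    u-rise : u′ ⋖ lift u′
    u-rise = lift-rise u⊑v cu
    LL-u : lift (lift u′) ≡ u′
    LL-u = Matching.invol μ u⊑v
    LL-w : lift (lift w′) ≡ w′
    LL-w = Matching.invol μ w⊑v
    Lu-down : lift (lift u′) ⋖ lift u′
    Lu-down = subst (_⋖ lift u′) (sym LL-u) u-rise
    wu : word (lift u′) ≡ M u
    wu = lift-word u⊑v
    ww : word (lift w′) ≡ M w
    ww = lift-word w⊑v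
    -- At `lift u′` the matching goes down, so the operator merely evaluates at `u′`. This converts
    -- the recursion downwards into the symmetry upwards.
    at-Lu : ∀ f → A lift f (lift u′) ≡ f u′
    at-Lu f = trans (A-down {lift} {f} {lift u′} Lu-down) (cong f LL-u)
    -- The equation for `M w`, which `M` lowers to `w`, read at `M u`.
    rising : Cov n w (M w) → coeffs (R u w) ≈ coeffs (R (M u) (M w))
    rising c = ≈-sym (≈-trans (≈-reflexive (cong₂ (λ a b → coeffs (R a b)) (sym wu) (sym ww)))
      (≈-trans (extend-down recursive {v′} {lift w′} μ (all-compatible recursive (lift w′)) (lift-closed w⊑v)
          (subst (_⋖ lift w′) (sym LL-w) (lift-rise w⊑v c)) (lift-closed u⊑v))
        (≈-reflexive (trans (at-Lu (ρ (lift (lift w′)))) (cong (λ y → ρ y u′) LL-w)))))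
    -- The equation for `w` is used twice: at `u` for the expansion, and at `M u` to replace the
    -- value of `M w` at `u` by that of `w` at `M u`.
    falling : Cov n (M w) w → coeffs (R u w) ≈ coeffs ((qm1 ⊗ R (M u) w) ⊕ (qP ⊗ R (M u) (M w)))
    falling c = ≈-trans (ext u⊑v) (≈-trans (≈-reflexive (A-rise {lift} {ρ (lift w′)} {u′} u-rise))
      (≈-trans (U-cong (≈-sym (≈-trans (≈-reflexive (cong (λ a → coeffs (R a w)) (sym wu)))
          (≈-trans (ext (lift-closed u⊑v)) (≈-reflexive (at-Lu (ρ (lift w′)))))))
          (≈-reflexive (cong₂ (λ a b → coeffs (R a b)) wu ww)))
        (≈-sym (coeffs-U (R (M u) w) (R (M u) (M w))))))
      where
      ext : ∀ {y} → y ⊑ v′ → ρ w′ y ≈ A lift (ρ (lift w′)) y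
      ext = extend-down recursive {v′} {w′} μ (all-compatible recursive w′) w⊑v (lift-down {w′} w⊑v c)
    fixing : M w ≡ w → coeffs (R u w) ≈ coeffs (qm1mx x ⊗ R (M u) w)
    fixing p = ≈-trans (≈-reflexive (sym (at-Lu (ρ w′))))
      (≈-trans (extend-fix recursive {v′} {w′} μ (all-compatible recursive w′) w⊑v (elem-≡ (trans ww p)) (lift-closed u⊑v))
        (≈-trans (χ-cong x (≈-reflexive (cong (λ a → coeffs (R a w)) wu))) (≈-sym (coeffs-C x (R (M u) w)))))

theorem3p5 : (n : ℕ) → (x : XPar) →
    (Mch : W n → W n → W n) →
    (∀ w → Twisted n w → w ≢ e n → SPM n w (Mch w)) →
    (R : W n → W n → Poly) → IsRFamily n x Mch R →
    UpDown n x R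
theorem3p5 = Main.up-down
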